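{- Let $p\geq 5$ be a prime. Then the following congruence between $p$-integral rational numbers holds modulo $p$: $$\begin{aligned} \sum_{j=2}^{p-3}\frac{B_j}{2^j}B_{p-1-j}\equiv{}& -1+2\Bigg[\frac{1}{2}\bigg(2\sum_{\substack{m=1\\ m\text{ odd}}}^{p-1}H_m\bigg)_0\Bigg]_1+\Bigg[2\bigg(\sum_{\substack{m=1\\ m\text{ odd}}}^{p-1}H_m\bigg)_0\Bigg]_1\\ &+6\sum_{\substack{m=1\\ m\text{ odd}}}^{p-1}H_m+4\sum_{m=1}^{\frac{p-3}{2}}H_{2m}^{(2)}-4\sum_{m=1}^{\frac{p-3}{2}}H_{2m}H_{2m+1}-4\bigg(\sum_{\substack{m=1\\ m\text{ odd}}}^{p-1}H_m\bigg)^2\\ &+2\sum_{m=2}^{\frac{p-3}{2}}\Big(\frac{H_1}{2m-1}+\frac{H_2}{2m-2}+\dots+\frac{H_{2m-1}}{1}\Big)\pmod p . \end{aligned}$$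
   Context: $B_j$ denotes the $j$-th Bernoulli number (generating function $t/(e^t-1)=\sum_{j\ge 0}B_j t^j/j!$). For integers $k\geq 1$ and $n\ge 1$, $H_k=\sum_{i=1}^k\frac1i$ is the harmonic number and $H_k^{(n)}=\sum_{i=1}^k\frac{1}{i^n}$ is the generalized harmonic number. For a $p$-adic integer $x$ (in particular a rational number whose denominator is prime to $p$), $(x)_i$, also written $[x]_i$, denotes the $(i+1)$-th digit of its Hensel expansion $x=\sum_{i=0}^{\infty}(x)_i\,p^i$ with $(x)_i\in\{0,1,\dots,p-1\}$; thus $(x)_0$ is the residue of $x$ modulo $p$ in $\{0,\dots,p-1\}$, regarded as an integer, and $[x]_1$ is the coefficient of $p$. Congruences modulo $p$ are between rational numbers with denominators prime to $p$ (equivalently, in $\mathbb{Z}_p$). An empty sum is $0$ (this occurs for the last sum over $m$ when $p=5$). -}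

module Defs where

open import Data.Fin.Base using (Fin; toℕ; fromℕ<)
open import Data.Fin.Properties using (any?; toℕ<n; toℕ-fromℕ<)
open import Data.Integer.Base as ℤ using (ℤ; +_)
import Data.Integer.Divisibility.Signed as ℤ∣
import Data.Integer.DivMod as ℤ
import Data.Integer.Properties as ℤ
open import Data.Integer.GCD using (gcd)
open import Data.Integer.Tactic.RingSolver using (solve; solve-∀)
open import Data.List.Base using (List; []; _∷_; foldr; filter; upTo; applyUpTo)
open import Data.Nat.Base as ℕ using (ℕ; zero; suc; _∸_; _^_; _!; NonZero)
open import Data.Nat.Coprimality using (Coprime; coprime?; coprime-divisor; coprime-Bézout)
import Data.Nat.Coprimality as Coprime
open import Data.Nat.Divisibility using (_∣_; _∣?_; divides; ∣-trans; m∣m*n)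
open import Data.Nat.GCD using (module Bézout)
open import Data.Nat.Properties using (_!≢0)
import Data.Nat.Properties as ℕ
open import Data.Product.Base using (_×_; _,_; proj₁; proj₂; ∃)
open import Data.Rational.Base using (ℚ; mkℚ; 0ℚ; 1ℚ; _+_; _*_; _-_; -_; _/_; ↥_; ↧_; ↧ₙ_; toℚᵘ; fromℚᵘ)
open import Data.Rational.Properties as ℚ using ()
open import Data.Rational.Solver using (module +-*-Solver)
import Data.Rational.Unnormalised.Base as ℚᵘ
import Data.Rational.Unnormalised.Properties as ℚᵘ
open import Function.Base using (id; _∘_)
open import Relation.Binary.PropositionalEquality
open import Relation.Nullary using (Dec; yes; no; ¬_; ¬?; contradiction)
open import Relation.Nullary.Decidable using (_×-dec_)

fromℕ : ℕ → ℚ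
fromℕ n = + n / 1

-- Division by a natural number, with the junk value x /ℕ 0 = 0.
infixl 7 _/ℕ_

_/ℕ_ : ℚ → ℕ → ℚ
x /ℕ zero  = 0ℚ
x /ℕ suc n = x * (+ 1 / suc n)

-- a ⋯ b lists a, a + 1, …, b; it is empty if b < a.
infix 5 _⋯_

_⋯_ : ℕ → ℕ → List ℕ
a ⋯ b = applyUpTo (a ℕ.+_) (suc b ∸ a)

odds : List ℕ → List ℕ
odds = filter (λ m → ¬? (2 ∣? m))

∑ : List ℕ → (ℕ → ℚ) → ℚ
∑ xs f = foldr (λ i s → f i + s) 0ℚ xs

infix 5 ∑
syntax ∑ xs (λ i → e) = ∑[ i ∈ xs ] e

H^[_] : ℕ → ℕ → ℚ
H^[ n ] k = ∑[ i ∈ 1 ⋯ k ] 1ℚ /ℕ (i ^ n)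

H : ℕ → ℚ
H k = ∑[ i ∈ 1 ⋯ k ] 1ℚ /ℕ i

-- Comparing coefficients of tⁿ⁺¹ in (eᵗ − 1) · ∑ⱼ bⱼ tʲ = t, where
-- bⱼ = Bⱼ / j!, gives  bₙ = [n = 0] − ∑_{i<n} bₙ₋₁₋ᵢ / (i + 2)!.
-- bernoulliCoeffs n is the list bₙ₋₁ ∷ … ∷ b₀ ∷ [].

weighted : ℕ → List ℚ → ℚ
weighted k []       = 0ℚ
weighted k (b ∷ bs) = b /ℕ (k !) + weighted (suc k) bs

δ₀ : ℕ → ℚ
δ₀ zero    = 1ℚ
δ₀ (suc _) = 0ℚ

bernoulliCoeffs : ℕ → List ℚ
bernoulliCoeff  : ℕ → ℚ

bernoulliCoeffs zero    = []
bernoulliCoeffs (suc n) = bernoulliCoeff n ∷ bernoulliCoeffs n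

bernoulliCoeff n = δ₀ n - weighted 2 (bernoulliCoeffs n)

B : ℕ → ℚ
B n = fromℕ (n !) * bernoulliCoeff n

-- ↥ (x - y) is in lowest terms, so for denominators prime to m this is
-- membership of x - y in m times the ring of such rationals.
infix 4 _≡_[mod_] _≡?_[mod_]

_≡_[mod_] : ℚ → ℚ → ℕ → Set
x ≡ y [mod m ] =
  Coprime (↧ₙ x) m × Coprime (↧ₙ y) m × m ∣ ℤ.∣ ↥ (x - y) ∣

_≡?_[mod_] : ∀ x y m → Dec (x ≡ y [mod m ])
x ≡? y [mod m ] =
  coprime? (↧ₙ x) m ×-dec coprime? (↧ₙ y) m ×-dec (m ∣? ℤ.∣ ↥ (x - y) ∣)

-- x = ∑ᵢ aᵢ pⁱ in the p-adic integers, with every aᵢ in {0, …, p − 1}.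
IsHenselExpansion : ℕ → ℚ → (ℕ → ℕ) → Set
IsHenselExpansion p x a =
  (∀ i → a i ℕ.< p) ×
  (∀ n → x ≡ ∑[ i ∈ upTo n ] fromℕ (a i ℕ.* p ^ i) [mod p ^ n ])

-- residue p x is the r ∈ {0, …, p − 1} with x ≡ r (mod p), and 0 if there is none.

residue? : ∀ p x → Dec (∃ λ (r : Fin p) → x ≡ fromℕ (toℕ r) [mod p ])
residue? p x = any? λ r → x ≡? fromℕ (toℕ r) [mod p ]

witness : ∀ {n} {P : Fin n → Set} → Dec (∃ P) → ℕ
witness (yes (r , _)) = toℕ r
witness (no _)        = 0

residue : ℕ → ℚ → ℕ
residue p x = witness (residue? p x)

-- digit p i x is (x)ᵢ for p-integral x; see digit-isHenselExpansion.

digit : ℕ → ℕ → ℚ → ℕ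
digit p zero    x = residue p x
digit p (suc i) x = digit p i ((x - fromℕ (residue p x)) /ℕ p)

coprime-∣ : ∀ {d n m} → d ∣ n → Coprime n m → Coprime d m
coprime-∣ d∣n c (k∣d , k∣m) = c (∣-trans k∣d d∣n , k∣m)

coprime-* : ∀ {a b m} → Coprime a m → Coprime b m → Coprime (a ℕ.* b) m
coprime-* {a} {b} ca cb {k} (k∣ab , k∣m) = cb (coprime-divisor ck k∣ab , k∣m)
  where
    ck : Coprime k a
    ck (l∣k , l∣a) = ca (l∣a , ∣-trans l∣k k∣m)

coprime-^ : ∀ {a m} n → Coprime a m → Coprime a (m ^ n)
coprime-^ zero    c = Coprime.sym (Coprime.1-coprimeTo _)
coprime-^ (suc n) c = Coprime.sym (coprime-* (Coprime.sym c) (Coprime.sym (coprime-^ n c)))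

↧ₙ-/-∣ : ∀ i n .{{_ : NonZero n}} → ↧ₙ (i / n) ∣ n
↧ₙ-/-∣ i n = divides ℤ.∣ g ∣ (begin
  n                       ≡⟨ cong ℤ.∣_∣ (sym (ℚ.↧-/ i n)) ⟩
  ℤ.∣ ↧ (i / n) ℤ.* g ∣   ≡⟨ ℤ.abs-* (↧ (i / n)) g ⟩
  ↧ₙ (i / n) ℕ.* ℤ.∣ g ∣  ≡⟨ ℕ.*-comm (↧ₙ (i / n)) ℤ.∣ g ∣ ⟩
  ℤ.∣ g ∣ ℕ.* ↧ₙ (i / n)  ∎)
  where
    open ≡-Reasoning
    g : ℤ
    g = gcd i (+ n)

coprime-+ : ∀ {m} x y → Coprime (↧ₙ x) m → Coprime (↧ₙ y) m → Coprime (↧ₙ (x + y)) m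
coprime-+ x@record{} y@record{} cx cy =
  coprime-∣ (↧ₙ-/-∣ (↥ x ℤ.* ↧ y ℤ.+ ↥ y ℤ.* ↧ x) (↧ₙ x ℕ.* ↧ₙ y)) (coprime-* cx cy)

coprime-fromℕ : ∀ {m} n → Coprime (↧ₙ (fromℕ n)) m
coprime-fromℕ n = coprime-∣ (↧ₙ-/-∣ (+ n) 1) (Coprime.1-coprimeTo _)

fromℕ≡ : ∀ n → fromℕ n ≡ mkℚ (+ n) 0 (Coprime.sym (Coprime.1-coprimeTo n))
fromℕ≡ n = ℚ.↥p/↧p≡p (mkℚ (+ n) 0 _)

toℚᵘ-fromℕ : ∀ n → toℚᵘ (fromℕ n) ≡ ℚᵘ.mkℚᵘ (+ n) 0
toℚᵘ-fromℕ n = cong toℚᵘ (fromℕ≡ n)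

fromℕ-* : ∀ m n → fromℕ (m ℕ.* n) ≡ fromℕ m * fromℕ n
fromℕ-* m n rewrite fromℕ≡ m | fromℕ≡ n = ℚ./-cong (ℤ.pos-* m n) refl

fromℕ*/ℕ : ∀ n .{{_ : NonZero n}} x → fromℕ n * x /ℕ n ≡ x
fromℕ*/ℕ (suc n) x = begin
  fromℕ (suc n) * x * (+ 1 / suc n)    ≡⟨ solve³ (fromℕ (suc n)) x (+ 1 / suc n) ⟩
  x * (fromℕ (suc n) * (+ 1 / suc n))  ≡⟨ cong (x *_) inverse ⟩
  x * 1ℚ                               ≡⟨ ℚ.*-identityʳ x ⟩
  x                                    ∎
  where
    open ≡-Reasoning
    open +-*-Solver
    solve³ : ∀ a b c → a * b * c ≡ b * (a * c)
    solve³ = +-*-Solver.solve 3 (λ a b c → a :* b :* c := b :* (a :* c)) refl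
    inverse : fromℕ (suc n) * (+ 1 / suc n) ≡ 1ℚ
    inverse = trans (cong₂ _*_ (fromℕ≡ (suc n)) (ℚ.↥p/↧p≡p (mkℚ (+ 1) n (Coprime.1-coprimeTo _))))
      (ℚ.*-inverseʳ (mkℚ (+ suc n) 0 (Coprime.sym (Coprime.1-coprimeTo (suc n)))))

multiple⇒∣ : ∀ m {w} z → w ≡ fromℕ m * z → Coprime (↧ₙ z) m → m ∣ ℤ.∣ ↥ w ∣
multiple⇒∣ m {w} z w≡mz c = coprime-divisor (Coprime.sym c) (divides ℤ.∣ ↥ z ℤ.* ↧ w ∣ eq′)
  where
    w≃ : toℚᵘ w ℚᵘ.≃ ℚᵘ.mkℚᵘ (+ m) 0 ℚᵘ.* toℚᵘ z
    w≃ = subst₂ (λ a b → toℚᵘ a ℚᵘ.≃ b ℚᵘ.* toℚᵘ z) (sym w≡mz) (toℚᵘ-fromℕ m)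
           (ℚ.toℚᵘ-homo-* (fromℕ m) z)
    cross : ∀ w z → toℚᵘ w ℚᵘ.≃ ℚᵘ.mkℚᵘ (+ m) 0 ℚᵘ.* toℚᵘ z →
            ↧ z ℤ.* ↥ w ≡ (↥ z ℤ.* ↧ w) ℤ.* + m
    cross w@record{} z@record{} (ℚᵘ.*≡* e) = begin
      ↧ z ℤ.* ↥ w                          ≡⟨ ℤ.*-comm (↧ z) (↥ w) ⟩
      ↥ w ℤ.* ↧ z                          ≡⟨ cong (λ d → ↥ w ℤ.* + d) (sym (ℕ.*-identityˡ (↧ₙ z))) ⟩
      ↥ w ℤ.* + (1 ℕ.* ↧ₙ z)               ≡⟨ e ⟩
      (+ m ℤ.* ↥ z) ℤ.* ↧ w                ≡⟨ ring (+ m) (↥ z) (↧ w) ⟩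
      (↥ z ℤ.* ↧ w) ℤ.* + m                ∎
      where
        open ≡-Reasoning
        ring : ∀ a b c → (a ℤ.* b) ℤ.* c ≡ (b ℤ.* c) ℤ.* a
        ring = solve-∀
    eq′ : ↧ₙ z ℕ.* ℤ.∣ ↥ w ∣ ≡ ℤ.∣ ↥ z ℤ.* ↧ w ∣ ℕ.* m
    eq′ = trans (sym (ℤ.abs-* (↧ z) (↥ w)))
      (trans (cong ℤ.∣_∣ (cross w z w≃)) (ℤ.abs-* (↥ z ℤ.* ↧ w) (+ m)))

∣⇒multiple : ∀ m w → Coprime (↧ₙ w) m → m ∣ ℤ.∣ ↥ w ∣ →
             ∃ λ z → w ≡ fromℕ m * z × Coprime (↧ₙ z) m
∣⇒multiple m w@record{} c m∣ with ℤ∣.∣ᵤ⇒∣ {+ m} {↥ w} m∣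
... | ℤ∣.divides q eq = z , ℚ.toℚᵘ-injective w≃mz , coprime-∣ (↧ₙ-/-∣ q (↧ₙ w)) c
  where
    z = q / ↧ₙ w
    w≃mz : toℚᵘ w ℚᵘ.≃ toℚᵘ (fromℕ m * z)
    w≃mz = begin
      toℚᵘ w                                      ≈⟨ ℚᵘ.*≡* cross ⟩
      ℚᵘ.mkℚᵘ (+ m) 0 ℚᵘ.* (q ℚᵘ./ ↧ₙ w)          ≈⟨ ℚᵘ.*-cong (ℚᵘ.≃-reflexive (sym (toℚᵘ-fromℕ m))) (ℚᵘ.≃-sym (ℚ.toℚᵘ-fromℚᵘ (q ℚᵘ./ ↧ₙ w))) ⟩
      toℚᵘ (fromℕ m) ℚᵘ.* toℚᵘ z                  ≈⟨ ℚᵘ.≃-sym (ℚ.toℚᵘ-homo-* (fromℕ m) z) ⟩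
      toℚᵘ (fromℕ m * z)                          ∎
      where
        open import Relation.Binary.Reasoning.Setoid ℚᵘ.≃-setoid
        cross : ↥ w ℤ.* + (1 ℕ.* ↧ₙ w) ≡ (+ m ℤ.* q) ℤ.* ↧ w
        cross = cong₂ ℤ._*_ (trans eq (ℤ.*-comm q (+ m))) (cong +_ (ℕ.*-identityˡ (↧ₙ w)))

inverseMod : ∀ {d p} → Coprime d p → ∃ λ u → ∃ λ v → + 1 ≡ + d ℤ.* u ℤ.+ + p ℤ.* v
inverseMod {d} {p} c with coprime-Bézout c
... | Bézout.+- x y eq = + x , ℤ.- + y , (begin
  + 1                                        ≡⟨ ring (+ 1) (+ y) (+ p) ⟩
  (+ 1 ℤ.+ + y ℤ.* + p) ℤ.+ + p ℤ.* ℤ.- + y  ≡⟨ cong (ℤ._+ + p ℤ.* ℤ.- + y) (cong (λ t → + 1 ℤ.+ t) (sym (ℤ.pos-* y p))) ⟩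
  + (1 ℕ.+ y ℕ.* p) ℤ.+ + p ℤ.* ℤ.- + y      ≡⟨ cong (λ t → + t ℤ.+ + p ℤ.* ℤ.- + y) (trans eq (ℕ.*-comm x d)) ⟩
  + (d ℕ.* x) ℤ.+ + p ℤ.* ℤ.- + y            ≡⟨ cong (ℤ._+ + p ℤ.* ℤ.- + y) (ℤ.pos-* d x) ⟩
  + d ℤ.* + x ℤ.+ + p ℤ.* ℤ.- + y            ∎)
  where
    open ≡-Reasoning
    ring : ∀ a y p → a ≡ (a ℤ.+ y ℤ.* p) ℤ.+ p ℤ.* ℤ.- y
    ring = solve-∀
... | Bézout.-+ x y eq = ℤ.- + x , + y , (begin
  + 1                                        ≡⟨ ring (+ 1) (+ x) (+ d) ⟩
  + d ℤ.* ℤ.- + x ℤ.+ (+ 1 ℤ.+ + x ℤ.* + d)  ≡⟨ cong (λ t → + d ℤ.* ℤ.- + x ℤ.+ t) (cong (λ t → + 1 ℤ.+ t) (sym (ℤ.pos-* x d))) ⟩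
  + d ℤ.* ℤ.- + x ℤ.+ + (1 ℕ.+ x ℕ.* d)      ≡⟨ cong (λ t → + d ℤ.* ℤ.- + x ℤ.+ + t) (trans eq (ℕ.*-comm y p)) ⟩
  + d ℤ.* ℤ.- + x ℤ.+ + (p ℕ.* y)            ≡⟨ cong (λ t → + d ℤ.* ℤ.- + x ℤ.+ t) (ℤ.pos-* p y) ⟩
  + d ℤ.* ℤ.- + x ℤ.+ + p ℤ.* + y            ∎)
  where
    open ≡-Reasoning
    ring : ∀ a x d → a ≡ d ℤ.* ℤ.- x ℤ.+ (a ℤ.+ x ℤ.* d)
    ring = solve-∀

residue-exists : ∀ p .{{_ : NonZero p}} x → Coprime (↧ₙ x) p →
                 ∃ λ (r : Fin p) → x ≡ fromℕ (toℕ r) [mod p ]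
residue-exists p x@record{} c with inverseMod c
... | u , v , bez = fromℕ< r<p , subst (λ r → x ≡ fromℕ r [mod p ]) (sym (toℕ-fromℕ< r<p))
                      (c , coprime-fromℕ r , p∣↥)
  where
    open ≡-Reasoning
    n d k : ℤ
    n = ↥ x
    d = ↧ x
    r : ℕ
    r = (n ℤ.* u) ℤ.%ℕ p
    k = (n ℤ.* u) ℤ./ℕ p
    r<p : r ℕ.< p
    r<p = ℤ.n%ℕd<d (n ℤ.* u) p
    num : n ℤ.+ ℤ.- + r ℤ.* d ≡ (n ℤ.* v ℤ.+ k ℤ.* d) ℤ.* + p
    num = begin
      n ℤ.+ ℤ.- + r ℤ.* d
        ≡⟨ cong (ℤ._+ ℤ.- + r ℤ.* d) (trans (sym (ℤ.*-identityʳ n)) (cong (n ℤ.*_) bez)) ⟩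
      n ℤ.* (d ℤ.* u ℤ.+ + p ℤ.* v) ℤ.+ ℤ.- + r ℤ.* d
        ≡⟨ ring₁ n d u (+ p) v (+ r) ⟩
      (n ℤ.* u) ℤ.* d ℤ.+ (n ℤ.* (+ p ℤ.* v) ℤ.+ ℤ.- + r ℤ.* d)
        ≡⟨ cong (λ t → t ℤ.* d ℤ.+ (n ℤ.* (+ p ℤ.* v) ℤ.+ ℤ.- + r ℤ.* d)) (ℤ.a≡a%ℕn+[a/ℕn]*n (n ℤ.* u) p) ⟩
      (+ r ℤ.+ k ℤ.* + p) ℤ.* d ℤ.+ (n ℤ.* (+ p ℤ.* v) ℤ.+ ℤ.- + r ℤ.* d)
        ≡⟨ ring₂ n d k (+ p) v (+ r) ⟩
      (n ℤ.* v ℤ.+ k ℤ.* d) ℤ.* + p ∎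
      where
        ring₁ : ∀ n d u p v r → n ℤ.* (d ℤ.* u ℤ.+ p ℤ.* v) ℤ.+ ℤ.- r ℤ.* d ≡
                (n ℤ.* u) ℤ.* d ℤ.+ (n ℤ.* (p ℤ.* v) ℤ.+ ℤ.- r ℤ.* d)
        ring₁ = solve-∀
        ring₂ : ∀ n d k p v r → (r ℤ.+ k ℤ.* p) ℤ.* d ℤ.+ (n ℤ.* (p ℤ.* v) ℤ.+ ℤ.- r ℤ.* d) ≡
                (n ℤ.* v ℤ.+ k ℤ.* d) ℤ.* p
        ring₂ = solve-∀
    q : ℤ
    q = n ℤ.* v ℤ.+ k ℤ.* d
    z : ℚ
    z = q / ↧ₙ x
    x-r≃pz : toℚᵘ (x - fromℕ r) ℚᵘ.≃ toℚᵘ (fromℕ p * z)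
    x-r≃pz = R.begin
      toℚᵘ (x - fromℕ r)                           R.≈⟨ ℚ.toℚᵘ-homo-+ x (- fromℕ r) ⟩
      toℚᵘ x ℚᵘ.+ toℚᵘ (- fromℕ r)                 R.≈⟨ ℚᵘ.+-congʳ (toℚᵘ x) (ℚ.toℚᵘ-homo‿- (fromℕ r)) ⟩
      toℚᵘ x ℚᵘ.- toℚᵘ (fromℕ r)                   R.≡⟨ cong (λ t → toℚᵘ x ℚᵘ.- t) (toℚᵘ-fromℕ r) ⟩
      toℚᵘ x ℚᵘ.- ℚᵘ.mkℚᵘ (+ r) 0                  R.≈⟨ ℚᵘ.*≡* cross ⟩
      ℚᵘ.mkℚᵘ (+ p) 0 ℚᵘ.* (q ℚᵘ./ ↧ₙ x)           R.≡⟨ cong (ℚᵘ._* (q ℚᵘ./ ↧ₙ x)) (sym (toℚᵘ-fromℕ p)) ⟩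
      toℚᵘ (fromℕ p) ℚᵘ.* (q ℚᵘ./ ↧ₙ x)            R.≈⟨ ℚᵘ.*-congˡ {toℚᵘ (fromℕ p)} (ℚᵘ.≃-sym (ℚ.toℚᵘ-fromℚᵘ (q ℚᵘ./ ↧ₙ x))) ⟩
      toℚᵘ (fromℕ p) ℚᵘ.* toℚᵘ z                   R.≈⟨ ℚᵘ.≃-sym (ℚ.toℚᵘ-homo-* (fromℕ p) z) ⟩
      toℚᵘ (fromℕ p * z)                           R.∎
      where
        module R where
          open import Relation.Binary.Reasoning.Setoid ℚᵘ.≃-setoid public
        cross : (n ℤ.* + 1 ℤ.+ ℤ.- + r ℤ.* d) ℤ.* + (1 ℕ.* ↧ₙ x) ≡ (+ p ℤ.* q) ℤ.* + (↧ₙ x ℕ.* 1)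
        cross = cong₂ ℤ._*_
          (trans (cong (ℤ._+ ℤ.- + r ℤ.* d) (ℤ.*-identityʳ n)) (trans num (ℤ.*-comm q (+ p))))
          (cong +_ (ℕ.*-comm 1 (↧ₙ x)))
    p∣↥ : p ∣ ℤ.∣ ↥ (x - fromℕ r) ∣
    p∣↥ = multiple⇒∣ p z (ℚ.toℚᵘ-injective x-r≃pz) (coprime-∣ (↧ₙ-/-∣ q (↧ₙ x)) c)

residue-< : ∀ p .{{_ : NonZero p}} x → residue p x ℕ.< p
residue-< p x = go (residue? p x)
  where
    go : {P : Fin p → Set} (r? : Dec (∃ P)) → witness r? ℕ.< p
    go (yes (r , _)) = toℕ<n r
    go (no _)        = ℕ.>-nonZero⁻¹ p

residue-≡ : ∀ p .{{_ : NonZero p}} x → Coprime (↧ₙ x) p → x ≡ fromℕ (residue p x) [mod p ]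
residue-≡ p x c = go (residue? p x)
  where
    go : (r? : Dec (∃ λ (r : Fin p) → x ≡ fromℕ (toℕ r) [mod p ])) → x ≡ fromℕ (witness r?) [mod p ]
    go (yes (_ , x≡r)) = x≡r
    go (no ∄r)         = contradiction (residue-exists p x c) ∄r

coprime-- : ∀ {m} x y → Coprime (↧ₙ x) m → Coprime (↧ₙ y) m → Coprime (↧ₙ (x - y)) m
coprime-- {m} x y cx cy = coprime-+ x (- y) cx (subst (λ d → Coprime d m) (sym ↧ₙ-neg) cy)
  where
    ↧ₙ-neg : ↧ₙ (- y) ≡ ↧ₙ y
    ↧ₙ-neg = cong ℤ.∣_∣ (ℚ.↧-neg y)

∑-applyUpTo : ∀ f g n → ∑ (applyUpTo g n) f ≡ ∑ (upTo n) (f ∘ g)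
∑-applyUpTo f g zero    = refl
∑-applyUpTo f g (suc n) = cong₂ _+_ {x = f (g 0)} refl
  (trans (∑-applyUpTo f (g ∘ suc) n) (sym (∑-applyUpTo (f ∘ g) suc n)))

∑-cong : ∀ {f g} → (∀ i → f i ≡ g i) → ∀ xs → ∑ xs f ≡ ∑ xs g
∑-cong f≡g []       = refl
∑-cong f≡g (x ∷ xs) = cong₂ _+_ (f≡g x) (∑-cong f≡g xs)

∑-*ˡ : ∀ c f xs → ∑ xs (λ i → c * f i) ≡ c * ∑ xs f
∑-*ˡ c f []       = sym (ℚ.*-zeroʳ c)
∑-*ˡ c f (x ∷ xs) = trans (cong₂ _+_ {x = c * f x} refl (∑-*ˡ c f xs)) (sym (ℚ.*-distribˡ-+ c (f x) (∑ xs f)))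

module _ (p : ℕ) .{{_ : NonZero p}} where

  truncation : ℚ → ℕ → ℚ
  truncation x n = ∑[ i ∈ upTo n ] fromℕ (digit p i x ℕ.* p ^ i)

  coprime-truncation : ∀ {m} x n → Coprime (↧ₙ (truncation x n)) m
  coprime-truncation x n = go (upTo n)
    where
      go : ∀ {m} is → Coprime (↧ₙ (∑[ i ∈ is ] fromℕ (digit p i x ℕ.* p ^ i))) m
      go []       = coprime-fromℕ 0
      go (i ∷ is) = coprime-+ (fromℕ (digit p i x ℕ.* p ^ i)) _ (coprime-fromℕ (digit p i x ℕ.* p ^ i)) (go is)

  next : ℚ → ℚ
  next x = (x - fromℕ (residue p x)) /ℕ p

  next-spec : ∀ x → Coprime (↧ₙ x) p →
              x - fromℕ (residue p x) ≡ fromℕ p * next x × Coprime (↧ₙ (next x)) p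
  next-spec x c = go (∣⇒multiple p (x - r)
                       (coprime-- x r c (coprime-fromℕ (residue p x)))
                       (proj₂ (proj₂ (residue-≡ p x c))))
    where
      r : ℚ
      r = fromℕ (residue p x)
      go : (∃ λ z → x - r ≡ fromℕ p * z × Coprime (↧ₙ z) p) →
           x - r ≡ fromℕ p * next x × Coprime (↧ₙ (next x)) p
      go (z , eq , cz) = trans eq (cong (fromℕ p *_) (sym next≡z)) ,
                         subst (λ t → Coprime (↧ₙ t) p) (sym next≡z) cz
        where
          next≡z : next x ≡ z
          next≡z = trans (cong (_/ℕ p) eq) (fromℕ*/ℕ p z)

  truncation-suc : ∀ x n → truncation x (suc n) ≡ fromℕ (residue p x) + fromℕ p * truncation (next x) n
  truncation-suc x n = cong₂ _+_ (cong fromℕ (ℕ.*-identityʳ (residue p x))) (begin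
    ∑[ i ∈ applyUpTo suc n ] term i                                    ≡⟨ ∑-applyUpTo term suc n ⟩
    ∑[ i ∈ upTo n ] term (suc i)                                       ≡⟨ ∑-cong shift (upTo n) ⟩
    ∑[ i ∈ upTo n ] fromℕ p * fromℕ (digit p i (next x) ℕ.* p ^ i)     ≡⟨ ∑-*ˡ (fromℕ p) _ (upTo n) ⟩
    fromℕ p * truncation (next x) n                                    ∎)
    where
      open ≡-Reasoning
      term : ℕ → ℚ
      term i = fromℕ (digit p i x ℕ.* p ^ i)
      shift : ∀ i → term (suc i) ≡ fromℕ p * fromℕ (digit p i (next x) ℕ.* p ^ i)
      shift i = trans (cong fromℕ (*-swap (digit p i (next x)) p (p ^ i)))
                      (fromℕ-* p (digit p i (next x) ℕ.* p ^ i))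
        where
          *-swap : ∀ a b c → a ℕ.* (b ℕ.* c) ≡ b ℕ.* (a ℕ.* c)
          *-swap a b c = trans (sym (ℕ.*-assoc a b c))
            (trans (cong (ℕ._* c) (ℕ.*-comm a b)) (ℕ.*-assoc b a c))

  remainder : ∀ n x → Coprime (↧ₙ x) p →
              ∃ λ z → x - truncation x n ≡ fromℕ (p ^ n) * z × Coprime (↧ₙ z) p
  remainder zero    x c = x , trans (ℚ.+-identityʳ x) (sym (ℚ.*-identityˡ x)) , c
  remainder (suc n) x c = z , eq , proj₂ (proj₂ ih)
    where
      x-r≡px′ = proj₁ (next-spec x c)
      ih = remainder n (next x) (proj₂ (next-spec x c))
      z = proj₁ ih
      x′-t≡pⁿz = proj₁ (proj₂ ih)
      open ≡-Reasoning
      open +-*-Solver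
      r P t : ℚ
      r = fromℕ (residue p x)
      P = fromℕ p
      t = truncation (next x) n
      eq : x - truncation x (suc n) ≡ fromℕ (p ^ suc n) * z
      eq = begin
        x - truncation x (suc n)   ≡⟨ cong (λ s → x - s) (truncation-suc x n) ⟩
        x - (r + P * t)            ≡⟨ +-*-Solver.solve 3 (λ x r a → x :- (r :+ a) := (x :- r) :- a) refl x r (P * t) ⟩
        (x - r) - P * t            ≡⟨ cong (λ s → s - P * t) x-r≡px′ ⟩
        P * next x - P * t         ≡⟨ +-*-Solver.solve 3 (λ P y t → P :* y :- P :* t := P :* (y :- t)) refl P (next x) t ⟩
        P * (next x - t)           ≡⟨ cong (P *_) x′-t≡pⁿz ⟩
        P * (fromℕ (p ^ n) * z)    ≡⟨ sym (ℚ.*-assoc P (fromℕ (p ^ n)) z) ⟩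
        P * fromℕ (p ^ n) * z      ≡⟨ cong (_* z) (sym (fromℕ-* p (p ^ n))) ⟩
        fromℕ (p ^ suc n) * z      ∎

  digit-< : ∀ i x → digit p i x ℕ.< p
  digit-< zero    x = residue-< p x
  digit-< (suc i) x = digit-< i (next x)

  digit-isHenselExpansion : ∀ x → Coprime (↧ₙ x) p → IsHenselExpansion p x (λ i → digit p i x)
  digit-isHenselExpansion x c = (λ i → digit-< i x) , λ n →
    let z , eq , cz = remainder n x c in
    coprime-^ n c , coprime-truncation x n , multiple⇒∣ (p ^ n) z eq (coprime-^ n cz)

weighted-∑ : ∀ k n → weighted k (bernoulliCoeffs n) ≡
             ∑[ i ∈ upTo n ] bernoulliCoeff (n ∸ suc i) /ℕ ((k ℕ.+ i) !)
weighted-∑ k zero    = refl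
weighted-∑ k (suc n) = cong₂ _+_
  (cong (λ j → bernoulliCoeff n /ℕ (j !)) (sym (ℕ.+-identityʳ k)))
  (trans (weighted-∑ (suc k) n)
  (trans (∑-cong (λ i → cong (λ j → bernoulliCoeff (n ∸ suc i) /ℕ (j !)) (sym (ℕ.+-suc k i))) (upTo n))
         (sym (∑-applyUpTo (λ i → bernoulliCoeff (n ∸ i) /ℕ ((k ℕ.+ i) !)) suc n))))

-- The Cauchy product of coefficient sequences.
infixl 7 _⊛_

_⊛_ : (ℕ → ℚ) → (ℕ → ℚ) → ℕ → ℚ
(f ⊛ g) n = ∑[ i ∈ 0 ⋯ n ] f i * g (n ∸ i)

-- The coefficient sequences of eᵗ − 1 and of t.
expm1 𝑡 : ℕ → ℚ
expm1 zero    = 0ℚ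
expm1 (suc n) = 1ℚ /ℕ (suc n !)
𝑡 1 = 1ℚ
𝑡 _ = 0ℚ

B/! : ∀ n → B n /ℕ (n !) ≡ bernoulliCoeff n
B/! n = fromℕ*/ℕ (n !) {{n !≢0}} (bernoulliCoeff n)

1/ℕ-* : ∀ k x → 1ℚ /ℕ k * x ≡ x /ℕ k
1/ℕ-* zero    x = ℚ.*-zeroˡ x
1/ℕ-* (suc k) x = trans (cong (_* x) (ℚ.*-identityˡ (+ 1 / suc k))) (ℚ.*-comm (+ 1 / suc k) x)

-- (eᵗ − 1) · ∑ⱼ Bⱼ tʲ / j! = t as formal power series.
B-generatingFunction : ∀ n → (expm1 ⊛ (λ j → B j /ℕ (j !))) n ≡ 𝑡 n
B-generatingFunction zero    = refl
B-generatingFunction (suc n) = begin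
  (expm1 ⊛ b) (suc n)
    ≡⟨ cong₂ _+_ (ℚ.*-zeroˡ (b (suc n))) (cong₂ _+_ (term 1 n) (∑-applyUpTo (λ i → expm1 i * b (suc n ∸ i)) (suc ∘ suc) n)) ⟩
  0ℚ + (bernoulliCoeff n /ℕ 1 + (∑[ i ∈ upTo n ] expm1 (2 ℕ.+ i) * b (n ∸ suc i)))
    ≡⟨ ℚ.+-identityˡ _ ⟩
  bernoulliCoeff n /ℕ 1 + (∑[ i ∈ upTo n ] expm1 (2 ℕ.+ i) * b (n ∸ suc i))
    ≡⟨ cong₂ _+_ (ℚ.*-identityʳ (bernoulliCoeff n)) (∑-cong (λ i → term (2 ℕ.+ i) (n ∸ suc i)) (upTo n)) ⟩
  bernoulliCoeff n + (∑[ i ∈ upTo n ] bernoulliCoeff (n ∸ suc i) /ℕ ((2 ℕ.+ i) !))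
    ≡⟨ cong₂ _+_ {x = bernoulliCoeff n} refl (sym (weighted-∑ 2 n)) ⟩
  (δ₀ n - w) + w
    ≡⟨ +-*-Solver.solve 2 (λ d w → (d :- w) :+ w := d) refl (δ₀ n) w ⟩
  δ₀ n
    ≡⟨ δ₀≡𝑡 n ⟩
  𝑡 (suc n) ∎
  where
    open ≡-Reasoning
    open +-*-Solver
    b : ℕ → ℚ
    b j = B j /ℕ (j !)
    w : ℚ
    w = weighted 2 (bernoulliCoeffs n)
    term : ∀ k j → 1ℚ /ℕ (k !) * b j ≡ bernoulliCoeff j /ℕ (k !)
    term k j = trans (1/ℕ-* (k !) (b j)) (cong (_/ℕ (k !)) (B/! j))
    δ₀≡𝑡 : ∀ n → δ₀ n ≡ 𝑡 (suc n)
    δ₀≡𝑡 zero    = refl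
    δ₀≡𝑡 (suc _) = refl

{-# OPTIONS --safe #-}
module Submission where

-- All congruences are modulo p; O denotes ∑ 1/m over the odd m < p, and S the sum of Hₘ over these m.
--
-- Let F(t) = t/(eᵗ − 1) = ∑ Bₙ tⁿ/n! and G(t) = F(t/2). Then G F = G² − t F/4 and F² = F − t F − t F′,
-- so ∑ⱼ C(p−1, j) 2⁻ʲ Bⱼ B₍ₚ₋₁₋ⱼ₎ is an explicit multiple of B₍ₚ₋₁₎. Since C(p−1, j) ≡ (−1)ʲ, p B₍ₚ₋₁₎ ≡ −1
-- and (2ᵖ⁻¹ − 1)/p ≡ O, the left-hand side is ≡ O + 1.
--
-- On the right, 2S ≡ O + 1, the inner sums H₁/(n−1) + … + H₍ₙ₋₁₎/1 equal Hₙ² − Hₙ⁽²⁾, and summation by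
-- parts together with the reflection i ↦ p − i reduces everything to O and to V′ = ∑ 1/(i j) over
-- odd j < even i < p. Partial fractions give 2V′ = ∑ 1/(j k) over odd j, k with j + k < p, which
-- reflection (k = p − i) turns into −V′; hence 3V′ ≡ 0. The two digit terms cancel each other.

open import Defs
open import Algebra.Bundles using (CommutativeRing)
import Algebra.Solver.Ring
open import Algebra.Solver.Ring.AlmostCommutativeRing using (_-Raw-AlmostCommutative⟶_; fromCommutativeRing)
import Data.Integer.Base as ℤ
import Data.Integer.Properties as ℤ
open import Data.List.Base as List using (applyUpTo)
open import Data.List.Properties using (filter-accept; filter-reject)
import Data.Maybe.Base as Maybe
open import Data.Nat using (ℕ; zero; suc; _≥_; _∸_; _^_; _!; s≤s; z≤n; NonZero)
  renaming (_+_ to _+ℕ_; _*_ to _*ℕ_; _/_ to _/₀_; _<_ to _<ℕ_; _≤_ to _≤ℕ_)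
open import Data.Nat.Coprimality using (Coprime)
import Data.Nat.Coprimality as Coprime
open import Data.Nat.Divisibility using (_∣_; _∣?_; divides; ∣⇒≤; ∣1⇒≡1; ∣m+n∣m⇒∣n; m∣m*n)
open import Data.Nat.DivMod using (m*n/n≡m)
open import Data.Nat.Primality using (Prime; prime⇒nonZero; prime⇒irreducible)
import Data.Nat.Properties as ℕ
open import Data.Nat.Properties using (_!≢0)
open import Data.Product using (_×_; _,_; proj₂; ∃)
open import Data.Rational using (ℚ; _+_; _*_; _-_; -_; 0ℚ; ½; 1ℚ; _/_; ↥_; ↧ₙ_)
import Data.Rational.Properties as ℚ
open import Data.Rational.Solver using (module +-*-Solver)
open import Data.Sum using (_⊎_; inj₁; inj₂)
open import Function using (_∘_)
open import Level using (0ℓ)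
open import Relation.Binary.PropositionalEquality
open import Relation.Nullary using (Dec; yes; no; ¬_; ¬?; contradiction)
open import Relation.Nullary.Decidable using (dec⇒maybe)
open +-*-Solver using (solve; _:+_; _:*_; _:-_; :-_; _:=_; con)
open ≡-Reasoning

-- B₍ₚ₋₁₎ has p in its denominator, so the full convolution cannot be reduced modulo p as it stands.
-- Its terms j = 0 and j = p - 1 carry B₍ₚ₋₁₎, the terms j = 1 and j = p - 2 vanish with B₍ₚ₋₂₎, and
-- the rest is the wanted sum. Writing 1 = 2ᵖ⁻¹ · 2⁻⁽ᵖ⁻¹⁾ and 2ᵖ⁻¹ = 1 + p q rearranges the exact
-- identity until B₍ₚ₋₁₎ occurs only as p B₍ₚ₋₁₎. The signs (-1)ʲ disappear because (-1)ʲ Bⱼ = Bⱼ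
-- for j ≥ 2. G F is traded for G² because G² is F² at t/2, which the identity for F² evaluates; the
-- correction t F/4 has a multiple of B₍ₚ₋₂₎ = 0 as its coefficient. On the right, terms at even
-- indices are rewritten at the next odd index. A sum over even and a sum over odd indices together
-- form a complete sum below p - 1, with a closed form in H₍ₚ₋₁₎ ≡ 0 and H₍ₚ₋₁₎⁽²⁾ ≡ 0. Divisions by
-- 2 and by 3 use p ≥ 5.

2ℚ : ℚ
2ℚ = 1ℚ + 1ℚ

-- Uses a hypothesis `u ≡ v` inside a ring identity: `c` is the cofactor of `u - v`, and the last
-- argument is left to the ring solver.
from-difference : ∀ {x y u v} c → u ≡ v → x - y ≡ c * (u - v) → x ≡ y
from-difference {x} {y} {u} {v} c u≡v eq = begin
  x                ≡⟨ solve 2 (λ x y → x := (x :- y) :+ y) refl x y ⟩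
  (x - y) + y      ≡⟨ cong (_+ y) (trans eq (cong (λ t → c * (t - v)) u≡v)) ⟩
  c * (v - v) + y  ≡⟨ solve 3 (λ c v y → c :* (v :- v) :+ y := y) refl c v y ⟩
  y                ∎

-- Natural numbers and their reciprocals in ℚ

fromℕ-+ : ∀ m n → fromℕ (m +ℕ n) ≡ fromℕ m + fromℕ n
fromℕ-+ m n rewrite fromℕ≡ m | fromℕ≡ n =
  ℚ./-cong (trans (ℤ.pos-+ m n) (sym (cong₂ ℤ._+_ (ℤ.*-identityʳ (ℤ.+ m)) (ℤ.*-identityʳ (ℤ.+ n))))) refl

fromℕ-suc : ∀ n → fromℕ (suc n) ≡ 1ℚ + fromℕ n
fromℕ-suc n = fromℕ-+ 1 n

inv : ℕ → ℚ
inv k = 1ℚ /ℕ k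

inv-inverse : ∀ n .{{_ : NonZero n}} → fromℕ n * inv n ≡ 1ℚ
inv-inverse (suc n) = trans (solve 2 (λ a b → a :* (con 1ℚ :* b) := (a :* con 1ℚ) :* b) refl (fromℕ (suc n)) _)
  (fromℕ*/ℕ (suc n) 1ℚ)

/ℕ-inv : ∀ x n → x /ℕ n ≡ inv n * x
/ℕ-inv x n = sym (1/ℕ-* n x)

inv-unique : ∀ n .{{_ : NonZero n}} {x} → fromℕ n * x ≡ 1ℚ → x ≡ inv n
inv-unique n {x} nx≡1 = from-difference (inv n) (trans nx≡1 (sym (inv-inverse n)))
  (from-difference (inv n - x) (inv-inverse n)
    (solve 3 (λ n x i → (x :- i) :- i :* (n :* x :- n :* i) := (i :- x) :* (n :* i :- con 1ℚ)) refl (fromℕ n) x (inv n)))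

inv-* : ∀ m n .{{_ : NonZero m}} .{{_ : NonZero n}} → inv (m *ℕ n) ≡ inv m * inv n
inv-* m n {{m≢0}} {{n≢0}} = sym (inv-unique (m *ℕ n) {{ℕ.m*n≢0 m n}} (begin
  fromℕ (m *ℕ n) * (inv m * inv n)        ≡⟨ cong (_* (inv m * inv n)) (fromℕ-* m n) ⟩
  fromℕ m * fromℕ n * (inv m * inv n)     ≡⟨ solve 4 (λ a b c d → a :* b :* (c :* d) := (a :* c) :* (b :* d)) refl (fromℕ m) (fromℕ n) (inv m) (inv n) ⟩
  fromℕ m * inv m * (fromℕ n * inv n)     ≡⟨ cong₂ _*_ (inv-inverse m) (inv-inverse n) ⟩
  1ℚ ∎))

-- Partial fractions. With m + n fixed this evaluates convolutions of reciprocals; with m + n = p it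
-- gives the reflection 1/m ≡ -1/n.
inv-+ : ∀ m n .{{_ : NonZero m}} .{{_ : NonZero n}} → fromℕ (m +ℕ n) * (inv m * inv n) ≡ inv m + inv n
inv-+ m n = begin
  fromℕ (m +ℕ n) * (inv m * inv n)
    ≡⟨ cong (_* (inv m * inv n)) (fromℕ-+ m n) ⟩
  (fromℕ m + fromℕ n) * (inv m * inv n)
    ≡⟨ solve 4 (λ a b c d → (a :+ b) :* (c :* d) := (a :* c) :* d :+ (b :* d) :* c) refl (fromℕ m) (fromℕ n) (inv m) (inv n) ⟩
  fromℕ m * inv m * inv n + fromℕ n * inv n * inv m
    ≡⟨ cong₂ (λ a b → a * inv n + b * inv m) (inv-inverse m) (inv-inverse n) ⟩
  1ℚ * inv n + 1ℚ * inv m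
    ≡⟨ solve 2 (λ a b → con 1ℚ :* b :+ con 1ℚ :* a := a :+ b) refl (inv m) (inv n) ⟩
  inv m + inv n ∎

-- Finite sums

-- The last term is split off, as in the recursions for `H` and `H^[ 2 ]`, whereas `∑` over a list
-- splits off the first; `∑-Σ` passes between them.
Σ< : ℕ → (ℕ → ℚ) → ℚ
Σ< zero    f = 0ℚ
Σ< (suc n) f = Σ< n f + f n

Σ-cong : ∀ n {f g} → (∀ i → i <ℕ n → f i ≡ g i) → Σ< n f ≡ Σ< n g
Σ-cong zero    f≡g = refl
Σ-cong (suc n) f≡g = cong₂ _+_ (Σ-cong n λ i i<n → f≡g i (ℕ.m<n⇒m<1+n i<n)) (f≡g n ℕ.≤-refl)

Σ-+ : ∀ n f g → Σ< n (λ i → f i + g i) ≡ Σ< n f + Σ< n g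
Σ-+ zero    f g = refl
Σ-+ (suc n) f g = trans (cong (_+ (f n + g n)) (Σ-+ n f g))
  (solve 4 (λ a b c d → (a :+ b) :+ (c :+ d) := (a :+ c) :+ (b :+ d)) refl (Σ< n f) (Σ< n g) (f n) (g n))

Σ-*ˡ : ∀ n c f → Σ< n (λ i → c * f i) ≡ c * Σ< n f
Σ-*ˡ zero    c f = sym (ℚ.*-zeroʳ c)
Σ-*ˡ (suc n) c f = trans (cong (_+ c * f n) (Σ-*ˡ n c f)) (sym (ℚ.*-distribˡ-+ c (Σ< n f) (f n)))

Σ-head : ∀ n f → Σ< (suc n) f ≡ f 0 + Σ< n (f ∘ suc)
Σ-head zero    f = ℚ.+-comm 0ℚ (f 0)
Σ-head (suc n) f = trans (cong (_+ f (suc n)) (Σ-head n f)) (ℚ.+-assoc (f 0) (Σ< n (f ∘ suc)) (f (suc n)))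

Σ-split : ∀ m n f → Σ< (m +ℕ n) f ≡ Σ< m f + Σ< n (λ i → f (m +ℕ i))
Σ-split m zero    f rewrite ℕ.+-identityʳ m = sym (ℚ.+-identityʳ (Σ< m f))
Σ-split m (suc n) f rewrite ℕ.+-suc m n =
  trans (cong (_+ f (m +ℕ n)) (Σ-split m n f)) (ℚ.+-assoc (Σ< m f) _ _)

Σ-reverse : ∀ n f → Σ< n f ≡ Σ< n (λ i → f (n ∸ suc i))
Σ-reverse zero    f = refl
Σ-reverse (suc n) f = trans (cong (_+ f n) (Σ-reverse n f))
  (trans (ℚ.+-comm _ (f n)) (sym (Σ-head n (λ i → f (n ∸ i)))))

2*suc : ∀ n → 2 *ℕ suc n ≡ suc (suc (2 *ℕ n))
2*suc n = ℕ.*-suc 2 n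

Σ-pairs : ∀ n f → Σ< (2 *ℕ n) f ≡ Σ< n (λ i → f (2 *ℕ i)) + Σ< n (λ i → f (suc (2 *ℕ i)))
Σ-pairs zero    f = refl
Σ-pairs (suc n) f = trans (cong (λ k → Σ< k f) (2*suc n)) (trans (cong (λ s → s + f (2 *ℕ n) + f (suc (2 *ℕ n))) (Σ-pairs n f))
  (solve 4 (λ a b c d → a :+ b :+ c :+ d := (a :+ c) :+ (b :+ d)) refl
    (Σ< n (λ i → f (2 *ℕ i))) (Σ< n (λ i → f (suc (2 *ℕ i)))) (f (2 *ℕ n)) (f (suc (2 *ℕ n)))))

∑-Σ : ∀ n g f → ∑ (applyUpTo g n) f ≡ Σ< n (f ∘ g)
∑-Σ zero    g f = refl
∑-Σ (suc n) g f = trans (cong (f (g 0) +_) (∑-Σ n (g ∘ suc) f)) (sym (Σ-head n (f ∘ g)))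

-- The enumeration `g` is arbitrary so that the induction can shift it by two, accepting one entry
-- and rejecting the next.
∑-odds : ∀ n g f → (∀ i → ¬ 2 ∣ g (2 *ℕ i)) → (∀ i → 2 ∣ g (suc (2 *ℕ i))) →
         ∑ (odds (applyUpTo g (2 *ℕ n))) f ≡ Σ< n (λ i → f (g (2 *ℕ i)))
∑-odds zero    g f odd even = refl
∑-odds (suc n) g f odd even = begin
  ∑ (odds (applyUpTo g (2 *ℕ suc n))) f
    ≡⟨ cong (λ k → ∑ (odds (applyUpTo g k)) f) (2*suc n) ⟩
  ∑ (odds (applyUpTo g (suc (suc (2 *ℕ n))))) f
    ≡⟨ cong (λ xs → ∑ xs f) (trans (filter-accept odd? (odd 0))
         (cong (g 0 List.∷_) (filter-reject odd? {xs = applyUpTo (g ∘ suc ∘ suc) (2 *ℕ n)} (λ ¬e → ¬e (even 0))))) ⟩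
  f (g 0) + ∑ (odds (applyUpTo (g ∘ suc ∘ suc) (2 *ℕ n))) f
    ≡⟨ cong (f (g 0) +_) (∑-odds n (g ∘ suc ∘ suc) f
         (λ i → subst (λ k → ¬ 2 ∣ g k) (2*suc i) (odd (suc i)))
         (λ i → subst (λ k → 2 ∣ g (suc k)) (2*suc i) (even (suc i)))) ⟩
  f (g 0) + Σ< n (λ i → f (g (suc (suc (2 *ℕ i)))))
    ≡⟨ cong (f (g 0) +_) (Σ-cong n (λ i _ → cong (f ∘ g) (sym (2*suc i)))) ⟩
  f (g 0) + Σ< n (λ i → f (g (2 *ℕ suc i)))
    ≡⟨ sym (Σ-head n _) ⟩
  Σ< (suc n) (λ i → f (g (2 *ℕ i))) ∎
  where
    odd? : ∀ m → Dec (¬ 2 ∣ m)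
    odd? m = ¬? (2 ∣? m)

-- Both sides sum a l · b l′ over l + l′ < n, by diagonals and by columns. The induction appends the
-- column l = n, still empty, and then the diagonal l + l′ = n.
Σ-triangle : ∀ n (a b : ℕ → ℚ) → Σ< n (λ m → Σ< (suc m) (λ l → a l * b (m ∸ l))) ≡ Σ< n (λ l → a l * Σ< (n ∸ l) b)
Σ-triangle zero    a b = refl
Σ-triangle (suc n) a b = begin
  Σ< n (λ m → Σ< (suc m) (λ l → a l * b (m ∸ l))) + Σ< (suc n) (λ l → a l * b (n ∸ l))
    ≡⟨ cong (_+ Σ< (suc n) (λ l → a l * b (n ∸ l))) (trans (Σ-triangle n a b) (sym last)) ⟩
  Σ< (suc n) (λ l → a l * Σ< (n ∸ l) b) + Σ< (suc n) (λ l → a l * b (n ∸ l))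
    ≡⟨ sym (Σ-+ (suc n) _ _) ⟩
  Σ< (suc n) (λ l → a l * Σ< (n ∸ l) b + a l * b (n ∸ l))
    ≡⟨ Σ-cong (suc n) (λ { l (s≤s l≤n) → trans (sym (ℚ.*-distribˡ-+ (a l) _ _))
         (cong (λ k → a l * Σ< k b) (sym (ℕ.+-∸-assoc 1 l≤n))) }) ⟩
  Σ< (suc n) (λ l → a l * Σ< (suc n ∸ l) b) ∎
  where
    last : Σ< (suc n) (λ l → a l * Σ< (n ∸ l) b) ≡ Σ< n (λ l → a l * Σ< (n ∸ l) b)
    last rewrite ℕ.n∸n≡0 n = trans (cong (Σ< n (λ l → a l * Σ< (n ∸ l) b) +_) (ℚ.*-zeroʳ (a n))) (ℚ.+-identityʳ _)

-- `c` stands for the constant sum of the two denominators, so the hypothesis is partial fractions;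
-- reversing the summation makes both halves equal.
Σ-conv : ∀ n c (a : ℕ → ℚ) → (∀ i → i <ℕ n → c * (a i * a (n ∸ suc i)) ≡ a i + a (n ∸ suc i)) →
         c * Σ< n (λ i → a i * a (n ∸ suc i)) ≡ Σ< n a + Σ< n a
Σ-conv n c a eq = begin
  c * Σ< n (λ i → a i * a (n ∸ suc i))         ≡⟨ sym (Σ-*ˡ n c _) ⟩
  Σ< n (λ i → c * (a i * a (n ∸ suc i)))       ≡⟨ Σ-cong n eq ⟩
  Σ< n (λ i → a i + a (n ∸ suc i))             ≡⟨ Σ-+ n a _ ⟩
  Σ< n a + Σ< n (λ i → a (n ∸ suc i))          ≡⟨ cong (Σ< n a +_) (sym (Σ-reverse n a)) ⟩
  Σ< n a + Σ< n a                              ∎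

-- Harmonic numbers

H-Σ : ∀ n → H n ≡ Σ< n (λ i → inv (suc i))
H-Σ n = ∑-Σ n suc inv

H²-Σ : ∀ n → H^[ 2 ] n ≡ Σ< n (λ i → inv (suc i) * inv (suc i))
H²-Σ n = trans (∑-Σ n suc (λ i → inv (i ^ 2))) (Σ-cong n λ i _ →
  trans (cong (λ k → inv (suc i *ℕ k)) (ℕ.*-identityʳ (suc i))) (inv-* (suc i) (suc i)))

H-suc : ∀ n → H (suc n) ≡ H n + inv (suc n)
H-suc n = trans (H-Σ (suc n)) (cong (_+ inv (suc n)) (sym (H-Σ n)))

H²-suc : ∀ n → H^[ 2 ] (suc n) ≡ H^[ 2 ] n + inv (suc n) * inv (suc n)
H²-suc n = trans (H²-Σ (suc n)) (cong (_+ inv (suc n) * inv (suc n)) (sym (H²-Σ n)))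

-- Here ν n = n, a n = 1/(n + 1), h = H and g = H⁽²⁾, known only through their recursions. The
-- closed forms for sums of h, g and h² are summation by parts; each induction step is a polynomial
-- identity modulo (n + 1) a n = 1.
module Harmonic (ν a h g : ℕ → ℚ)
  (ν-zero : ν 0 ≡ 0ℚ) (ν-suc : ∀ n → ν (suc n) ≡ 1ℚ + ν n) (ν*a : ∀ n → ν (suc n) * a n ≡ 1ℚ)
  (h-zero : h 0 ≡ 0ℚ) (h-suc : ∀ n → h (suc n) ≡ h n + a n)
  (g-zero : g 0 ≡ 0ℚ) (g-suc : ∀ n → g (suc n) ≡ g n + a n * a n) where

  private
    inverse : ∀ n → (1ℚ + ν n) * a n ≡ 1ℚ
    inverse n = trans (cong (_* a n) (sym (ν-suc n))) (ν*a n)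

  Σ-h : ∀ n → Σ< n h ≡ ν n * (h n - 1ℚ)
  Σ-h zero    rewrite ν-zero | h-zero = refl
  Σ-h (suc n) rewrite Σ-h n | h-suc n | ν-suc n = from-difference (- 1ℚ) (inverse n)
    (solve 3 (λ n h r → n :* (h :- con 1ℚ) :+ h :- (con 1ℚ :+ n) :* (h :+ r :- con 1ℚ)
       := con (- 1ℚ) :* ((con 1ℚ :+ n) :* r :- con 1ℚ)) refl (ν n) (h n) (a n))

  Σ-g : ∀ n → Σ< n g ≡ ν n * g n - h n
  Σ-g zero    rewrite ν-zero | h-zero | g-zero = refl
  Σ-g (suc n) rewrite Σ-g n | g-suc n | h-suc n | ν-suc n = from-difference (- a n) (inverse n)
    (solve 4 (λ n h g r → n :* g :- h :+ g :- ((con 1ℚ :+ n) :* (g :+ r :* r) :- (h :+ r))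
       := :- r :* ((con 1ℚ :+ n) :* r :- con 1ℚ)) refl (ν n) (h n) (g n) (a n))

  Σ-hh : ∀ n → Σ< n (λ k → h k * h k) ≡ ν n * (h n * h n) - (2ℚ * ν n + 1ℚ) * h n + 2ℚ * ν n
  Σ-hh zero    rewrite ν-zero | h-zero = refl
  -- The cofactor is the quotient of the difference of both sides by (n + 1) a n - 1.
  Σ-hh (suc n) rewrite Σ-hh n | h-suc n | ν-suc n = from-difference (- (2ℚ * h n + a n - 2ℚ)) (inverse n)
    (solve 3 (λ n h r → n :* (h :* h) :- (con 2ℚ :* n :+ con 1ℚ) :* h :+ con 2ℚ :* n :+ h :* h
       :- ((con 1ℚ :+ n) :* ((h :+ r) :* (h :+ r)) :- (con 2ℚ :* (con 1ℚ :+ n) :+ con 1ℚ) :* (h :+ r) :+ con 2ℚ :* (con 1ℚ :+ n))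
       := :- (con 2ℚ :* h :+ r :- con 2ℚ) :* ((con 1ℚ :+ n) :* r :- con 1ℚ)) refl (ν n) (h n) (a n))

  -- The summand is the increment of h² minus (a m)², the increment of g.
  telescope : ∀ n → Σ< n (λ m → a m * (h m + h m)) ≡ h n * h n - g n
  telescope zero    rewrite h-zero | g-zero = refl
  telescope (suc n) rewrite telescope n | h-suc n | g-suc n =
    solve 3 (λ h g r → h :* h :- g :+ r :* (h :+ h) := (h :+ r) :* (h :+ r) :- (g :+ r :* r)) refl
      (h n) (g n) (a n)

open Harmonic fromℕ (inv ∘ suc) H (H^[ 2 ]) refl fromℕ-suc (λ n → inv-inverse (suc n)) refl H-suc refl H²-suc public

by-inv : ∀ n .{{_ : NonZero n}} {x y} → fromℕ n * x ≡ y → x ≡ inv n * y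
by-inv n {x} {y} nx≡y = begin
  x                    ≡⟨ sym (ℚ.*-identityˡ x) ⟩
  1ℚ * x               ≡⟨ cong (_* x) (sym (inv-inverse n)) ⟩
  fromℕ n * inv n * x  ≡⟨ solve 3 (λ n i x → n :* i :* x := i :* (n :* x)) refl (fromℕ n) (inv n) x ⟩
  inv n * (fromℕ n * x) ≡⟨ cong (inv n *_) nx≡y ⟩
  inv n * y ∎

-- Both factors of 1/(i + 1) · 1/(n − i) split by partial fractions over n + 1.
Σ-inv-inv : ∀ n → Σ< n (λ i → inv (suc i) * inv (suc (n ∸ suc i))) ≡ inv (suc n) * (H n + H n)
Σ-inv-inv n = trans (by-inv (suc n) (Σ-conv n (fromℕ (suc n)) (λ i → inv (suc i)) λ i i<n →
    trans (cong (λ k → fromℕ k * (inv (suc i) * inv (suc (n ∸ suc i))))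
            (sym (trans (cong suc (ℕ.+-suc i (n ∸ suc i))) (cong suc (ℕ.m+[n∸m]≡n i<n)))))
          (inv-+ (suc i) (suc (n ∸ suc i)))))
  (cong (inv (suc n) *_) (sym (cong₂ _+_ (H-Σ n) (H-Σ n))))

-- Expanding `H i` gives a sum of 1/(l l′) over l + l′ ≤ n. By partial fractions the diagonal l + l′
-- = s contributes 2 H₍ₛ₋₁₎/s, and these contributions telescope.
H-conv : ∀ n → Σ< n (λ i → H i * inv (n ∸ i)) ≡ H n * H n - H^[ 2 ] n
H-conv zero    = refl
H-conv (suc n) = begin
  Σ< (suc n) (λ i → H i * inv (suc n ∸ i))
    ≡⟨ Σ-reverse (suc n) _ ⟩
  Σ< (suc n) (λ i → H (n ∸ i) * inv (suc n ∸ (n ∸ i)))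
    ≡⟨ Σ-cong (suc n) (λ { i (s≤s i≤n) → trans (ℚ.*-comm (H (n ∸ i)) (inv (suc n ∸ (n ∸ i)))) (cong₂ _*_ (cong inv (trans (ℕ.+-∸-assoc 1 (ℕ.m∸n≤m n i)) (cong suc (ℕ.m∸[m∸n]≡n i≤n)))) (H-Σ (n ∸ i))) }) ⟩
  Σ< (suc n) (λ l → a l * Σ< (n ∸ l) a)
    ≡⟨ cong (λ k → Σ< n (λ l → a l * Σ< (n ∸ l) a) + a n * Σ< k a) (ℕ.n∸n≡0 n) ⟩
  Σ< n (λ l → a l * Σ< (n ∸ l) a) + a n * 0ℚ
    ≡⟨ cong₂ _+_ (sym (Σ-triangle n a a)) (ℚ.*-zeroʳ (a n)) ⟩
  Σ< n (λ m → Σ< (suc m) (λ l → a l * a (m ∸ l))) + 0ℚ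
    ≡⟨ ℚ.+-identityʳ _ ⟩
  Σ< n (λ m → Σ< (suc m) (λ l → a l * a (m ∸ l)))
    ≡⟨ Σ-cong n (λ m _ → Σ-inv-inv (suc m)) ⟩
  Σ< n (λ m → a (suc m) * (H (suc m) + H (suc m)))
    ≡⟨ sym (trans (Σ-head n _) (trans (cong (_+ Σ< n (λ m → a (suc m) * (H (suc m) + H (suc m)))) (ℚ.*-zeroʳ (a 0))) (ℚ.+-identityˡ _))) ⟩
  Σ< (suc n) (λ m → a m * (H m + H m))
    ≡⟨ telescope (suc n) ⟩
  H (suc n) * H (suc n) - H^[ 2 ] (suc n) ∎
  where
    a : ℕ → ℚ
    a i = inv (suc i)

-- Congruences modulo p

coprime-*-↧ : ∀ {m} x y → Coprime (↧ₙ x) m → Coprime (↧ₙ y) m → Coprime (↧ₙ (x * y)) m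
coprime-*-↧ x@record{} y@record{} cx cy =
  coprime-∣ (↧ₙ-/-∣ (↥ x ℤ.* ↥ y) (↧ₙ x *ℕ ↧ₙ y)) (coprime-* cx cy)

module Localisation (p : ℕ) (prime : Prime p) where

  instance
    p≢0 : NonZero p
    p≢0 = prime⇒nonZero prime

  -- Wrapped in a record because `Coprime` unfolds to a function type from which `x` cannot be
  -- inferred.
  record Integral (x : ℚ) : Set where
    constructor integral
    field coprime : Coprime (↧ₙ x) p

  open Integral public

  infix 4 _~_

  -- Neither side has to be p-integral, so sums of congruences carry no side conditions. Integrality
  -- travels along `int-resp-~`; that of p B₍ₚ₋₁₎, for example, is read off from its congruence.
  record _~_ (x y : ℚ) : Set where
    constructor congruent
    field
      quotient          : ℚ
      quotient-integral : Integral quotient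
      equality          : x - y ≡ fromℕ p * quotient

  int-fromℕ : ∀ n → Integral (fromℕ n)
  int-fromℕ n = integral (coprime-fromℕ n)

  int-0 : Integral 0ℚ
  int-0 = int-fromℕ 0

  int-1 : Integral 1ℚ
  int-1 = int-fromℕ 1

  int-2 : Integral 2ℚ
  int-2 = int-fromℕ 2

  int-+ : ∀ {x y} → Integral x → Integral y → Integral (x + y)
  int-+ {x} {y} (integral a) (integral b) = integral (coprime-+ x y a b)

  int-* : ∀ {x y} → Integral x → Integral y → Integral (x * y)
  int-* {x} {y} (integral a) (integral b) = integral (coprime-*-↧ x y a b)

  int-- : ∀ {x y} → Integral x → Integral y → Integral (x - y)
  int-- {x} {y} (integral a) (integral b) = integral (coprime-- x y a b)

  int-neg : ∀ {x} → Integral x → Integral (- x)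
  int-neg {x} a = subst Integral (ℚ.+-identityˡ (- x)) (int-- int-0 a)

  int-inv : ∀ k → k <ℕ p → Integral (inv k)
  int-inv zero    _   = int-0
  int-inv (suc k) k<p = int-* {1ℚ} {ℤ.+ 1 / suc k} int-1 (integral (coprime-∣ (↧ₙ-/-∣ (ℤ.+ 1) (suc k)) (Coprime.sym (Coprime.prime⇒coprime prime k<p))))

  int-Σ : ∀ n {f} → (∀ i → i <ℕ n → Integral (f i)) → Integral (Σ< n f)
  int-Σ zero    _ = int-0
  int-Σ (suc n) i = int-+ (int-Σ n λ k k<n → i k (ℕ.m<n⇒m<1+n k<n)) (i n ℕ.≤-refl)

  ~-reflexive : ∀ {x y} → x ≡ y → x ~ y
  ~-reflexive {x} refl = congruent 0ℚ int-0 (trans (ℚ.+-inverseʳ x) (sym (ℚ.*-zeroʳ (fromℕ p))))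

  ~-refl : ∀ {x} → x ~ x
  ~-refl = ~-reflexive refl

  ~-+ : ∀ {x y u v} → x ~ y → u ~ v → x + u ~ y + v
  ~-+ {x} {y} {u} {v} (congruent a ia ea) (congruent b ib eb) = congruent (a + b) (int-+ ia ib)
    (trans (solve 4 (λ x y u v → x :+ u :- (y :+ v) := (x :- y) :+ (u :- v)) refl x y u v)
    (trans (cong₂ _+_ ea eb) (sym (ℚ.*-distribˡ-+ (fromℕ p) a b))))

  ~-*ˡ : ∀ {c x y} → Integral c → x ~ y → c * x ~ c * y
  ~-*ˡ {c} {x} {y} ic (congruent a ia ea) = congruent (c * a) (int-* ic ia)
    (trans (solve 3 (λ c x y → c :* x :- c :* y := c :* (x :- y)) refl c x y)
    (trans (cong (c *_) ea) (solve 3 (λ c p a → c :* (p :* a) := p :* (c :* a)) refl c (fromℕ p) a)))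

  ~-neg : ∀ {x y} → x ~ y → - x ~ - y
  ~-neg {x} {y} e = subst₂ _~_ (neg x) (neg y) (~-*ˡ (int-neg int-1) e)
    where
      neg : ∀ x → - 1ℚ * x ≡ - x
      neg = solve 1 (λ x → con (- 1ℚ) :* x := :- x) refl

  ~-- : ∀ {x y u v} → x ~ y → u ~ v → x - u ~ y - v
  ~-- e f = ~-+ e (~-neg f)

  ~-sym : ∀ {x y} → x ~ y → y ~ x
  ~-sym {x} {y} e = subst₂ _~_
    (solve 2 (λ x y → :- x :+ (x :+ y) := y) refl x y) (solve 2 (λ x y → :- y :+ (x :+ y) := x) refl x y)
    (~-+ (~-neg e) (~-refl {x + y}))

  ~-trans : ∀ {x y z} → x ~ y → y ~ z → x ~ z
  ~-trans {x} {y} {z} e f = subst₂ _~_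
    (solve 2 (λ x y → (x :+ y) :- y := x) refl x y) (solve 2 (λ y z → (y :+ z) :- y := z) refl y z)
    (~-- (~-+ e f) (~-refl {y}))

  ~-*ʳ : ∀ {c x y} → Integral c → x ~ y → x * c ~ y * c
  ~-*ʳ {c} {x} {y} ic e = subst₂ _~_ (ℚ.*-comm c x) (ℚ.*-comm c y) (~-*ˡ ic e)

  ~-* : ∀ {x y u v} → Integral x → Integral v → x ~ y → u ~ v → x * u ~ y * v
  ~-* ix iv e f = ~-trans (~-*ˡ ix f) (~-*ʳ iv e)

  ~-Σ : ∀ n {f g} → (∀ i → i <ℕ n → f i ~ g i) → Σ< n f ~ Σ< n g
  ~-Σ zero    e = ~-refl
  ~-Σ (suc n) e = ~-+ (~-Σ n λ i i<n → e i (ℕ.m<n⇒m<1+n i<n)) (e n ℕ.≤-refl)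

  ~-from : ∀ {x y u v} → u ~ v → x - y ≡ u - v → x ~ y
  ~-from (congruent z iz eq) eq′ = congruent z iz (trans eq′ eq)

  int-resp-~ : ∀ {x y} → x ~ y → Integral y → Integral x
  int-resp-~ {x} {y} (congruent a ia ea) iy = subst Integral
    (trans (cong (_+ y) (sym ea)) (solve 2 (λ x y → (x :- y) :+ y := x) refl x y))
    (int-+ (int-* (int-fromℕ p) ia) iy)

  multiple~0 : ∀ {x} → Integral x → fromℕ p * x ~ 0ℚ
  multiple~0 {x} ix = congruent x ix (ℚ.+-identityʳ _)

  ~-cancelˡ : ∀ k → k <ℕ p → .{{_ : NonZero k}} → ∀ {x y} → fromℕ k * x ~ fromℕ k * y → x ~ y
  ~-cancelˡ k k<p {x} {y} e = subst₂ _~_ (sym (by-inv k refl)) (sym (by-inv k refl)) (~-*ˡ (int-inv k k<p) e)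

  -- 1/i + 1/j = p/(i j), and 1/(i j) is p-integral because i, j < p.
  inv-reflect : ∀ i j .{{_ : NonZero i}} .{{_ : NonZero j}} → i +ℕ j ≡ p → inv i ~ - inv j
  inv-reflect i@(suc _) j@(suc _) eq = congruent (inv i * inv j)
    (int-* (int-inv i (subst (i <ℕ_) eq (ℕ.m<m+n i (s≤s z≤n)))) (int-inv j (subst (j <ℕ_) eq (ℕ.m<n+m j (s≤s z≤n)))))
    (trans (solve 2 (λ x y → x :- :- y := x :+ y) refl (inv i) (inv j))
      (trans (sym (inv-+ i j)) (cong (λ k → fromℕ k * (inv i * inv j)) eq)))

  ~⇒≡mod : ∀ {x y} → Integral y → x ~ y → x ≡ y [mod p ]
  ~⇒≡mod {x} {y} iy e@(congruent a ia ea) =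
    coprime (int-resp-~ e iy) , coprime iy , multiple⇒∣ p a ea (coprime ia)

  ≡mod⇒~ : ∀ {x y} → x ≡ y [mod p ] → x ~ y
  ≡mod⇒~ {x} {y} (cx , cy , p∣) with ∣⇒multiple p (x - y) (coprime-- x y cx cy) p∣
  ... | z , eq , cz = congruent z (integral cz) eq

-- Harmonic sums modulo p

odd-inv even-inv : ℕ → ℚ
odd-inv  m = inv (suc (2 *ℕ m))
even-inv m = inv (suc (suc (2 *ℕ m)))

-- The denominators 2 l + 1 and 2 (m - l) + 1 add up to 2 m + 2 for every l.
Σ-odd-odd : ∀ m → Σ< (suc m) (λ l → odd-inv l * odd-inv (m ∸ l)) ≡ even-inv m * (Σ< (suc m) odd-inv + Σ< (suc m) odd-inv)
Σ-odd-odd m = by-inv (suc (suc (2 *ℕ m))) (Σ-conv (suc m) (fromℕ (suc (suc (2 *ℕ m)))) odd-inv λ { l (s≤s l≤m) →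
  trans (cong (λ k → fromℕ k * (odd-inv l * odd-inv (m ∸ l)))
          (sym (trans (cong suc (ℕ.+-suc (2 *ℕ l) (2 *ℕ (m ∸ l))))
            (cong (suc ∘ suc) (trans (sym (ℕ.*-distribˡ-+ 2 l (m ∸ l))) (cong (2 *ℕ_) (ℕ.m+[n∸m]≡n l≤m)))))))
        (inv-+ (suc (2 *ℕ l)) (suc (2 *ℕ (m ∸ l)))) })

-- The square of index pairs is cut in two. The diagonal goes to the second sum, which suits f odd
-- and g even: 2 m + 1 precedes 2 m + 2.
Σ-partial-sums : ∀ n (f g : ℕ → ℚ) → Σ< n (λ m → Σ< m g * f m) + Σ< n (λ m → Σ< (suc m) f * g m) ≡ Σ< n f * Σ< n g
Σ-partial-sums zero    f g = refl
Σ-partial-sums (suc n) f g = begin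
  (V + G * f n) + (V′ + (F + f n) * g n)
    ≡⟨ solve 6 (λ v v′ F G f g → (v :+ G :* f) :+ (v′ :+ (F :+ f) :* g) := (v :+ v′) :+ (G :* f :+ (F :+ f) :* g)) refl V V′ F G (f n) (g n) ⟩
  (V + V′) + (G * f n + (F + f n) * g n)
    ≡⟨ cong (_+ (G * f n + (F + f n) * g n)) (Σ-partial-sums n f g) ⟩
  F * G + (G * f n + (F + f n) * g n)
    ≡⟨ solve 4 (λ F G f g → F :* G :+ (G :* f :+ (F :+ f) :* g) := (F :+ f) :* (G :+ g)) refl F G (f n) (g n) ⟩
  (F + f n) * (G + g n) ∎
  where
    V = Σ< n (λ m → Σ< m g * f m)
    V′ = Σ< n (λ m → Σ< (suc m) f * g m)
    F = Σ< n f
    G = Σ< n g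

-- Doubling the sum over l ≤ m counts the diagonal twice, once more than the square of the whole sum
-- does.
Σ-own-partial-sums : ∀ n (f : ℕ → ℚ) →
  Σ< n (λ m → Σ< (suc m) f * f m) + Σ< n (λ m → Σ< (suc m) f * f m) ≡ Σ< n f * Σ< n f + Σ< n (λ m → f m * f m)
Σ-own-partial-sums zero    f = refl
Σ-own-partial-sums (suc n) f = begin
  (W + (F + f n) * f n) + (W + (F + f n) * f n)
    ≡⟨ solve 3 (λ w F f → (w :+ (F :+ f) :* f) :+ (w :+ (F :+ f) :* f) := (w :+ w) :+ con 2ℚ :* ((F :+ f) :* f)) refl W F (f n) ⟩
  (W + W) + 2ℚ * ((F + f n) * f n)
    ≡⟨ cong (_+ 2ℚ * ((F + f n) * f n)) (Σ-own-partial-sums n f) ⟩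
  F * F + Q + 2ℚ * ((F + f n) * f n)
    ≡⟨ solve 3 (λ F q f → F :* F :+ q :+ con 2ℚ :* ((F :+ f) :* f) := (F :+ f) :* (F :+ f) :+ (q :+ f :* f)) refl F Q (f n) ⟩
  (F + f n) * (F + f n) + (Q + f n * f n) ∎
  where
    W = Σ< n (λ m → Σ< (suc m) f * f m)
    F = Σ< n f
    Q = Σ< n (λ m → f m * f m)

H-even : ∀ m → H (2 *ℕ m) ≡ Σ< m odd-inv + Σ< m even-inv
H-even m = trans (H-Σ (2 *ℕ m)) (Σ-pairs m (inv ∘ suc))

H²-even : ∀ m → H^[ 2 ] (2 *ℕ m) ≡ Σ< m (λ i → odd-inv i * odd-inv i) + Σ< m (λ i → even-inv i * even-inv i)
H²-even m = trans (H²-Σ (2 *ℕ m)) (Σ-pairs m (λ i → inv (suc i) * inv (suc i)))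

H²-half : ∀ m → Σ< m (λ i → even-inv i * even-inv i) ≡ inv 2 * inv 2 * H^[ 2 ] m
H²-half m = begin
  Σ< m (λ i → even-inv i * even-inv i)
    ≡⟨ Σ-cong m (λ i _ → trans (cong (λ k → inv k * inv k) (sym (2*suc i)))
         (trans (cong₂ _*_ (inv-* 2 (suc i)) (inv-* 2 (suc i)))
           (solve 2 (λ h x → (h :* x) :* (h :* x) := (h :* h) :* (x :* x)) refl (inv 2) (inv (suc i))))) ⟩
  Σ< m (λ i → (inv 2 * inv 2) * (inv (suc i) * inv (suc i)))
    ≡⟨ Σ-*ˡ m (inv 2 * inv 2) _ ⟩
  inv 2 * inv 2 * Σ< m (λ i → inv (suc i) * inv (suc i))
    ≡⟨ cong (inv 2 * inv 2 *_) (sym (H²-Σ m)) ⟩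
  inv 2 * inv 2 * H^[ 2 ] m ∎

-- With p = 2 N + 1 the numbers 1, ..., p - 1 are the 2 m + 1 and the 2 m + 2 for m < N; 2 ≤ N makes
-- 2 and 3 invertible modulo p.
module OddPrime (N : ℕ) (prime : Prime (suc (2 *ℕ N))) (2≤N : 2 ≤ℕ N) where

  p : ℕ
  p = suc (2 *ℕ N)

  open Localisation (suc (2 *ℕ N)) prime public

  3<p : 3 <ℕ p
  3<p = s≤s (ℕ.≤-trans (ℕ.n≤1+n 3) (ℕ.*-monoʳ-≤ 2 2≤N))

  2<p : 2 <ℕ p
  2<p = ℕ.<-trans ℕ.≤-refl 3<p

  odd<p : ∀ {m} → m <ℕ N → suc (2 *ℕ m) <ℕ p
  odd<p m<N = s≤s (ℕ.*-monoʳ-< 2 m<N)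

  even<p : ∀ {m} → m <ℕ N → suc (suc (2 *ℕ m)) <ℕ p
  even<p {m} m<N = s≤s (subst (_≤ℕ 2 *ℕ N) (2*suc m) (ℕ.*-monoʳ-≤ 2 m<N))

  int-odd : ∀ m → m <ℕ N → Integral (odd-inv m)
  int-odd m m<N = int-inv (suc (2 *ℕ m)) (odd<p m<N)

  int-even : ∀ m → m <ℕ N → Integral (even-inv m)
  int-even m m<N = int-inv (suc (suc (2 *ℕ m))) (even<p m<N)

  -- i ↦ p - i exchanges odd and even numbers and reverses their order, hence the index N - 1 - m.
  odd-reflect : ∀ m → m <ℕ N → odd-inv (N ∸ suc m) ~ - even-inv m
  odd-reflect m m<N = inv-reflect (suc (2 *ℕ (N ∸ suc m))) (suc (suc (2 *ℕ m))) (cong suc (begin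
    2 *ℕ (N ∸ suc m) +ℕ suc (suc (2 *ℕ m))  ≡⟨ cong (2 *ℕ (N ∸ suc m) +ℕ_) (sym (2*suc m)) ⟩
    2 *ℕ (N ∸ suc m) +ℕ 2 *ℕ suc m          ≡⟨ sym (ℕ.*-distribˡ-+ 2 (N ∸ suc m) (suc m)) ⟩
    2 *ℕ (N ∸ suc m +ℕ suc m)               ≡⟨ cong (2 *ℕ_) (ℕ.m∸n+n≡m m<N) ⟩
    2 *ℕ N                                  ∎))

  -- V and V′ sum 1/(i j) over even i < odd j and over odd j < even i respectively.
  O E O₂ E₂ S Z Q W V V′ : ℚ
  O  = Σ< N odd-inv
  E  = Σ< N even-inv
  O₂ = Σ< N (λ m → odd-inv m * odd-inv m)
  E₂ = Σ< N (λ m → even-inv m * even-inv m)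
  S  = Σ< N (λ m → H (suc (2 *ℕ m)))
  Z  = Σ< N (λ m → H^[ 2 ] (suc (2 *ℕ m)))
  Q  = Σ< N (λ m → H (suc (2 *ℕ m)) * H (suc (2 *ℕ m)))
  W  = Σ< N (λ m → H (suc (2 *ℕ m)) * odd-inv m)
  V  = Σ< N (λ m → Σ< m even-inv * odd-inv m)
  V′ = Σ< N (λ m → Σ< (suc m) odd-inv * even-inv m)

  int-O : Integral O
  int-O = int-Σ N int-odd

  Σ-neg : ∀ n f → Σ< n (λ i → - f i) ≡ - Σ< n f
  Σ-neg zero    f = refl
  Σ-neg (suc n) f = trans (cong (_+ - f n) (Σ-neg n f)) (sym (ℚ.neg-distrib-+ (Σ< n f) (f n)))

  O~-E : O ~ - E
  O~-E = subst₂ _~_ (sym (Σ-reverse N odd-inv)) (Σ-neg N even-inv) (~-Σ N odd-reflect)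

  O₂~E₂ : O₂ ~ E₂
  O₂~E₂ = subst₂ _~_ (sym (Σ-reverse N _)) (Σ-cong N λ m _ → neg-*-neg (even-inv m))
    (~-Σ N λ m m<N → ~-* (int-resp-~ (odd-reflect m m<N) (int-neg (int-even m m<N))) (int-neg (int-even m m<N))
      (odd-reflect m m<N) (odd-reflect m m<N))
    where
      neg-*-neg : ∀ x → - x * - x ≡ x * x
      neg-*-neg = solve 1 (λ x → :- x :* :- x := x :* x) refl

  H[p-1]~0 : H (2 *ℕ N) ~ 0ℚ
  H[p-1]~0 = subst (_~ 0ℚ) (sym (H-even N)) (~-from O~-E (solve 2 (λ o e → o :+ e :- con 0ℚ := o :- :- e) refl O E))

  -- i ↦ p - i maps the upper half of 1, ..., p - 1 onto the lower half and preserves squares modulo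
  -- p.
  H²-halves : H^[ 2 ] (2 *ℕ N) ~ H^[ 2 ] N + H^[ 2 ] N
  H²-halves = subst₂ _~_ (sym lhs) (sym (cong₂ _+_ (H²-Σ N) (H²-Σ N))) (~-+ (~-refl {Σ< N b}) (~-Σ N reflect))
    where
      b : ℕ → ℚ
      b i = inv (suc i) * inv (suc i)
      lhs : H^[ 2 ] (2 *ℕ N) ≡ Σ< N b + Σ< N (λ i → b (N +ℕ (N ∸ suc i)))
      lhs = trans (H²-Σ (2 *ℕ N)) (trans (cong (λ k → Σ< (N +ℕ k) b) (ℕ.+-identityʳ N))
        (trans (Σ-split N N b) (cong (Σ< N b +_) (Σ-reverse N (λ i → b (N +ℕ i))))))
      reflect : ∀ i → i <ℕ N → b (N +ℕ (N ∸ suc i)) ~ b i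
      reflect i i<N = subst (b (N +ℕ (N ∸ suc i)) ~_) (solve 1 (λ x → :- x :* :- x := x :* x) refl (inv (suc i)))
        (~-* (int-resp-~ r (int-neg int)) (int-neg int) r r)
        where
          int : Integral (inv (suc i))
          int = int-inv (suc i) (s≤s (ℕ.≤-trans i<N (ℕ.m≤m+n N _)))
          r : inv (suc (N +ℕ (N ∸ suc i))) ~ - inv (suc i)
          r = inv-reflect (suc (N +ℕ (N ∸ suc i))) (suc i) (cong suc (begin
            N +ℕ (N ∸ suc i) +ℕ suc i    ≡⟨ ℕ.+-assoc N (N ∸ suc i) (suc i) ⟩
            N +ℕ (N ∸ suc i +ℕ suc i)    ≡⟨ cong (N +ℕ_) (trans (ℕ.m∸n+n≡m i<N) (sym (ℕ.+-identityʳ N))) ⟩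
            2 *ℕ N                       ∎))

  -- Scaling by 2 and reflecting express the full sum of 1/i² as 2 E₂ and as 8 E₂.
  E₂~0 : E₂ ~ 0ℚ
  E₂~0 = ~-cancelˡ 3 3<p (~-cancelˡ 2 2<p (~-from (~-+ (~-sym H²-halves) O₂~E₂) (begin
    two * (three * E₂) - two * (three * 0ℚ)
      ≡⟨ solve 1 (λ e → con two :* (con three :* e) :- con two :* (con three :* con 0ℚ) := (con four :* e :+ con four :* e) :- con two :* e) refl E₂ ⟩
    four * E₂ + four * E₂ - two * E₂
      ≡⟨ cong (λ h → h + h - two * E₂) (sym h≡4E₂) ⟩
    H^[ 2 ] N + H^[ 2 ] N - two * E₂
      ≡⟨ solve 3 (λ o e h → h :+ h :- con two :* e := h :+ h :+ o :- (o :+ e :+ e)) refl O₂ E₂ (H^[ 2 ] N) ⟩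
    H^[ 2 ] N + H^[ 2 ] N + O₂ - (O₂ + E₂ + E₂)
      ≡⟨ cong (λ x → H^[ 2 ] N + H^[ 2 ] N + O₂ - (x + E₂)) (sym (H²-even N)) ⟩
    H^[ 2 ] N + H^[ 2 ] N + O₂ - (H^[ 2 ] (2 *ℕ N) + E₂) ∎)))
    where
      two three four : ℚ
      two = fromℕ 2
      three = fromℕ 3
      four = fromℕ 4
      h≡4E₂ : H^[ 2 ] N ≡ four * E₂
      h≡4E₂ = trans (solve 1 (λ h → h := con four :* (con (inv 2 * inv 2) :* h)) refl (H^[ 2 ] N))
        (cong (four *_) (sym (H²-half N)))

  O₂~0 : O₂ ~ 0ℚ
  O₂~0 = ~-trans O₂~E₂ E₂~0

  H²[p-1]~0 : H^[ 2 ] (2 *ℕ N) ~ 0ℚ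
  H²[p-1]~0 = subst (_~ 0ℚ) (sym (H²-even N)) (~-+ O₂~0 E₂~0)

  p-1~-1 : fromℕ (2 *ℕ N) ~ - 1ℚ
  p-1~-1 = ~-from (multiple~0 int-1) (trans (solve 1 (λ x → x :- con (- 1ℚ) := (con 1ℚ :+ x) :* con 1ℚ :- con 0ℚ) refl (fromℕ (2 *ℕ N)))
    (cong (λ x → x * 1ℚ - 0ℚ) (sym (fromℕ-suc (2 *ℕ N)))))

  -- S - O is the sum of H at the even indices 2 m; with S it makes up the sum of H over all indices
  -- below p - 1, which `Σ-h` evaluates.
  S-exact : S + S - O ≡ fromℕ (2 *ℕ N) * (H (2 *ℕ N) - 1ℚ)
  S-exact = begin
    S + S - O
      ≡⟨ cong (λ s → s + S - O) (trans (Σ-cong N λ m _ → H-suc (2 *ℕ m)) (Σ-+ N _ odd-inv)) ⟩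
    Σ< N (λ m → H (2 *ℕ m)) + O + S - O
      ≡⟨ solve 3 (λ t o s → t :+ o :+ s :- o := t :+ s) refl (Σ< N (λ m → H (2 *ℕ m))) O S ⟩
    Σ< N (λ m → H (2 *ℕ m)) + S
      ≡⟨ sym (Σ-pairs N H) ⟩
    Σ< (2 *ℕ N) H
      ≡⟨ Σ-h (2 *ℕ N) ⟩
    fromℕ (2 *ℕ N) * (H (2 *ℕ N) - 1ℚ) ∎

  2S~O+1 : S + S ~ O + 1ℚ
  2S~O+1 = ~-from
    (~-* (int-fromℕ (2 *ℕ N)) (int-- int-0 int-1) p-1~-1 (~-- H[p-1]~0 (~-refl {1ℚ})))
    (trans (solve 2 (λ s o → s :+ s :- (o :+ con 1ℚ) := (s :+ s :- o) :- con (- 1ℚ) :* (con 0ℚ :- con 1ℚ)) refl S O)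
      (cong (_- - 1ℚ * (0ℚ - 1ℚ)) S-exact))

  int-S : Integral S
  int-S = subst Integral (solve 1 (λ s → con (inv 2) :* (s :+ s) := s) refl S)
    (int-* (int-inv 2 2<p) (int-resp-~ 2S~O+1 (int-+ int-O int-1)))

  -- The argument for S, with H⁽²⁾, O₂ and `Σ-g` in place of H, O and `Σ-h`.
  2Z~0 : Z + Z ~ 0ℚ
  2Z~0 = ~-from
    (~-+ (~-- (~-* (int-fromℕ (2 *ℕ N)) int-0 p-1~-1 H²[p-1]~0) H[p-1]~0) O₂~0) (begin
    Z + Z - 0ℚ
      ≡⟨ cong (λ s → s + Z - 0ℚ) (trans (Σ-cong N λ m _ → H²-suc (2 *ℕ m)) (Σ-+ N _ _)) ⟩
    Σ< N (λ m → H^[ 2 ] (2 *ℕ m)) + O₂ + Z - 0ℚ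
      ≡⟨ solve 3 (λ t o s → t :+ o :+ s :- con 0ℚ := (t :+ s :+ o) :- (con (- 1ℚ) :* con 0ℚ :- con 0ℚ :+ con 0ℚ)) refl (Σ< N (λ m → H^[ 2 ] (2 *ℕ m))) O₂ Z ⟩
    Σ< N (λ m → H^[ 2 ] (2 *ℕ m)) + Z + O₂ - (- 1ℚ * 0ℚ - 0ℚ + 0ℚ)
      ≡⟨ cong (λ x → x + O₂ - (- 1ℚ * 0ℚ - 0ℚ + 0ℚ)) (trans (sym (Σ-pairs N (H^[ 2 ]))) (Σ-g (2 *ℕ N))) ⟩
    fromℕ (2 *ℕ N) * H^[ 2 ] (2 *ℕ N) - H (2 *ℕ N) + O₂ - (- 1ℚ * 0ℚ - 0ℚ + 0ℚ) ∎)

  -- Squaring H₂ₘ = H₂ₘ₊₁ - 1/(2 m + 1) gives Q - 2 W + O₂ as the sum of the H₂ₘ²; adding Q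
  -- completes it to the sum evaluated by `Σ-hh`.
  Q-exact : Q + Q ≡ fromℕ (2 *ℕ N) * (H (2 *ℕ N) * H (2 *ℕ N)) - (2ℚ * fromℕ (2 *ℕ N) + 1ℚ) * H (2 *ℕ N)
                    + 2ℚ * fromℕ (2 *ℕ N) + (W + W) - O₂
  Q-exact = begin
    Q + Q
      ≡⟨ solve 4 (λ q t w o → q :+ q := (q :+ o :- (w :+ w) :+ q) :+ (w :+ w) :- o) refl Q (Σ< N (λ m → H (2 *ℕ m))) W O₂ ⟩
    (Q + O₂ - (W + W) + Q) + (W + W) - O₂
      ≡⟨ cong (λ x → x + Q + (W + W) - O₂) evens ⟩
    (Σ< N (λ m → H (2 *ℕ m) * H (2 *ℕ m)) + Q) + (W + W) - O₂
      ≡⟨ cong (λ x → x + (W + W) - O₂) (trans (sym (Σ-pairs N (λ k → H k * H k))) (Σ-hh (2 *ℕ N))) ⟩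
    _ ∎
    where
      evens : Q + O₂ - (W + W) ≡ Σ< N (λ m → H (2 *ℕ m) * H (2 *ℕ m))
      evens = begin
        Q + O₂ - (W + W)
          ≡⟨ solve 3 (λ q w o → q :+ o :- (w :+ w) := (q :+ o) :+ con (- 2ℚ) :* w) refl Q W O₂ ⟩
        Q + O₂ + - 2ℚ * W
          ≡⟨ sym (trans (Σ-+ N _ _) (cong₂ _+_ (Σ-+ N _ _) (Σ-*ˡ N (- 2ℚ) _))) ⟩
        Σ< N (λ m → H (suc (2 *ℕ m)) * H (suc (2 *ℕ m)) + odd-inv m * odd-inv m + - 2ℚ * (H (suc (2 *ℕ m)) * odd-inv m))
          ≡⟨ Σ-cong N (λ m _ → trans (cong (λ h → h * h + odd-inv m * odd-inv m + - 2ℚ * (h * odd-inv m)) (H-suc (2 *ℕ m)))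
               (solve 2 (λ h o → (h :+ o) :* (h :+ o) :+ o :* o :+ con (- 2ℚ) :* ((h :+ o) :* o) := h :* h) refl (H (2 *ℕ m)) (odd-inv m))) ⟩
        Σ< N (λ m → H (2 *ℕ m) * H (2 *ℕ m)) ∎

  -- The terms of H₂ₘ₊₁ are separated by the parity of their denominators; the even ones produce V.
  W-split : W ≡ Σ< N (λ m → Σ< (suc m) odd-inv * odd-inv m) + V
  W-split = trans (Σ-cong N λ m _ → begin
      H (suc (2 *ℕ m)) * odd-inv m
        ≡⟨ cong (_* odd-inv m) (trans (H-suc (2 *ℕ m)) (cong (_+ odd-inv m) (H-even m))) ⟩
      (Σ< m odd-inv + Σ< m even-inv + odd-inv m) * odd-inv m
        ≡⟨ solve 3 (λ a b o → (a :+ b :+ o) :* o := (a :+ o) :* o :+ b :* o) refl (Σ< m odd-inv) (Σ< m even-inv) (odd-inv m) ⟩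
      Σ< (suc m) odd-inv * odd-inv m + Σ< m even-inv * odd-inv m ∎)
    (Σ-+ N _ _)

  2V′~-V′ : V′ + V′ ~ - V′
  2V′~-V′ = subst₂ _~_ left right (~-Σ N λ m m<N →
      ~-* (int-resp-~ (odd-reflect m m<N) (int-neg (int-even m m<N))) (partial (suc m) m<N) (odd-reflect m m<N) (~-refl {Σ< (suc m) odd-inv}))
    where
      partial : ∀ m → m ≤ℕ N → Integral (Σ< m odd-inv)
      partial m m≤N = int-Σ m λ i i<m → int-odd i (ℕ.<-≤-trans i<m m≤N)
      left : Σ< N (λ m → odd-inv (N ∸ suc m) * Σ< (suc m) odd-inv) ≡ V′ + V′
      left = begin
        Σ< N (λ m → odd-inv (N ∸ suc m) * Σ< (suc m) odd-inv)
          ≡⟨ Σ-cong N (λ m m<N → cong (λ k → odd-inv (N ∸ suc m) * Σ< k odd-inv) (sym (ℕ.m∸[m∸n]≡n m<N))) ⟩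
        Σ< N (λ m → odd-inv (N ∸ suc m) * Σ< (N ∸ (N ∸ suc m)) odd-inv)
          ≡⟨ sym (Σ-reverse N _) ⟩
        Σ< N (λ l → odd-inv l * Σ< (N ∸ l) odd-inv)
          ≡⟨ sym (Σ-triangle N odd-inv odd-inv) ⟩
        Σ< N (λ m → Σ< (suc m) (λ l → odd-inv l * odd-inv (m ∸ l)))
          -- Grouped by the value 2 m + 2 of j + k, the sum is open to partial fractions.
          ≡⟨ Σ-cong N (λ m _ → trans (Σ-odd-odd m)
               (solve 2 (λ e s → e :* (s :+ s) := s :* e :+ s :* e) refl (even-inv m) (Σ< (suc m) odd-inv))) ⟩
        Σ< N (λ m → Σ< (suc m) odd-inv * even-inv m + Σ< (suc m) odd-inv * even-inv m)
          ≡⟨ Σ-+ N _ _ ⟩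
        V′ + V′ ∎
      right : Σ< N (λ m → - even-inv m * Σ< (suc m) odd-inv) ≡ - V′
      right = trans (Σ-cong N λ m _ → solve 2 (λ e s → :- e :* s := :- (s :* e)) refl (even-inv m) (Σ< (suc m) odd-inv))
        (Σ-neg N _)

  V′~0 : V′ ~ 0ℚ
  V′~0 = ~-cancelˡ 3 3<p (~-from 2V′~-V′
    (solve 1 (λ v → con (fromℕ 3) :* v :- con (fromℕ 3) :* con 0ℚ := v :+ v :- :- v) refl V′))

  -- V + V′ = O E, as each pair of an odd j and an even i is counted in exactly one of V and V′;
  -- then E ≡ -O and V′ ≡ 0.
  V~-O² : V ~ - (O * O)
  V~-O² = ~-from (~-- (~-*ˡ int-O O~-E) V′~0) (begin
    V - - (O * O)
      ≡⟨ solve 3 (λ v v′ o → v :- :- (o :* o) := (v :+ v′) :- v′ :+ o :* o) refl V V′ O ⟩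
    V + V′ - V′ + O * O
      ≡⟨ cong (λ x → x - V′ + O * O) (Σ-partial-sums N odd-inv even-inv) ⟩
    O * E - V′ + O * O
      ≡⟨ solve 3 (λ o e v′ → o :* e :- v′ :+ o :* o := (o :* o :- v′) :- (o :* :- e :- con 0ℚ)) refl O E V′ ⟩
    (O * O - V′) - (O * - E - 0ℚ) ∎)

  -- 2 W = (O² + O₂) + 2 V, and V ≡ -O².
  2W-O₂~-O² : W + W - O₂ ~ - (O * O)
  2W-O₂~-O² = ~-from (~-+ V~-O² V~-O²) (begin
    W + W - O₂ - - (O * O)
      ≡⟨ cong (λ w → w + w - O₂ - - (O * O)) W-split ⟩
    (W₁ + V) + (W₁ + V) - O₂ - - (O * O)
      ≡⟨ solve 4 (λ w v o₂ o → (w :+ v) :+ (w :+ v) :- o₂ :- :- (o :* o) := (w :+ w) :+ (v :+ v) :- o₂ :+ o :* o) refl W₁ V O₂ O ⟩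
    (W₁ + W₁) + (V + V) - O₂ + O * O
      ≡⟨ cong (λ w → w + (V + V) - O₂ + O * O) (Σ-own-partial-sums N odd-inv) ⟩
    (O * O + O₂) + (V + V) - O₂ + O * O
      ≡⟨ solve 3 (λ v o₂ o → (o :* o :+ o₂) :+ (v :+ v) :- o₂ :+ o :* o := (v :+ v) :- (:- (o :* o) :+ :- (o :* o))) refl V O₂ O ⟩
    (V + V) - (- (O * O) + - (O * O)) ∎)
    where
      W₁ : ℚ
      W₁ = Σ< N (λ m → Σ< (suc m) odd-inv * odd-inv m)

  2Q~-2-O² : Q + Q ~ - 2ℚ - O * O
  2Q~-2-O² = ~-from (~-+ (~-+ (~-*ˡ int-c H[p-1]~0) (~-*ˡ int-2 p-1~-1)) 2W-O₂~-O²) (begin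
    Q + Q - (- 2ℚ - O * O)
      ≡⟨ cong (_- (- 2ℚ - O * O)) Q-exact ⟩
    n * (h * h) - (2ℚ * n + 1ℚ) * h + 2ℚ * n + (W + W) - O₂ - (- 2ℚ - O * O)
      ≡⟨ solve 5 (λ n h w o₂ o → n :* (h :* h) :- (con 2ℚ :* n :+ con 1ℚ) :* h :+ con 2ℚ :* n :+ (w :+ w) :- o₂ :- (con (- 2ℚ) :- o :* o)
           := (n :* h :- (con 2ℚ :* n :+ con 1ℚ)) :* h :+ con 2ℚ :* n :+ (w :+ w :- o₂)
              :- ((n :* h :- (con 2ℚ :* n :+ con 1ℚ)) :* con 0ℚ :+ con 2ℚ :* con (- 1ℚ) :+ :- (o :* o))) refl n h W O₂ O ⟩
    c * h + 2ℚ * n + (W + W - O₂) - (c * 0ℚ + 2ℚ * - 1ℚ + - (O * O)) ∎)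
    where
      n h c : ℚ
      n = fromℕ (2 *ℕ N)
      h = H (2 *ℕ N)
      c = n * h - (2ℚ * n + 1ℚ)
      int-c : Integral c
      int-c = int-- (int-* (int-fromℕ (2 *ℕ N)) (int-resp-~ H[p-1]~0 int-0)) (int-+ (int-* int-2 (int-fromℕ (2 *ℕ N))) int-1)

-- The right-hand side without its digits

∑-1⋯ : ∀ n f → f 0 ≡ 0ℚ → ∑ (1 ⋯ n) f ≡ Σ< (suc n) f
∑-1⋯ n f f0≡0 = begin
  ∑ (1 ⋯ n) f             ≡⟨ ∑-Σ n suc f ⟩
  Σ< n (f ∘ suc)          ≡⟨ sym (ℚ.+-identityˡ _) ⟩
  0ℚ + Σ< n (f ∘ suc)     ≡⟨ cong (_+ Σ< n (f ∘ suc)) (sym f0≡0) ⟩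
  f 0 + Σ< n (f ∘ suc)    ≡⟨ sym (Σ-head n f) ⟩
  Σ< (suc n) f            ∎

∑-2⋯ : ∀ n f → f 0 ≡ 0ℚ → ∑ (2 ⋯ suc n) f ≡ Σ< (suc (suc n)) f - f 1
∑-2⋯ n f f0≡0 = begin
  ∑ (2 ⋯ suc n) f                       ≡⟨ ∑-Σ n (2 +ℕ_) f ⟩
  Σ< n (f ∘ (2 +ℕ_))                    ≡⟨ solve 2 (λ x y → x := y :+ x :- y) refl (Σ< n (f ∘ (2 +ℕ_))) (f 1) ⟩
  f 1 + Σ< n (f ∘ (2 +ℕ_)) - f 1        ≡⟨ cong (_- f 1) (sym (Σ-head n (f ∘ suc))) ⟩
  Σ< (suc n) (f ∘ suc) - f 1            ≡⟨ cong (_- f 1) (trans (sym (∑-Σ (suc n) suc f)) (∑-1⋯ (suc n) f f0≡0)) ⟩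
  Σ< (suc (suc n)) f - f 1              ∎

∑-H-conv : ∀ n → ∑[ i ∈ 1 ⋯ n ∸ 1 ] H i /ℕ (n ∸ i) ≡ H n * H n - H^[ 2 ] n
∑-H-conv zero    = refl
∑-H-conv (suc n) = begin
  ∑ (1 ⋯ n) (λ i → H i /ℕ (suc n ∸ i))
    ≡⟨ ∑-Σ n suc (λ i → H i /ℕ (suc n ∸ i)) ⟩
  Σ< n (λ i → H (suc i) /ℕ (n ∸ i))
    ≡⟨ Σ-cong n (λ i _ → trans (/ℕ-inv (H (suc i)) (n ∸ i)) (ℚ.*-comm (inv (n ∸ i)) (H (suc i)))) ⟩
  Σ< n (λ i → H (suc i) * inv (n ∸ i))
    ≡⟨ sym (trans (Σ-head n _) (trans (cong (_+ Σ< n (λ i → H (suc i) * inv (n ∸ i))) (ℚ.*-zeroˡ (inv (suc n)))) (ℚ.+-identityˡ _))) ⟩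
  Σ< (suc n) (λ i → H i * inv (suc n ∸ i))
    ≡⟨ H-conv (suc n) ⟩
  H (suc n) * H (suc n) - H^[ 2 ] (suc n) ∎

module RightHandSide (k : ℕ) (prime : Prime (suc (2 *ℕ suc (suc k)))) where

  open OddPrime (suc (suc k)) prime (s≤s (s≤s z≤n))

  private
    N = suc (suc k)
    h = suc k

    H-odd : ∀ m → H (suc (2 *ℕ m)) ≡ H (2 *ℕ m) + odd-inv m
    H-odd m = H-suc (2 *ℕ m)

    conv : ℕ → ℚ
    conv m = ∑[ i ∈ 1 ⋯ 2 *ℕ m ∸ 1 ] H i /ℕ (2 *ℕ m ∸ i)

  Σ-H²-even : ∑[ m ∈ 1 ⋯ h ] H^[ 2 ] (2 *ℕ m) ≡ Z - O₂
  Σ-H²-even = begin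
    ∑[ m ∈ 1 ⋯ h ] H^[ 2 ] (2 *ℕ m)        ≡⟨ ∑-1⋯ h (λ m → H^[ 2 ] (2 *ℕ m)) refl ⟩
    A                                       ≡⟨ solve 2 (λ a o → a := (a :+ o) :- o) refl A O₂ ⟩
    (A + O₂) - O₂                           ≡⟨ cong (_- O₂) (sym (trans (Σ-cong N λ m _ → H²-suc (2 *ℕ m)) (Σ-+ N _ _))) ⟩
    Z - O₂                                  ∎
    where
      A = Σ< N (λ m → H^[ 2 ] (2 *ℕ m))

  Σ-H-H : ∑[ m ∈ 1 ⋯ h ] H (2 *ℕ m) * H (2 *ℕ m +ℕ 1) ≡ Q - W
  Σ-H-H = begin
    ∑[ m ∈ 1 ⋯ h ] H (2 *ℕ m) * H (2 *ℕ m +ℕ 1)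
      ≡⟨ ∑-1⋯ h (λ m → H (2 *ℕ m) * H (2 *ℕ m +ℕ 1)) refl ⟩
    Σ< N (λ m → H (2 *ℕ m) * H (2 *ℕ m +ℕ 1))
      ≡⟨ Σ-cong N (λ m _ → trans (cong (λ j → H (2 *ℕ m) * H j) (ℕ.+-comm (2 *ℕ m) 1))
           (trans (solve 3 (λ x y o → x :* y := (x :+ o) :* y :+ con (- 1ℚ) :* (y :* o)) refl (H (2 *ℕ m)) (H (suc (2 *ℕ m))) (odd-inv m))
             (cong (λ x → x * H (suc (2 *ℕ m)) + - 1ℚ * (H (suc (2 *ℕ m)) * odd-inv m)) (sym (H-odd m))))) ⟩
    Σ< N (λ m → H (suc (2 *ℕ m)) * H (suc (2 *ℕ m)) + - 1ℚ * (H (suc (2 *ℕ m)) * odd-inv m))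
      ≡⟨ trans (Σ-+ N _ _) (cong (Q +_) (Σ-*ˡ N (- 1ℚ) _)) ⟩
    Q + - 1ℚ * W
      ≡⟨ solve 2 (λ q w → q :+ con (- 1ℚ) :* w := q :- w) refl Q W ⟩
    Q - W ∎

  -- Each inner sum is H₂ₘ² - H₂ₘ⁽²⁾, rewritten at the index 2 m + 1 so that Q, W, O₂ and Z suffice.
  Σ-conv-even : ∑[ m ∈ 2 ⋯ h ] (∑[ i ∈ 1 ⋯ 2 *ℕ m ∸ 1 ] H i /ℕ (2 *ℕ m ∸ i)) ≡ Q - (W + W) + O₂ - (Z - O₂) - 1ℚ
  Σ-conv-even = begin
    ∑ (2 ⋯ h) conv
      -- Of the two indices adjoined, m = 0 gives an empty sum and m = 1 gives H₁/1 = 1.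
      ≡⟨ ∑-2⋯ k conv refl ⟩
    Σ< N conv - 1ℚ
      ≡⟨ cong (_- 1ℚ) (Σ-cong N λ m _ → trans (∑-H-conv (2 *ℕ m)) (odd-form (H (2 *ℕ m)) (H^[ 2 ] (2 *ℕ m)) (H-odd m) (H²-suc (2 *ℕ m)))) ⟩
    Σ< N (λ m → (H (suc (2 *ℕ m)) * H (suc (2 *ℕ m)) + - 2ℚ * (H (suc (2 *ℕ m)) * odd-inv m))
                + (2ℚ * (odd-inv m * odd-inv m) + - 1ℚ * H^[ 2 ] (suc (2 *ℕ m)))) - 1ℚ
      ≡⟨ cong (_- 1ℚ) (trans (Σ-+ N _ _) (cong₂ _+_ (trans (Σ-+ N _ _) (cong (Q +_) (Σ-*ˡ N (- 2ℚ) _)))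
           (trans (Σ-+ N _ _) (cong₂ _+_ (Σ-*ˡ N 2ℚ _) (Σ-*ˡ N (- 1ℚ) _))))) ⟩
    (Q + - 2ℚ * W) + (2ℚ * O₂ + - 1ℚ * Z) - 1ℚ
      ≡⟨ solve 4 (λ q w o z → (q :+ con (- 2ℚ) :* w) :+ (con 2ℚ :* o :+ con (- 1ℚ) :* z) :- con 1ℚ
           := q :- (w :+ w) :+ o :- (z :- o) :- con 1ℚ) refl Q W O₂ Z ⟩
    Q - (W + W) + O₂ - (Z - O₂) - 1ℚ ∎
    where
      odd-form : ∀ x g {y g′ o} → y ≡ x + o → g′ ≡ g + o * o →
                 x * x - g ≡ (y * y + - 2ℚ * (y * o)) + (2ℚ * (o * o) + - 1ℚ * g′)
      odd-form x g {o = o} refl refl = solve 3 (λ x g o → x :* x :- g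
        := ((x :+ o) :* (x :+ o) :+ con (- 2ℚ) :* ((x :+ o) :* o)) :+ (con 2ℚ :* (o :* o) :+ con (- 1ℚ) :* (g :+ o :* o))) refl x g o

  -- W and O₂ cancel identically, which leaves 6 S - 4 S² + 2 Z - 2 Q - 3.
  main-terms : - 1ℚ + fromℕ 6 * S + fromℕ 4 * (Z - O₂) - fromℕ 4 * (Q - W) - fromℕ 4 * (S * S)
               + fromℕ 2 * (Q - (W + W) + O₂ - (Z - O₂) - 1ℚ) ~ O + 1ℚ
  -- With u = 2 S and v = O + 1, (3 u - u²) - (3 v - v²) = (3 - u - v)(u - v); the multiplier is 3 -
  -- u - v = 2 - (2 S + O).
  main-terms = ~-from (~-+ (~-*ˡ (int-- (int-fromℕ 2) (int-+ (int-+ int-S int-S) int-O)) 2S~O+1) (~-- 2Z~0 2Q~-2-O²))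
    (solve 6 (λ s o z q w o₂ →
      con (- 1ℚ) :+ con (fromℕ 6) :* s :+ con (fromℕ 4) :* (z :- o₂) :- con (fromℕ 4) :* (q :- w) :- con (fromℕ 4) :* (s :* s)
        :+ con (fromℕ 2) :* (q :- (w :+ w) :+ o₂ :- (z :- o₂) :- con 1ℚ) :- (o :+ con 1ℚ)
      := ((con (fromℕ 2) :- (s :+ s :+ o)) :* (s :+ s) :+ ((z :+ z) :- (q :+ q)))
        :- ((con (fromℕ 2) :- (s :+ s :+ o)) :* (o :+ con 1ℚ) :+ (con 0ℚ :- (con (- 2ℚ) :- o :* o)))) refl S O Z Q W O₂)

-- Digits

∣⇒≡0 : ∀ {m n} → m ∣ n → n <ℕ m → n ≡ 0
∣⇒≡0 {n = zero}  _   _   = refl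
∣⇒≡0 {n = suc _} m∣n n<m = contradiction (∣⇒≤ m∣n) (ℕ.<⇒≱ n<m)

module Digits (p : ℕ) (prime : Prime p) where

  open Localisation p prime

  ~0⇒∣ : ∀ n → fromℕ n ~ 0ℚ → p ∣ n
  ~0⇒∣ n n~0 = subst (p ∣_) (trans (cong (λ x → ℤ.∣ ↥ x ∣) (ℚ.+-identityʳ (fromℕ n))) (cong (λ x → ℤ.∣ ↥ x ∣) (fromℕ≡ n)))
    (proj₂ (proj₂ (~⇒≡mod int-0 n~0)))

  fromℕ-injective-mod′ : ∀ {a b} → a ≤ℕ b → b <ℕ p → fromℕ a ~ fromℕ b → a ≡ b
  fromℕ-injective-mod′ {a} {b} a≤b b<p a~b = trans (sym (ℕ.+-identityʳ a)) (trans (cong (a +ℕ_) (sym b∸a≡0)) (ℕ.m+[n∸m]≡n a≤b))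
    where
      b∸a~0 : fromℕ (b ∸ a) ~ 0ℚ
      b∸a~0 = subst₂ _~_
        (trans (cong (_- fromℕ a) (trans (cong fromℕ (sym (ℕ.m+[n∸m]≡n a≤b))) (fromℕ-+ a (b ∸ a))))
          (solve 2 (λ a c → a :+ c :- a := c) refl (fromℕ a) (fromℕ (b ∸ a))))
        (ℚ.+-inverseʳ (fromℕ a)) (~-- (~-sym a~b) (~-refl {fromℕ a}))
      b∸a≡0 : b ∸ a ≡ 0
      b∸a≡0 = ∣⇒≡0 (~0⇒∣ (b ∸ a) b∸a~0) (ℕ.≤-<-trans (ℕ.m∸n≤m b a) b<p)

  fromℕ-injective-mod : ∀ {a b} → a <ℕ p → b <ℕ p → fromℕ a ~ fromℕ b → a ≡ b
  fromℕ-injective-mod {a} {b} a<p b<p a~b with ℕ.≤-total a b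
  ... | inj₁ a≤b = fromℕ-injective-mod′ a≤b b<p a~b
  ... | inj₂ b≤a = sym (fromℕ-injective-mod′ b≤a a<p (~-sym a~b))

  residue~ : ∀ x → Integral x → x ~ fromℕ (residue p x)
  residue~ x ix = ≡mod⇒~ (residue-≡ p x (coprime ix))

  residue-unique : ∀ x {a} → a <ℕ p → x ~ fromℕ a → residue p x ≡ a
  residue-unique x {a} a<p x~a = fromℕ-injective-mod {residue p x} {a} (residue-< p x) a<p
    (~-trans {fromℕ (residue p x)} {x} (~-sym (residue~ x (int-resp-~ x~a (int-fromℕ a)))) x~a)

  -- `y` may be any p-integral rational, not just a natural number; -1/2 occurs below.
  digit₁-unique : ∀ x y {a b} → a <ℕ p → b <ℕ p → x ≡ fromℕ a + fromℕ p * y → y ~ fromℕ b → digit p 1 x ≡ b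
  digit₁-unique x y {a} {b} a<p b<p x≡a+py y~b = residue-unique (next p x) b<p (subst (_~ fromℕ b) (sym next≡y) y~b)
    where
      iy : Integral y
      iy = int-resp-~ y~b (int-fromℕ b)
      x~a : x ~ fromℕ a
      x~a = subst₂ _~_ (sym x≡a+py) (ℚ.+-identityʳ (fromℕ a)) (~-+ (~-refl {fromℕ a}) (multiple~0 iy))
      difference : ∀ r → r ≡ a → x - fromℕ r ≡ fromℕ p * y
      difference r r≡a = trans (cong₂ (λ x r → x - fromℕ r) x≡a+py r≡a)
        (solve 2 (λ a py → a :+ py :- a := py) refl (fromℕ a) (fromℕ p * y))
      next≡y : next p x ≡ y
      next≡y = trans (cong (_/ℕ p) (difference (residue p x) (residue-unique x a<p x~a))) (fromℕ*/ℕ p y)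

  -- Let s be the residue of x. If 2s < p, both digits vanish. Otherwise the residue 2s − p of 2x is
  -- odd, (2s − p)/2 = s − p/2 with −1/2 ≡ (p − 1)/2, and the digits are (p − 1)/2 and 1.
  private
    digits-cancel′ : ∀ N → p ≡ suc (2 *ℕ N) → 2 <ℕ p → ∀ s r d₁ d₂ → s <ℕ p →
      (∀ a → a <ℕ p → fromℕ (2 *ℕ s) ~ fromℕ a → r ≡ a) →
      (∀ y {a b} → a <ℕ p → b <ℕ p → fromℕ r /ℕ 2 ≡ fromℕ a + fromℕ p * y → y ~ fromℕ b → d₁ ≡ b) →
      (∀ y {a b} → a <ℕ p → b <ℕ p → fromℕ 2 * fromℕ s ≡ fromℕ a + fromℕ p * y → y ~ fromℕ b → d₂ ≡ b) →
      fromℕ 2 * fromℕ d₁ + fromℕ d₂ ~ 0ℚ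
    digits-cancel′ N p≡1+2N 2<p s r d₁ d₂ s<p r-unique d₁-unique d₂-unique = by-cases (2 *ℕ s ℕ.<? p)
      where
        0<p : 0 <ℕ p
        0<p = ℕ.<-trans (s≤s z≤n) 2<p
        int-½ : Integral (inv 2)
        int-½ = int-inv 2 2<p
        half : ∀ a y → fromℕ (2 *ℕ s) ≡ a + y → a /ℕ 2 ≡ fromℕ s + - inv 2 * y
        half a y eq = begin
          a /ℕ 2                                ≡⟨ /ℕ-inv a 2 ⟩
          inv 2 * a                             ≡⟨ solve 2 (λ a y → con (inv 2) :* a := con (inv 2) :* (a :+ y) :+ con (- inv 2) :* y) refl a y ⟩
          inv 2 * (a + y) + - inv 2 * y         ≡⟨ cong (λ z → inv 2 * z + - inv 2 * y) (trans (sym eq) (fromℕ-* 2 s)) ⟩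
          inv 2 * (fromℕ 2 * fromℕ s) + - inv 2 * y
            ≡⟨ solve 2 (λ s y → con (inv 2) :* (con (fromℕ 2) :* s) :+ con (- inv 2) :* y := s :+ con (- inv 2) :* y) refl (fromℕ s) y ⟩
          fromℕ s + - inv 2 * y ∎
        goal : ∀ a b → d₁ ≡ a → d₂ ≡ b → fromℕ 2 * fromℕ a + fromℕ b ~ 0ℚ → fromℕ 2 * fromℕ d₁ + fromℕ d₂ ~ 0ℚ
        goal _ _ refl refl e = e
        by-cases : Dec (2 *ℕ s <ℕ p) → fromℕ 2 * fromℕ d₁ + fromℕ d₂ ~ 0ℚ
        by-cases (yes 2s<p) = goal 0 0
          (d₁-unique 0ℚ s<p 0<p
            (trans (cong (λ k → fromℕ k /ℕ 2) (r-unique (2 *ℕ s) 2s<p (~-refl {fromℕ (2 *ℕ s)})))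
            (trans (half (fromℕ (2 *ℕ s)) 0ℚ (sym (ℚ.+-identityʳ _)))
              (solve 2 (λ s p → s :+ con (- inv 2) :* con 0ℚ := s :+ p :* con 0ℚ) refl (fromℕ s) (fromℕ p)))) (~-refl {0ℚ}))
          (d₂-unique 0ℚ 2s<p 0<p
            (trans (sym (fromℕ-* 2 s)) (solve 2 (λ s p → s := s :+ p :* con 0ℚ) refl (fromℕ (2 *ℕ s)) (fromℕ p))) (~-refl {0ℚ}))
          (~-refl {0ℚ})
        by-cases (no 2s≮p) = goal N 1
          (d₁-unique (- inv 2) s<p N<p
            (trans (cong (λ k → fromℕ k /ℕ 2) (r-unique c c<p 2s~c))
            (trans (half (fromℕ c) (fromℕ p) 2s≡c+p) (cong (fromℕ s +_) (ℚ.*-comm (- inv 2) (fromℕ p))))) -½~N)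
          (d₂-unique 1ℚ c<p (ℕ.<-trans (s≤s (s≤s z≤n)) 2<p)
            (trans (sym (fromℕ-* 2 s)) (trans 2s≡c+p (cong (fromℕ c +_) (sym (ℚ.*-identityʳ (fromℕ p)))))) (~-refl {1ℚ}))
          -- Here 2 d₁ + d₂ = 2 N + 1 is p itself.
          (subst (_~ 0ℚ) p≡2N+1 (multiple~0 int-1))
          where
            c : ℕ
            c = 2 *ℕ s ∸ p
            p≤2s : p ≤ℕ 2 *ℕ s
            p≤2s = ℕ.≮⇒≥ 2s≮p
            N<p : N <ℕ p
            N<p = subst (N <ℕ_) (sym p≡1+2N) (s≤s (ℕ.m≤m+n N _))
            c<p : c <ℕ p
            c<p = ℕ.+-cancelʳ-< p c p (subst (_<ℕ p +ℕ p) (sym (ℕ.m∸n+n≡m p≤2s))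
              (subst (λ k → s +ℕ k <ℕ p +ℕ p) (sym (ℕ.+-identityʳ s)) (ℕ.+-mono-< s<p s<p)))
            2s≡c+p : fromℕ (2 *ℕ s) ≡ fromℕ c + fromℕ p
            2s≡c+p = trans (cong fromℕ (sym (ℕ.m∸n+n≡m p≤2s))) (fromℕ-+ c p)
            2s~c : fromℕ (2 *ℕ s) ~ fromℕ c
            2s~c = subst₂ _~_ (trans (cong (fromℕ c +_) (ℚ.*-identityʳ (fromℕ p))) (sym 2s≡c+p)) (ℚ.+-identityʳ (fromℕ c))
              (~-+ (~-refl {fromℕ c}) (multiple~0 int-1))
            p≡2N+1 : fromℕ p * 1ℚ ≡ fromℕ 2 * fromℕ N + fromℕ 1
            p≡2N+1 = trans (ℚ.*-identityʳ (fromℕ p)) (trans (trans (cong fromℕ p≡1+2N) (fromℕ-suc (2 *ℕ N))) (trans (ℚ.+-comm 1ℚ (fromℕ (2 *ℕ N))) (cong (_+ 1ℚ) (fromℕ-* 2 N))))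
            -½~N : - inv 2 ~ fromℕ N
            -½~N = congruent (- inv 2) (int-neg int-½) (begin
              - inv 2 - fromℕ N
                ≡⟨ solve 1 (λ n → con (- inv 2) :- n := (con (fromℕ 2) :* n :+ con 1ℚ) :* con (- inv 2)) refl (fromℕ N) ⟩
              (fromℕ 2 * fromℕ N + 1ℚ) * - inv 2
                ≡⟨ cong (_* - inv 2) (trans (sym p≡2N+1) (ℚ.*-identityʳ (fromℕ p))) ⟩
              fromℕ p * - inv 2 ∎)

  -- The residue s of x determines both digits: 2 x ≡ 2 s, so the inner digit of the first is the
  -- residue of 2 s. All digits are passed on as plain numbers together with the properties that
  -- determine them.
  digits-cancel : ∀ N → p ≡ suc (2 *ℕ N) → 2 <ℕ p → ∀ x → Integral x →
    fromℕ 2 * fromℕ (digit p 1 (fromℕ (digit p 0 (fromℕ 2 * x)) /ℕ 2)) + fromℕ (digit p 1 (fromℕ 2 * fromℕ (digit p 0 x))) ~ 0ℚ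
  digits-cancel N p≡1+2N 2<p x ix = from-residues (digit p 0 x) (digit p 0 (fromℕ 2 * x)) (residue-< p x) (residue~ x ix) (λ a → residue-unique (fromℕ 2 * x) {a})
    where
      from-residues : ∀ s r → s <ℕ p → x ~ fromℕ s → (∀ a → a <ℕ p → fromℕ 2 * x ~ fromℕ a → r ≡ a) →
        fromℕ 2 * fromℕ (digit p 1 (fromℕ r /ℕ 2)) + fromℕ (digit p 1 (fromℕ 2 * fromℕ s)) ~ 0ℚ
      from-residues s r s<p x~s r-unique = 
        digits-cancel′ N p≡1+2N 2<p s r (digit p 1 (fromℕ r /ℕ 2)) (digit p 1 (fromℕ 2 * fromℕ s)) s<p
          (λ a a<p e → r-unique a a<p (~-trans {fromℕ 2 * x} {fromℕ (2 *ℕ s)} {fromℕ a} double e)) 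
          (λ y {a} {b} → digit₁-unique (fromℕ r /ℕ 2) y {a} {b})
          (λ y {a} {b} → digit₁-unique (fromℕ 2 * fromℕ s) y {a} {b})
        where
          double : fromℕ 2 * x ~ fromℕ (2 *ℕ s)
          double = subst (fromℕ 2 * x ~_) (sym (fromℕ-* 2 s)) (~-*ˡ (int-fromℕ 2) x~s)

-- Exponential generating functions

infixl 7 _⋆_
infixl 6 _⊕_

_⊕_ _⋆_ : (ℕ → ℚ) → (ℕ → ℚ) → ℕ → ℚ
(f ⊕ g) n = f n + g n

-- With f standing for the exponential generating function ∑ₙ f n tⁿ / n!, whose derivative
-- is f ∘ suc, this is the product of power series, defined by the Leibniz rule.
(f ⋆ g) zero    = f 0 * g 0
(f ⋆ g) (suc n) = ((f ∘ suc) ⋆ g) n + (f ⋆ (g ∘ suc)) n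

⊖_ : (ℕ → ℚ) → ℕ → ℚ
(⊖ f) n = - f n

scalar : ℚ → ℕ → ℚ
scalar c n = c * δ₀ n

⋆-cong : ∀ {f f′ g g′} → f ≗ f′ → g ≗ g′ → f ⋆ g ≗ f′ ⋆ g′
⋆-cong f≗ g≗ zero    = cong₂ _*_ (f≗ 0) (g≗ 0)
⋆-cong f≗ g≗ (suc n) = cong₂ _+_ (⋆-cong (f≗ ∘ suc) g≗ n) (⋆-cong f≗ (g≗ ∘ suc) n)

⋆-comm : ∀ f g → f ⋆ g ≗ g ⋆ f
⋆-comm f g zero    = ℚ.*-comm (f 0) (g 0)
⋆-comm f g (suc n) = trans (cong₂ _+_ (⋆-comm (f ∘ suc) g n) (⋆-comm f (g ∘ suc) n))
  (ℚ.+-comm ((g ⋆ (f ∘ suc)) n) (((g ∘ suc) ⋆ f) n))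

⋆-distribʳ-⊕ : ∀ h f g → (f ⊕ g) ⋆ h ≗ f ⋆ h ⊕ g ⋆ h
⋆-distribʳ-⊕ h f g zero    = ℚ.*-distribʳ-+ (h 0) (f 0) (g 0)
⋆-distribʳ-⊕ h f g (suc n) = trans (cong₂ _+_ (⋆-distribʳ-⊕ h (f ∘ suc) (g ∘ suc) n) (⋆-distribʳ-⊕ (h ∘ suc) f g n))
  (solve 4 (λ a b c d → (a :+ b) :+ (c :+ d) := (a :+ c) :+ (b :+ d)) refl
    (((f ∘ suc) ⋆ h) n) (((g ∘ suc) ⋆ h) n) ((f ⋆ (h ∘ suc)) n) ((g ⋆ (h ∘ suc)) n))

⋆-distribˡ-⊕ : ∀ h f g → h ⋆ (f ⊕ g) ≗ h ⋆ f ⊕ h ⋆ g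
⋆-distribˡ-⊕ h f g n = trans (⋆-comm h (f ⊕ g) n)
  (trans (⋆-distribʳ-⊕ h f g n) (cong₂ _+_ (⋆-comm f h n) (⋆-comm g h n)))

⋆-assoc : ∀ f g h → (f ⋆ g) ⋆ h ≗ f ⋆ (g ⋆ h)
⋆-assoc f g h zero    = ℚ.*-assoc (f 0) (g 0) (h 0)
⋆-assoc f g h (suc n) = begin
  (((f ∘ suc) ⋆ g ⊕ f ⋆ (g ∘ suc)) ⋆ h) n + ((f ⋆ g) ⋆ (h ∘ suc)) n
    ≡⟨ cong (_+ ((f ⋆ g) ⋆ (h ∘ suc)) n) (⋆-distribʳ-⊕ h ((f ∘ suc) ⋆ g) (f ⋆ (g ∘ suc)) n) ⟩
  ((f ∘ suc) ⋆ g ⋆ h) n + (f ⋆ (g ∘ suc) ⋆ h) n + ((f ⋆ g) ⋆ (h ∘ suc)) n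
    ≡⟨ cong₂ _+_ (cong₂ _+_ (⋆-assoc (f ∘ suc) g h n) (⋆-assoc f (g ∘ suc) h n)) (⋆-assoc f g (h ∘ suc) n) ⟩
  ((f ∘ suc) ⋆ (g ⋆ h)) n + (f ⋆ ((g ∘ suc) ⋆ h)) n + (f ⋆ (g ⋆ (h ∘ suc))) n
    ≡⟨ ℚ.+-assoc (((f ∘ suc) ⋆ (g ⋆ h)) n) _ _ ⟩
  ((f ∘ suc) ⋆ (g ⋆ h)) n + ((f ⋆ ((g ∘ suc) ⋆ h)) n + (f ⋆ (g ⋆ (h ∘ suc))) n)
    ≡⟨ cong (((f ∘ suc) ⋆ (g ⋆ h)) n +_) (sym (⋆-distribˡ-⊕ f ((g ∘ suc) ⋆ h) (g ⋆ (h ∘ suc)) n)) ⟩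
  ((f ∘ suc) ⋆ (g ⋆ h)) n + (f ⋆ ((g ∘ suc) ⋆ h ⊕ g ⋆ (h ∘ suc))) n ∎

⋆-zeroˡ : ∀ g → (λ _ → 0ℚ) ⋆ g ≗ λ _ → 0ℚ
⋆-zeroˡ g zero    = ℚ.*-zeroˡ (g 0)
⋆-zeroˡ g (suc n) = cong₂ _+_ (⋆-zeroˡ g n) (⋆-zeroˡ (g ∘ suc) n)

⋆-scaleˡ : ∀ c f g → (λ k → c * f k) ⋆ g ≗ λ n → c * (f ⋆ g) n
⋆-scaleˡ c f g zero    = ℚ.*-assoc c (f 0) (g 0)
⋆-scaleˡ c f g (suc n) = trans (cong₂ _+_ (⋆-scaleˡ c (f ∘ suc) g n) (⋆-scaleˡ c f (g ∘ suc) n))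
  (sym (ℚ.*-distribˡ-+ c _ _))

⋆-scaleʳ : ∀ c f g → f ⋆ (λ k → c * g k) ≗ λ n → c * (f ⋆ g) n
⋆-scaleʳ c f g n = trans (⋆-comm f _ n) (trans (⋆-scaleˡ c g f n) (cong (c *_) (⋆-comm g f n)))

⋆-identityˡ : ∀ g → δ₀ ⋆ g ≗ g
⋆-identityˡ g zero    = ℚ.*-identityˡ (g 0)
⋆-identityˡ g (suc n) = trans (cong₂ _+_ (⋆-zeroˡ g n) (⋆-identityˡ (g ∘ suc) n)) (ℚ.+-identityˡ (g (suc n)))

scalar-⋆ : ∀ c g → scalar c ⋆ g ≗ λ n → c * g n
scalar-⋆ c g n = trans (⋆-scaleˡ c δ₀ g n) (cong (c *_) (⋆-identityˡ g n))

-- Lets the ring solver, with rational constants through `scalar`, decide identities between power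
-- series.
seriesRing : CommutativeRing 0ℓ 0ℓ
seriesRing = record
  { Carrier = ℕ → ℚ
  ; _≈_ = _≗_
  ; _+_ = _⊕_
  ; _*_ = _⋆_
  ; -_ = ⊖_
  ; 0# = λ _ → 0ℚ
  ; 1# = δ₀
  ; isCommutativeRing = record
    { isRing = record
      { +-isAbelianGroup = record
        { isGroup = record
          { isMonoid = record
            { isSemigroup = record
              { isMagma = record
                { isEquivalence = record { refl = λ _ → refl ; sym = λ e n → sym (e n) ; trans = λ e e′ n → trans (e n) (e′ n) }
                ; ∙-cong = λ e e′ n → cong₂ _+_ (e n) (e′ n)
                }
              ; assoc = λ f g h n → ℚ.+-assoc (f n) (g n) (h n)
              }
            ; identity = (λ f n → ℚ.+-identityˡ (f n)) , (λ f n → ℚ.+-identityʳ (f n))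
            }
          ; inverse = (λ f n → ℚ.+-inverseˡ (f n)) , (λ f n → ℚ.+-inverseʳ (f n))
          ; ⁻¹-cong = λ e n → cong -_ (e n)
          }
        ; comm = λ f g n → ℚ.+-comm (f n) (g n)
        }
      ; *-cong = ⋆-cong
      ; *-assoc = ⋆-assoc
      ; *-identity = ⋆-identityˡ , (λ f n → trans (⋆-comm f δ₀ n) (⋆-identityˡ f n))
      ; distrib = ⋆-distribˡ-⊕ , ⋆-distribʳ-⊕
      }
    ; *-comm = ⋆-comm
    }
  }

scalar-homomorphism : ℚ.+-*-rawRing -Raw-AlmostCommutative⟶ fromCommutativeRing seriesRing
scalar-homomorphism = record
  { ⟦_⟧    = scalar
  ; +-homo = λ c d n → ℚ.*-distribʳ-+ (δ₀ n) c d
  ; *-homo = λ c d n → trans (ℚ.*-assoc c d (δ₀ n)) (sym (scalar-⋆ c (scalar d) n))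
  ; -‿homo = λ c n → sym (ℚ.neg-distribˡ-* c (δ₀ n))
  ; 0-homo = λ n → ℚ.*-zeroˡ (δ₀ n)
  ; 1-homo = λ n → ℚ.*-identityˡ (δ₀ n)
  }

module SeriesSolver = Algebra.Solver.Ring ℚ.+-*-rawRing (fromCommutativeRing seriesRing) scalar-homomorphism
  (λ c d → Maybe.map (λ c≡d n → cong (λ x → scalar x n) c≡d) (dec⇒maybe (c ℚ.≟ d)))

-- The analogue of `from-difference` for series: `u` and `v` are the two sides of a combination of
-- known equations, already multiplied by their cofactors.
from-combination : ∀ {f g u v} → u ≗ v → f ⊕ v ≗ g ⊕ u → f ≗ g
from-combination {f} {g} {u} {v} u≗v eq n = from-difference 1ℚ (u≗v n) (begin
  f n - g n                     ≡⟨ solve 3 (λ f g v → f :- g := (f :+ v) :- (g :+ v)) refl (f n) (g n) (v n) ⟩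
  (f n + v n) - (g n + v n)     ≡⟨ cong (_- (g n + v n)) (eq n) ⟩
  (g n + u n) - (g n + v n)     ≡⟨ solve 3 (λ g u v → (g :+ u) :- (g :+ v) := con 1ℚ :* (u :- v)) refl (g n) (u n) (v n) ⟩
  1ℚ * (u n - v n)              ∎)

-- As a generating function this is the series of exp(c t); as a sequence it supplies the powers
-- (-1)ⁿ, 2ⁿ and 2⁻ⁿ.
exp : ℚ → ℕ → ℚ
exp c zero    = 1ℚ
exp c (suc n) = c * exp c n

exp-⋆-exp : ∀ a b → exp a ⋆ exp b ≗ exp (a + b)
exp-⋆-exp a b zero    = refl
exp-⋆-exp a b (suc n) = begin
  ((λ k → a * exp a k) ⋆ exp b) n + (exp a ⋆ (λ k → b * exp b k)) n
    ≡⟨ cong₂ _+_ (⋆-scaleˡ a (exp a) (exp b) n) (⋆-scaleʳ b (exp a) (exp b) n) ⟩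
  a * (exp a ⋆ exp b) n + b * (exp a ⋆ exp b) n
    ≡⟨ sym (ℚ.*-distribʳ-+ ((exp a ⋆ exp b) n) a b) ⟩
  (a + b) * (exp a ⋆ exp b) n
    ≡⟨ cong ((a + b) *_) (exp-⋆-exp a b n) ⟩
  (a + b) * exp (a + b) n ∎

exp-* : ∀ a b n → exp (a * b) n ≡ exp a n * exp b n
exp-* a b zero    = refl
exp-* a b (suc n) = trans (cong (a * b *_) (exp-* a b n))
  (solve 4 (λ a b x y → a :* b :* (x :* y) := (a :* x) :* (b :* y)) refl a b (exp a n) (exp b n))

exp-0 : exp 0ℚ ≗ δ₀
exp-0 zero    = refl
exp-0 (suc n) = ℚ.*-zeroˡ (exp 0ℚ n)

exp-1 : ∀ n → exp 1ℚ n ≡ 1ℚ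
exp-1 zero    = refl
exp-1 (suc n) = trans (ℚ.*-identityˡ (exp 1ℚ n)) (exp-1 n)

-- The substitution t ↦ c t.
rescale : ℚ → (ℕ → ℚ) → ℕ → ℚ
rescale c f n = exp c n * f n

rescale-cong : ∀ c {f g} → f ≗ g → rescale c f ≗ rescale c g
rescale-cong c f≗g n = cong (exp c n *_) (f≗g n)

rescale-⋆ : ∀ c f g → rescale c (f ⋆ g) ≗ rescale c f ⋆ rescale c g
rescale-⋆ c f g zero    = solve 2 (λ x y → con 1ℚ :* (x :* y) := con 1ℚ :* x :* (con 1ℚ :* y)) refl (f 0) (g 0)
rescale-⋆ c f g (suc n) = begin
  c * exp c n * (((f ∘ suc) ⋆ g) n + (f ⋆ (g ∘ suc)) n)
    ≡⟨ solve 4 (λ c e x y → c :* e :* (x :+ y) := c :* (e :* x) :+ c :* (e :* y)) refl c (exp c n) (((f ∘ suc) ⋆ g) n) ((f ⋆ (g ∘ suc)) n) ⟩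
  c * rescale c ((f ∘ suc) ⋆ g) n + c * rescale c (f ⋆ (g ∘ suc)) n
    ≡⟨ cong₂ (λ x y → c * x + c * y) (rescale-⋆ c (f ∘ suc) g n) (rescale-⋆ c f (g ∘ suc) n) ⟩
  c * (rescale c (f ∘ suc) ⋆ rescale c g) n + c * (rescale c f ⋆ rescale c (g ∘ suc)) n
    ≡⟨ sym (cong₂ _+_
         (trans (⋆-cong (λ k → ℚ.*-assoc c (exp c k) (f (suc k))) (λ _ → refl) n) (⋆-scaleˡ c (rescale c (f ∘ suc)) (rescale c g) n))
         (trans (⋆-cong (λ _ → refl) (λ k → ℚ.*-assoc c (exp c k) (g (suc k))) n) (⋆-scaleʳ c (rescale c f) (rescale c (g ∘ suc)) n))) ⟩
  ((rescale c f ∘ suc) ⋆ rescale c g) n + (rescale c f ⋆ (rescale c g ∘ suc)) n ∎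

𝑡-suc : 𝑡 ∘ suc ≗ δ₀
𝑡-suc zero    = refl
𝑡-suc (suc n) = refl

𝑡-⋆ : ∀ f n → (𝑡 ⋆ f) n ≡ fromℕ n * f (n ∸ 1)
𝑡-⋆ f zero    = trans (ℚ.*-zeroˡ (f 0)) (sym (ℚ.*-zeroˡ (f 0)))
𝑡-⋆ f (suc n) = begin
  ((𝑡 ∘ suc) ⋆ f) n + (𝑡 ⋆ (f ∘ suc)) n    ≡⟨ cong₂ _+_ (trans (⋆-cong 𝑡-suc (λ _ → refl) n) (⋆-identityˡ f n)) (trans (𝑡-⋆ (f ∘ suc) n) (index n)) ⟩
  f n + fromℕ n * f n                      ≡⟨ solve 2 (λ n x → x :+ n :* x := (con 1ℚ :+ n) :* x) refl (fromℕ n) (f n) ⟩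
  (1ℚ + fromℕ n) * f n                     ≡⟨ cong (_* f n) (sym (fromℕ-suc n)) ⟩
  fromℕ (suc n) * f n                      ∎
  where
    index : ∀ n → fromℕ n * f (suc (n ∸ 1)) ≡ fromℕ n * f n
    index zero    = trans (ℚ.*-zeroˡ (f 1)) (sym (ℚ.*-zeroˡ (f 0)))
    index (suc n) = refl

-- eᵗ - 1 has no inverse power series, so identities for t/(eᵗ - 1) are proved after multiplication
-- by t, where t = (eᵗ - 1) F can be substituted.
𝑡-cancel : ∀ {f g} → 𝑡 ⋆ f ≗ 𝑡 ⋆ g → f ≗ g
𝑡-cancel {f} {g} eq n = trans (by-inv (suc n) (trans (sym (𝑡-⋆ f (suc n))) (trans (eq (suc n)) (𝑡-⋆ g (suc n)))))
  (sym (by-inv (suc n) refl))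

1/! : ℕ → ℚ
1/! n = inv (n !)

1/!-suc : ∀ n → fromℕ (suc n) * 1/! (suc n) ≡ 1/! n
1/!-suc n = begin
  fromℕ (suc n) * inv (suc n *ℕ n !)             ≡⟨ cong (fromℕ (suc n) *_) (inv-* (suc n) (n !) {{_}} {{n !≢0}}) ⟩
  fromℕ (suc n) * (inv (suc n) * 1/! n)          ≡⟨ sym (ℚ.*-assoc (fromℕ (suc n)) (inv (suc n)) (1/! n)) ⟩
  fromℕ (suc n) * inv (suc n) * 1/! n            ≡⟨ cong (_* 1/! n) (inv-inverse (suc n)) ⟩
  1ℚ * 1/! n                                     ≡⟨ ℚ.*-identityˡ (1/! n) ⟩
  1/! n                                          ∎

private
  cauchyTerm : (ℕ → ℚ) → (ℕ → ℚ) → ℕ → ℕ → ℚ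
  cauchyTerm f g n i = f i * 1/! i * (g (n ∸ i) * 1/! (n ∸ i))

-- Multiplying by n + 1 = i + (n + 1 − i) differentiates either of the factors.
⋆-Cauchy : ∀ f g n → Σ< (suc n) (cauchyTerm f g n) ≡ (f ⋆ g) n * 1/! n
⋆-Cauchy f g zero    = solve 2 (λ x y → con 0ℚ :+ x :* con (1/! 0) :* (y :* con (1/! 0)) := x :* y :* con (1/! 0)) refl (f 0) (g 0)
⋆-Cauchy f g (suc n) = trans (by-inv (suc n) (begin
    fromℕ (suc n) * Σ< (suc (suc n)) T
      ≡⟨ sym (Σ-*ˡ (suc (suc n)) (fromℕ (suc n)) T) ⟩
    Σ< (suc (suc n)) (λ i → fromℕ (suc n) * T i)
      ≡⟨ Σ-cong (suc (suc n)) (λ { i (s≤s i≤n) → trans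
           (cong (_* T i) (trans (cong fromℕ (sym (ℕ.m+[n∸m]≡n i≤n))) (fromℕ-+ i (suc n ∸ i))))
           (ℚ.*-distribʳ-+ (T i) (fromℕ i) (fromℕ (suc n ∸ i))) }) ⟩
    Σ< (suc (suc n)) (λ i → fromℕ i * T i + fromℕ (suc n ∸ i) * T i)
      ≡⟨ Σ-+ (suc (suc n)) _ _ ⟩
    Σ< (suc (suc n)) (λ i → fromℕ i * T i) + Σ< (suc (suc n)) (λ i → fromℕ (suc n ∸ i) * T i)
      ≡⟨ cong₂ _+_ left right ⟩
    ((f ∘ suc) ⋆ g) n * 1/! n + (f ⋆ (g ∘ suc)) n * 1/! n
      ≡⟨ sym (ℚ.*-distribʳ-+ (1/! n) (((f ∘ suc) ⋆ g) n) ((f ⋆ (g ∘ suc)) n)) ⟩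
    (f ⋆ g) (suc n) * 1/! n ∎))
  (begin
    inv (suc n) * ((f ⋆ g) (suc n) * 1/! n)
      ≡⟨ solve 3 (λ i x y → i :* (x :* y) := x :* (i :* y)) refl (inv (suc n)) ((f ⋆ g) (suc n)) (1/! n) ⟩
    (f ⋆ g) (suc n) * (inv (suc n) * 1/! n)
      ≡⟨ cong ((f ⋆ g) (suc n) *_) (sym (inv-* (suc n) (n !) {{_}} {{n !≢0}})) ⟩
    (f ⋆ g) (suc n) * 1/! (suc n) ∎)
  where
    T : ℕ → ℚ
    T = cauchyTerm f g (suc n)
    left : Σ< (suc (suc n)) (λ i → fromℕ i * T i) ≡ ((f ∘ suc) ⋆ g) n * 1/! n
    left = begin
      Σ< (suc (suc n)) (λ i → fromℕ i * T i)
        ≡⟨ Σ-head (suc n) (λ i → fromℕ i * T i) ⟩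
      0ℚ * T 0 + Σ< (suc n) (λ i → fromℕ (suc i) * T (suc i))
        ≡⟨ cong₂ _+_ (ℚ.*-zeroˡ (T 0)) (Σ-cong (suc n) (λ i _ → trans
             (solve 4 (λ c x y z → c :* (x :* y :* z) := x :* (c :* y) :* z) refl (fromℕ (suc i)) (f (suc i)) (1/! (suc i)) (g (n ∸ i) * 1/! (n ∸ i)))
             (cong (λ y → f (suc i) * y * (g (n ∸ i) * 1/! (n ∸ i))) (1/!-suc i)))) ⟩
      0ℚ + Σ< (suc n) (cauchyTerm (f ∘ suc) g n)
        ≡⟨ trans (ℚ.+-identityˡ _) (⋆-Cauchy (f ∘ suc) g n) ⟩
      ((f ∘ suc) ⋆ g) n * 1/! n ∎
    right : Σ< (suc (suc n)) (λ i → fromℕ (suc n ∸ i) * T i) ≡ (f ⋆ (g ∘ suc)) n * 1/! n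
    right = begin
      Σ< (suc n) (λ i → fromℕ (suc n ∸ i) * T i) + fromℕ (suc n ∸ suc n) * T (suc n)
        ≡⟨ cong₂ _+_ (Σ-cong (suc n) (λ { i (s≤s i≤n) → trans (cong (λ k → fromℕ k * (f i * 1/! i * (g k * 1/! k))) (ℕ.+-∸-assoc 1 i≤n)) (trans
             (solve 4 (λ c x y z → c :* (x :* (y :* z)) := x :* (y :* (c :* z))) refl (fromℕ (suc (n ∸ i))) (f i * 1/! i) (g (suc (n ∸ i))) (1/! (suc (n ∸ i))))
             (cong (λ y → f i * 1/! i * (g (suc (n ∸ i)) * y)) (1/!-suc (n ∸ i)))) }))
             (trans (cong (λ k → fromℕ k * T (suc n)) (ℕ.n∸n≡0 n)) (ℚ.*-zeroˡ (T (suc n)))) ⟩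
      Σ< (suc n) (cauchyTerm f (g ∘ suc) n) + 0ℚ
        ≡⟨ trans (ℚ.+-identityʳ _) (⋆-Cauchy f (g ∘ suc) n) ⟩
      (f ⋆ (g ∘ suc)) n * 1/! n ∎

-- Bernoulli numbers

private
  -- With `B` as the series F(t), the last three are F(-t), F(t/2) and F′(t).
  e e⁻¹ √e B⁻ G B′ : ℕ → ℚ
  e   = exp 1ℚ
  e⁻¹ = exp (- 1ℚ)
  √e  = exp ½
  B⁻  = rescale (- 1ℚ) B
  G   = rescale ½ B
  B′  = B ∘ suc

  -1ˢ : (ℕ → ℚ)
  -1ˢ = scalar (- 1ℚ)

rescale-scalar : ∀ c d → rescale c (scalar d) ≗ scalar d
rescale-scalar c d zero    = ℚ.*-identityˡ (d * 1ℚ)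
rescale-scalar c d (suc n) = trans (cong (exp c (suc n) *_) (ℚ.*-zeroʳ d)) (trans (ℚ.*-zeroʳ (exp c (suc n))) (sym (ℚ.*-zeroʳ d)))

rescale-⊕ : ∀ c f g → rescale c (f ⊕ g) ≗ rescale c f ⊕ rescale c g
rescale-⊕ c f g n = ℚ.*-distribˡ-+ (exp c n) (f n) (g n)

rescale-e : ∀ c → rescale c e ≗ exp c
rescale-e c n = trans (cong (exp c n *_) (exp-1 n)) (ℚ.*-identityʳ (exp c n))

rescale-𝑡 : ∀ c → rescale c 𝑡 ≗ scalar c ⋆ 𝑡
rescale-𝑡 c n = trans (pointwise n) (sym (scalar-⋆ c 𝑡 n))
  where
    pointwise : ∀ n → exp c n * 𝑡 n ≡ c * 𝑡 n
    pointwise zero          = trans (ℚ.*-zeroʳ 1ℚ) (sym (ℚ.*-zeroʳ c))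
    pointwise (suc zero)    = cong (_* 1ℚ) (ℚ.*-identityʳ c)
    pointwise (suc (suc n)) = trans (ℚ.*-zeroʳ (exp c (suc (suc n)))) (sym (ℚ.*-zeroʳ c))

B-equation : (e ⊕ -1ˢ) ⋆ B ≗ 𝑡
B-equation n = begin
  ((e ⊕ -1ˢ) ⋆ B) n
    ≡⟨ trans (by-inv (n !) {{n !≢0}} refl) (ℚ.*-comm (1/! n) _) ⟩
  fromℕ (n !) * ((e ⊕ -1ˢ) ⋆ B) n * 1/! n
    ≡⟨ ℚ.*-assoc (fromℕ (n !)) (((e ⊕ -1ˢ) ⋆ B) n) (1/! n) ⟩
  fromℕ (n !) * (((e ⊕ -1ˢ) ⋆ B) n * 1/! n)
    ≡⟨ cong (fromℕ (n !) *_) (sym (⋆-Cauchy (e ⊕ -1ˢ) B n)) ⟩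
  fromℕ (n !) * Σ< (suc n) (λ i → (e ⊕ -1ˢ) i * 1/! i * (B (n ∸ i) * 1/! (n ∸ i)))
    ≡⟨ cong (fromℕ (n !) *_) (Σ-cong (suc n) (λ i _ → cong₂ _*_ (coefficient i)
         (trans (ℚ.*-comm (B (n ∸ i)) (1/! (n ∸ i))) (sym (/ℕ-inv (B (n ∸ i)) ((n ∸ i) !)))))) ⟩
  fromℕ (n !) * Σ< (suc n) (λ i → expm1 i * (B (n ∸ i) /ℕ ((n ∸ i) !)))
    ≡⟨ cong (fromℕ (n !) *_) (trans (sym (∑-Σ (suc n) (λ i → i) (λ i → expm1 i * (B (n ∸ i) /ℕ ((n ∸ i) !))))) (B-generatingFunction n)) ⟩
  fromℕ (n !) * 𝑡 n
    -- t lives in degree 1, where 1! = 1.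
    ≡⟨ n!*𝑡 n ⟩
  𝑡 n ∎
  where
    coefficient : ∀ i → (e ⊕ -1ˢ) i * 1/! i ≡ expm1 i
    coefficient zero    = refl
    coefficient (suc i) = trans (cong (λ x → (x + -1ˢ (suc i)) * 1/! (suc i)) (exp-1 (suc i))) (ℚ.*-identityˡ (1/! (suc i)))
    n!*𝑡 : ∀ n → fromℕ (n !) * 𝑡 n ≡ 𝑡 n
    n!*𝑡 zero          = refl
    n!*𝑡 (suc zero)    = refl
    n!*𝑡 (suc (suc n)) = ℚ.*-zeroʳ (fromℕ (suc (suc n) !))

B-rescaled : ∀ c → (exp c ⊕ -1ˢ) ⋆ rescale c B ≗ scalar c ⋆ 𝑡
B-rescaled c n = begin
  ((exp c ⊕ -1ˢ) ⋆ rescale c B) n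
    ≡⟨ sym (⋆-cong (λ k → trans (rescale-⊕ c e -1ˢ k) (cong₂ _+_ (rescale-e c k) (rescale-scalar c (- 1ℚ) k))) (λ _ → refl) n) ⟩
  (rescale c (e ⊕ -1ˢ) ⋆ rescale c B) n
    ≡⟨ sym (rescale-⋆ c (e ⊕ -1ˢ) B n) ⟩
  rescale c ((e ⊕ -1ˢ) ⋆ B) n
    ≡⟨ rescale-cong c B-equation n ⟩
  rescale c 𝑡 n
    ≡⟨ rescale-𝑡 c n ⟩
  (scalar c ⋆ 𝑡) n ∎

-- The derivative of (eᵗ - 1) F = t.
B-derivative : e ⋆ B ⊕ (e ⊕ -1ˢ) ⋆ B′ ≗ scalar 1ℚ
B-derivative n = begin
  (e ⋆ B) n + ((e ⊕ -1ˢ) ⋆ B′) n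
    ≡⟨ cong (_+ ((e ⊕ -1ˢ) ⋆ B′) n) (⋆-cong (λ k → sym (derivative k)) (λ _ → refl) n) ⟩
  ((e ⊕ -1ˢ) ⋆ B) (suc n)
    ≡⟨ B-equation (suc n) ⟩
  𝑡 (suc n)
    ≡⟨ trans (𝑡-suc n) (sym (ℚ.*-identityˡ (δ₀ n))) ⟩
  scalar 1ℚ n ∎
  where
    derivative : ∀ k → (e ⊕ -1ˢ) (suc k) ≡ e k
    derivative k = trans (cong₂ _+_ (ℚ.*-identityˡ (e k)) (ℚ.*-zeroʳ (- 1ℚ))) (ℚ.+-identityʳ (e k))

private
  open SeriesSolver using () renaming (solve to solveˢ; con to κ; _:=_ to _≔_; _:+_ to _∔_; _:*_ to _·_; :-_ to ∼_)

  ⊕-cong : ∀ {f f′ g g′} → f ≗ f′ → g ≗ g′ → f ⊕ g ≗ f′ ⊕ g′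
  ⊕-cong p q n = cong₂ _+_ (p n) (q n)

  ⋆-congʳ : ∀ f {g g′} → g ≗ g′ → f ⋆ g ≗ f ⋆ g′
  ⋆-congʳ f p = ⋆-cong (λ _ → refl) p

  e⋆e⁻¹ : e ⋆ e⁻¹ ≗ scalar 1ℚ
  e⋆e⁻¹ n = trans (exp-⋆-exp 1ℚ (- 1ℚ) n) (trans (exp-0 n) (sym (ℚ.*-identityˡ (δ₀ n))))

  √e⋆√e : √e ⋆ √e ≗ e
  √e⋆√e = exp-⋆-exp ½ ½

-- F(-t) = -t/(e⁻ᵗ - 1) = t eᵗ/(eᵗ - 1) = t + F(t).
B-reflection : B⁻ ≗ 𝑡 ⊕ B
B-reflection = 𝑡-cancel {B⁻} {𝑡 ⊕ B} (from-combination {𝑡 ⋆ B⁻} {𝑡 ⋆ (𝑡 ⊕ B)}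
  (⊕-cong (⋆-congʳ (⊖ (e ⋆ B)) (B-rescaled (- 1ℚ))) (⊕-cong (⋆-congʳ (B ⋆ B⁻) e⋆e⁻¹) (⋆-congʳ (𝑡 ⊕ (⊖ B⁻)) B-equation)))
  (solveˢ 5 (λ e f b b⁻ t →
    t · b⁻ ∔ ((∼ (e · b)) · (κ (- 1ℚ) · t) ∔ ((b · b⁻) · κ 1ℚ ∔ (t ∔ ∼ b⁻) · t))
    ≔ t · (t ∔ b) ∔ ((∼ (e · b)) · ((f ∔ κ (- 1ℚ)) · b⁻) ∔ ((b · b⁻) · (e · f)
        ∔ (t ∔ ∼ b⁻) · ((e ∔ κ (- 1ℚ)) · b))))
    (λ _ → refl) e e⁻¹ B B⁻ 𝑡))

-- F times the differentiated equation reads eᵗ F² + t F′ = F, and eᵗ F² = F² + t F.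
B⋆B : B ⋆ B ≗ B ⊕ (⊖ (𝑡 ⋆ B)) ⊕ (⊖ (𝑡 ⋆ B′))
B⋆B = from-combination {B ⋆ B} {B ⊕ (⊖ (𝑡 ⋆ B)) ⊕ (⊖ (𝑡 ⋆ B′))}
  (⊕-cong (⋆-congʳ B B-derivative) (⋆-congʳ (⊖ (B ⊕ B′)) B-equation))
  (solveˢ 4 (λ e b b′ t →
    b · b ∔ (b · κ 1ℚ ∔ (∼ (b ∔ b′)) · t)
    ≔ (b ∔ ∼ (t · b) ∔ ∼ (t · b′)) ∔ (b · (e · b ∔ (e ∔ κ (- 1ℚ)) · b′) ∔ (∼ (b ∔ b′)) · ((e ∔ κ (- 1ℚ)) · b)))
    (λ _ → refl) e B B′ 𝑡)

-- F(t/2) = (t/2)/(√e - 1), and eᵗ - 1 = (√e - 1)(√e + 1).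
G-equation : G ≗ scalar ½ ⋆ ((√e ⊕ scalar 1ℚ) ⋆ B)
G-equation = 𝑡-cancel {G} {scalar ½ ⋆ ((√e ⊕ scalar 1ℚ) ⋆ B)} (from-combination {𝑡 ⋆ G} {𝑡 ⋆ (scalar ½ ⋆ ((√e ⊕ scalar 1ℚ) ⋆ B))}
  (⊕-cong (⋆-congʳ ((√e ⊕ scalar 1ℚ) ⋆ B) (B-rescaled ½)) (⊕-cong (⋆-congʳ (⊖ (B ⋆ G)) √e⋆√e) (⋆-congʳ (⊖ G) B-equation)))
  (solveˢ 5 (λ e u b g t →
    t · g ∔ (((u ∔ κ 1ℚ) · b) · (κ ½ · t) ∔ ((∼ (b · g)) · e ∔ (∼ g) · t))
    ≔ t · (κ ½ · ((u ∔ κ 1ℚ) · b)) ∔ (((u ∔ κ 1ℚ) · b) · ((u ∔ κ (- 1ℚ)) · g)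
      ∔ ((∼ (b · g)) · (u · u) ∔ (∼ g) · ((e ∔ κ (- 1ℚ)) · b))))
    (λ _ → refl) e √e B G 𝑡))

-- In G² = ½ (√e + 1) F G write √e + 1 = (√e - 1) + 2; since (√e - 1) G = t/2, the first part
-- contributes t F/4.
G⋆B : G ⋆ B ≗ G ⋆ G ⊕ scalar (- (½ * ½)) ⋆ (𝑡 ⋆ B)
G⋆B = from-combination {G ⋆ B} {G ⋆ G ⊕ scalar (- (½ * ½)) ⋆ (𝑡 ⋆ B)}
  (⊕-cong (⋆-congʳ (⊖ G) G-equation) (⋆-congʳ (scalar (- ½) ⋆ B) (B-rescaled ½)))
  (solveˢ 4 (λ u b g t →
    g · b ∔ ((∼ g) · (κ ½ · ((u ∔ κ 1ℚ) · b)) ∔ (κ (- ½) · b) · (κ ½ · t))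
    ≔ (g · g ∔ κ (- (½ * ½)) · (t · b)) ∔ ((∼ g) · g ∔ (κ (- ½) · b) · ((u ∔ κ (- 1ℚ)) · g)))
    (λ _ → refl) √e B G 𝑡)

B-symmetric : ∀ n → exp (- 1ℚ) (2 +ℕ n) * B (2 +ℕ n) ≡ B (2 +ℕ n)
B-symmetric n = trans (B-reflection (2 +ℕ n)) (ℚ.+-identityˡ (B (2 +ℕ n)))

B-odd : ∀ n → exp (- 1ℚ) (2 +ℕ n) ≡ - 1ℚ → B (2 +ℕ n) ≡ 0ℚ
B-odd n odd = begin
  b                         ≡⟨ solve 1 (λ b → b := con ½ :* (b :- con (- 1ℚ) :* b)) refl b ⟩
  ½ * (b - - 1ℚ * b)        ≡⟨ cong (λ x → ½ * (b - x * b)) (sym odd) ⟩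
  ½ * (b - exp (- 1ℚ) (2 +ℕ n) * b)  ≡⟨ cong (λ x → ½ * (b - x)) (B-symmetric n) ⟩
  ½ * (b - b)               ≡⟨ solve 1 (λ b → con ½ :* (b :- b) := con 0ℚ) refl b ⟩
  0ℚ                        ∎
  where
    b = B (2 +ℕ n)

-- The coefficient of t F is (n + 1) Bₙ = 0, both in G F and in F², so only the terms F and t F′ of
-- F² at t/2 survive. It is applied with n + 1 = p - 1.
½⋆B-coefficient : ∀ n → B n ≡ 0ℚ → (rescale ½ B ⋆ B) (suc n) ≡ exp ½ (suc n) * (B (suc n) - fromℕ (suc n) * B (suc n))
½⋆B-coefficient n Bn≡0 = begin
  (G ⋆ B) (suc n)
    ≡⟨ G⋆B (suc n) ⟩
  (G ⋆ G) (suc n) + (scalar (- (½ * ½)) ⋆ (𝑡 ⋆ B)) (suc n)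
    ≡⟨ cong₂ _+_ (trans (sym (rescale-⋆ ½ B B (suc n))) (cong (exp ½ (suc n) *_) (B⋆B (suc n))))
         (trans (scalar-⋆ (- (½ * ½)) (𝑡 ⋆ B) (suc n)) (cong (- (½ * ½) *_) 𝑡⋆B≡0)) ⟩
  exp ½ (suc n) * (B (suc n) + - (𝑡 ⋆ B) (suc n) + - (𝑡 ⋆ B′) (suc n)) + - (½ * ½) * 0ℚ
    ≡⟨ cong₂ (λ x y → exp ½ (suc n) * (B (suc n) + - x + - y) + - (½ * ½) * 0ℚ) 𝑡⋆B≡0 (𝑡-⋆ B′ (suc n)) ⟩
  exp ½ (suc n) * (B (suc n) + - 0ℚ + - (fromℕ (suc n) * B (suc n))) + - (½ * ½) * 0ℚ
    ≡⟨ solve 3 (λ x b n → x :* (b :+ :- con 0ℚ :+ :- (n :* b)) :+ con (- (½ * ½)) :* con 0ℚ := x :* (b :- n :* b)) refl (exp ½ (suc n)) (B (suc n)) (fromℕ (suc n)) ⟩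
  exp ½ (suc n) * (B (suc n) - fromℕ (suc n) * B (suc n)) ∎
  where
    𝑡⋆B≡0 : (𝑡 ⋆ B) (suc n) ≡ 0ℚ
    𝑡⋆B≡0 = trans (𝑡-⋆ B (suc n)) (trans (cong (fromℕ (suc n) *_) Bn≡0) (ℚ.*-zeroʳ (fromℕ (suc n))))

b-recursion : ∀ n → bernoulliCoeff n ≡ δ₀ n - Σ< n (λ i → 1/! (2 +ℕ i) * bernoulliCoeff (n ∸ suc i))
b-recursion n = cong (λ x → δ₀ n - x) (trans (weighted-∑ 2 n) (trans (∑-Σ n (λ i → i) (λ i → bernoulliCoeff (n ∸ suc i) /ℕ ((2 +ℕ i) !)))
  (Σ-cong n λ i _ → /ℕ-inv (bernoulliCoeff (n ∸ suc i)) ((2 +ℕ i) !))))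

-- Binomial coefficients and the expansion of 2ⁿ

binomial : ℕ → ℕ → ℚ
binomial n i = fromℕ (n !) * (1/! i * 1/! (n ∸ i))

!-inverse : ∀ n → fromℕ (n !) * 1/! n ≡ 1ℚ
!-inverse n = inv-inverse (n !) {{n !≢0}}

binomial-zero : ∀ n → binomial n 0 ≡ 1ℚ
binomial-zero n = trans (cong (fromℕ (n !) *_) (ℚ.*-identityˡ (1/! n))) (!-inverse n)

binomial-self : ∀ n → binomial n n ≡ 1ℚ
binomial-self n = trans (cong (λ k → fromℕ (n !) * (1/! n * 1/! k)) (ℕ.n∸n≡0 n))
  (trans (cong (fromℕ (n !) *_) (ℚ.*-identityʳ (1/! n))) (!-inverse n))

1/!-inv : ∀ n → 1/! (suc n) ≡ inv (suc n) * 1/! n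
1/!-inv n = inv-* (suc n) (n !) {{_}} {{n !≢0}}

binomial-suc-suc : ∀ n i → binomial (suc n) (suc i) ≡ fromℕ (suc n) * (inv (suc i) * binomial n i)
binomial-suc-suc n i = trans (cong₂ (λ x y → x * (y * 1/! (n ∸ i))) (fromℕ-* (suc n) (n !)) (1/!-inv i))
  (solve 5 (λ s f v x y → (s :* f) :* ((v :* x) :* y) := s :* (v :* (f :* (x :* y)))) refl
    (fromℕ (suc n)) (fromℕ (n !)) (inv (suc i)) (1/! i) (1/! (n ∸ i)))

⋆-binomial : ∀ f g n → (f ⋆ g) n ≡ Σ< (suc n) (λ i → binomial n i * (f i * g (n ∸ i)))
⋆-binomial f g n = begin
  (f ⋆ g) n
    ≡⟨ sym (ℚ.*-identityʳ ((f ⋆ g) n)) ⟩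
  (f ⋆ g) n * 1ℚ
    ≡⟨ cong ((f ⋆ g) n *_) (sym (!-inverse n)) ⟩
  (f ⋆ g) n * (fromℕ (n !) * 1/! n)
    ≡⟨ solve 3 (λ x a b → x :* (a :* b) := a :* (x :* b)) refl ((f ⋆ g) n) (fromℕ (n !)) (1/! n) ⟩
  fromℕ (n !) * ((f ⋆ g) n * 1/! n)
    ≡⟨ cong (fromℕ (n !) *_) (sym (⋆-Cauchy f g n)) ⟩
  fromℕ (n !) * Σ< (suc n) (λ i → f i * 1/! i * (g (n ∸ i) * 1/! (n ∸ i)))
    ≡⟨ sym (Σ-*ˡ (suc n) (fromℕ (n !)) _) ⟩
  Σ< (suc n) (λ i → fromℕ (n !) * (f i * 1/! i * (g (n ∸ i) * 1/! (n ∸ i))))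
    ≡⟨ Σ-cong (suc n) (λ i _ → solve 5 (λ c x a y b → c :* (x :* a :* (y :* b)) := c :* (a :* b) :* (x :* y)) refl
         (fromℕ (n !)) (f i) (1/! i) (g (n ∸ i)) (1/! (n ∸ i))) ⟩
  Σ< (suc n) (λ i → binomial n i * (f i * g (n ∸ i))) ∎

-- Comparing coefficients in eᵗ eᵗ = e²ᵗ and absorbing C(n + 1, i + 1) = (n + 1)/(i + 1) · C(n, i);
-- for n + 1 = p this exhibits the factor p of 2ᵖ - 2.
exp-2 : ∀ n → exp 2ℚ (suc n) ≡ 2ℚ + fromℕ (suc n) * Σ< n (λ i → inv (suc i) * binomial n i)
exp-2 n = begin
  exp 2ℚ (suc n)
    ≡⟨ sym (exp-⋆-exp 1ℚ 1ℚ (suc n)) ⟩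
  (e ⋆ e) (suc n)
    ≡⟨ ⋆-binomial e e (suc n) ⟩
  Σ< (suc (suc n)) (λ i → binomial (suc n) i * (e i * e (suc n ∸ i)))
    ≡⟨ Σ-cong (suc (suc n)) (λ i _ → trans (cong₂ (λ x y → binomial (suc n) i * (x * y)) (exp-1 i) (exp-1 (suc n ∸ i))) (ℚ.*-identityʳ (binomial (suc n) i))) ⟩
  Σ< (suc n) (binomial (suc n)) + binomial (suc n) (suc n)
    ≡⟨ cong₂ _+_ (Σ-head n (binomial (suc n))) (binomial-self (suc n)) ⟩
  binomial (suc n) 0 + Σ< n (λ i → binomial (suc n) (suc i)) + 1ℚ
    ≡⟨ cong₂ (λ x y → x + y + 1ℚ) (binomial-zero (suc n)) (trans (Σ-cong n λ i _ → binomial-suc-suc n i) (Σ-*ˡ n (fromℕ (suc n)) _)) ⟩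
  1ℚ + fromℕ (suc n) * R + 1ℚ
    ≡⟨ solve 2 (λ n r → con 1ℚ :+ n :* r :+ con 1ℚ := con 2ℚ :+ n :* r) refl (fromℕ (suc n)) R ⟩
  2ℚ + fromℕ (suc n) * R ∎
  where
    R = Σ< n (λ i → inv (suc i) * binomial n i)

-- Bernoulli numbers and binomial coefficients modulo p

module BernoulliModPrime (m : ℕ) (prime : Prime (2 +ℕ m)) where

  open Localisation (2 +ℕ m) prime public

  private
    n p : ℕ
    n = suc m
    p = suc n

  int-1/! : ∀ k → k <ℕ p → Integral (1/! k)
  int-1/! zero    _   = int-1
  int-1/! (suc k) k<p = subst Integral (sym (1/!-inv k)) (int-* (int-inv (suc k) k<p) (int-1/! k (ℕ.<-trans (ℕ.n<1+n k) k<p)))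

  int-exp : ∀ {c} → Integral c → ∀ k → Integral (exp c k)
  int-exp ic zero    = int-1
  int-exp ic (suc k) = int-* ic (int-exp ic k)

  int-δ₀ : ∀ k → Integral (δ₀ k)
  int-δ₀ zero    = int-1
  int-δ₀ (suc _) = int-0

  -- Strong induction with the bound `k`: for j < p - 1 the recursion involves only factorials of
  -- numbers below p.
  int-bernoulliCoeff : ∀ k j → j <ℕ k → k ≤ℕ n → Integral (bernoulliCoeff j)
  int-bernoulliCoeff (suc k) j (s≤s j≤k) k<n = subst Integral (sym (b-recursion j))
    (int-- (int-δ₀ j) (int-Σ j λ i i<j → int-*
      (int-1/! (2 +ℕ i) (s≤s (s≤s (ℕ.<-≤-trans i<j (ℕ.≤-trans j≤k (ℕ.≤-pred k<n))))))
      (int-bernoulliCoeff k (j ∸ suc i) (ℕ.<-≤-trans (∸-suc-< i<j) j≤k) (ℕ.<⇒≤ k<n))))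
    where
      ∸-suc-< : ∀ {i j} → i <ℕ j → j ∸ suc i <ℕ j
      ∸-suc-< {i} {suc j} _ = s≤s (ℕ.m∸n≤m j i)

  int-B : ∀ j → j <ℕ n → Integral (B j)
  int-B j j<n = int-* (int-fromℕ (j !)) (int-bernoulliCoeff n j j<n ℕ.≤-refl)

  -- In the recursion for B₍ₚ₋₁₎/(p - 1)! only the last term b₀/p! is not known to be p-integral,
  -- and p · (p - 1)!/p! = 1. The remaining terms form `T`.
  pB~-1 : fromℕ p * B n ~ - 1ℚ
  pB~-1 = congruent (fromℕ (n !) * - T) (int-* (int-fromℕ (n !)) (int-neg int-T)) (begin
    fromℕ p * (fromℕ (n !) * bernoulliCoeff n) - - 1ℚ
      ≡⟨ cong (λ x → fromℕ p * (fromℕ (n !) * x) - - 1ℚ) (b-recursion n) ⟩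
    fromℕ p * (fromℕ (n !) * (0ℚ - (T + 1/! p * bernoulliCoeff (m ∸ m)))) - - 1ℚ
      ≡⟨ cong (λ k → fromℕ p * (fromℕ (n !) * (0ℚ - (T + 1/! p * bernoulliCoeff k))) - - 1ℚ) (ℕ.n∸n≡0 m) ⟩
    fromℕ p * (fromℕ (n !) * (0ℚ - (T + 1/! p * 1ℚ))) - - 1ℚ
      ≡⟨ solve 4 (λ p f t x → p :* (f :* (con 0ℚ :- (t :+ x :* con 1ℚ))) :- con (- 1ℚ)
           := p :* (f :* :- t) :+ (con 1ℚ :- f :* (p :* x))) refl (fromℕ p) (fromℕ (n !)) T (1/! p) ⟩
    fromℕ p * (fromℕ (n !) * - T) + (1ℚ - fromℕ (n !) * (fromℕ p * 1/! p))
      ≡⟨ cong (λ x → fromℕ p * (fromℕ (n !) * - T) + (1ℚ - x)) (trans (cong (fromℕ (n !) *_) (1/!-suc n)) (!-inverse n)) ⟩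
    fromℕ p * (fromℕ (n !) * - T) + 0ℚ
      ≡⟨ ℚ.+-identityʳ _ ⟩
    fromℕ p * (fromℕ (n !) * - T) ∎)
    where
      T : ℚ
      T = Σ< m (λ i → 1/! (2 +ℕ i) * bernoulliCoeff (m ∸ i))
      int-T : Integral T
      int-T = int-Σ m λ i i<m → int-* (int-1/! (2 +ℕ i) (s≤s (s≤s i<m)))
        (int-bernoulliCoeff n (m ∸ i) (s≤s (ℕ.m∸n≤m m i)) ℕ.≤-refl)

  -- Consecutive coefficients have ratio (p - 1 - i)/(i + 1) ≡ -1.
  binomial~±1 : ∀ i → i ≤ℕ n → binomial n i ~ exp (- 1ℚ) i
  binomial~±1 zero    _   = ~-reflexive (binomial-zero n)
  binomial~±1 (suc i) i<n = subst (_~ - 1ℚ * exp (- 1ℚ) i) (sym step)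
    (~-* (int-resp-~ ratio~-1 (int-neg int-1)) (int-exp (int-neg int-1) i) ratio~-1 (binomial~±1 i (ℕ.<⇒≤ i<n)))
    where
      k : ℕ
      k = n ∸ suc i
      sum≡p : suc i +ℕ suc k ≡ p
      sum≡p = trans (ℕ.+-suc (suc i) k) (cong suc (ℕ.m+[n∸m]≡n i<n))
      ratio~-1 : inv (suc i) * fromℕ (suc k) ~ - 1ℚ
      ratio~-1 = congruent (inv (suc i)) (int-inv (suc i) (s≤s i<n)) (begin
        inv (suc i) * fromℕ (suc k) - - 1ℚ
          ≡⟨ cong (λ x → inv (suc i) * fromℕ (suc k) - - x) (sym (inv-inverse (suc i))) ⟩
        inv (suc i) * fromℕ (suc k) - - (fromℕ (suc i) * inv (suc i))
          ≡⟨ solve 3 (λ v a b → v :* b :- :- (a :* v) := (a :+ b) :* v) refl (inv (suc i)) (fromℕ (suc i)) (fromℕ (suc k)) ⟩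
        (fromℕ (suc i) + fromℕ (suc k)) * inv (suc i)
          ≡⟨ cong (_* inv (suc i)) (trans (sym (fromℕ-+ (suc i) (suc k))) (cong fromℕ sum≡p)) ⟩
        fromℕ p * inv (suc i) ∎)
      step : binomial n (suc i) ≡ inv (suc i) * fromℕ (suc k) * binomial n i
      step = begin
        fromℕ (n !) * (1/! (suc i) * 1/! k)
          ≡⟨ cong₂ (λ x y → fromℕ (n !) * (x * y)) (1/!-inv i) (sym (1/!-suc k)) ⟩
        fromℕ (n !) * (inv (suc i) * 1/! i * (fromℕ (suc k) * 1/! (suc k)))
          ≡⟨ solve 5 (λ f v x s y → f :* (v :* x :* (s :* y)) := v :* s :* (f :* (x :* y))) refl
               (fromℕ (n !)) (inv (suc i)) (1/! i) (fromℕ (suc k)) (1/! (suc k)) ⟩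
        inv (suc i) * fromℕ (suc k) * (fromℕ (n !) * (1/! i * 1/! (suc k)))
          ≡⟨ cong (λ l → inv (suc i) * fromℕ (suc k) * (fromℕ (n !) * (1/! i * 1/! l))) (sym (ℕ.+-∸-assoc 1 i<n)) ⟩
        inv (suc i) * fromℕ (suc k) * binomial n i ∎

-- The left-hand side

exp-inv : ∀ n → inv (2 ^ n) ≡ exp ½ n
exp-inv zero    = refl
exp-inv (suc n) = trans (inv-* 2 (2 ^ n) {{_}} {{ℕ.m^n≢0 2 n}}) (cong (½ *_) (exp-inv n))

-- `odd` states (-1)ᵖ⁻² = -1, the form in which oddness of p makes B₍ₚ₋₂₎ vanish.
module LeftHandSide (M : ℕ) (prime : Prime (5 +ℕ M)) (odd : exp (- 1ℚ) (3 +ℕ M) ≡ - 1ℚ) where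

  open BernoulliModPrime (3 +ℕ M) prime

  private
    n p : ℕ
    n = 4 +ℕ M
    p = suc n

    B[p-2]≡0 : B (3 +ℕ M) ≡ 0ℚ
    B[p-2]≡0 = B-odd (suc M) odd

    x y R : ℚ
    x = exp 2ℚ n
    y = exp ½ n
    R = Σ< n (λ i → inv (suc i) * binomial n i)

    term : ℕ → ℚ
    term i = rescale ½ B i * B (n ∸ i)

    L : ℚ
    L = Σ< (suc M) (λ i → term (2 +ℕ i))

    L-∑ : ∑[ j ∈ 2 ⋯ 2 +ℕ M ] B j /ℕ (2 ^ j) * B (n ∸ j) ≡ L
    L-∑ = trans (∑-Σ (suc M) (2 +ℕ_) (λ j → B j /ℕ (2 ^ j) * B (n ∸ j)))
      (Σ-cong (suc M) λ i _ → cong (_* B (n ∸ (2 +ℕ i)))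
        (trans (/ℕ-inv (B (2 +ℕ i)) (2 ^ (2 +ℕ i))) (cong (_* B (2 +ℕ i)) (exp-inv (2 +ℕ i)))))

    int-½ : Integral ½
    int-½ = int-inv 2 (s≤s (s≤s (s≤s z≤n)))

    x*y≡1 : x * y ≡ 1ℚ
    x*y≡1 = trans (sym (exp-* 2ℚ ½ n)) (exp-1 n)

    -- ½ R is the Fermat quotient (2ᵖ⁻¹ - 1)/p.
    x-1 : x - 1ℚ ≡ fromℕ p * (½ * R)
    x-1 = begin
      x - 1ℚ                              ≡⟨ solve 1 (λ x → x :- con 1ℚ := con ½ :* (con 2ℚ :* x :- con 2ℚ)) refl x ⟩
      ½ * (2ℚ * x - 2ℚ)                   ≡⟨ cong (λ z → ½ * (z - 2ℚ)) (exp-2 n) ⟩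
      ½ * (2ℚ + fromℕ p * R - 2ℚ)         ≡⟨ solve 2 (λ p r → con ½ :* (con 2ℚ :+ p :* r :- con 2ℚ) := p :* (con ½ :* r)) refl (fromℕ p) R ⟩
      fromℕ p * (½ * R)                   ∎

    R~ : R ~ Σ< n (λ i → inv (suc i) * exp (- 1ℚ) i)
    R~ = ~-Σ n λ i i<n → ~-*ˡ (int-inv (suc i) (s≤s i<n)) (binomial~±1 i (ℕ.<⇒≤ i<n))

    int-R : Integral R
    int-R = int-resp-~ R~ (int-Σ n λ i i<n → int-* (int-inv (suc i) (s≤s i<n)) (int-exp (int-neg int-1) i))

    -- The binomial coefficient becomes (-1)ʲ, which Bⱼ absorbs since j ≥ 2; all Bernoulli numbers
    -- involved have index at most p - 3 and are p-integral.
    middle~ : Σ< (suc M) (λ i → binomial n (2 +ℕ i) * term (2 +ℕ i)) ~ L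
    middle~ = ~-Σ (suc M) λ { i (s≤s i≤M) → subst (binomial n (2 +ℕ i) * term (2 +ℕ i) ~_)
      (trans (solve 4 (λ s h b c → s :* (h :* b :* c) := h :* (s :* b) :* c) refl (exp (- 1ℚ) (2 +ℕ i)) (exp ½ (2 +ℕ i)) (B (2 +ℕ i)) (B (n ∸ (2 +ℕ i))))
        (cong (λ z → exp ½ (2 +ℕ i) * z * B (n ∸ (2 +ℕ i))) (B-symmetric i)))
      (~-*ʳ (int-* (int-* (int-exp int-½ (2 +ℕ i)) (int-B (2 +ℕ i) (s≤s (s≤s (s≤s (ℕ.≤-trans i≤M (ℕ.n≤1+n M)))))))
          (int-B (n ∸ (2 +ℕ i)) (s≤s (ℕ.≤-trans (ℕ.m∸n≤m (2 +ℕ M) i) (ℕ.n≤1+n (2 +ℕ M))))))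
        (binomial~±1 (2 +ℕ i) (s≤s (s≤s (ℕ.≤-trans i≤M (ℕ.m≤n+m M 2)))))) }

    Mid : ℚ
    Mid = Σ< (suc M) (λ i → binomial n (2 +ℕ i) * term (2 +ℕ i))

    -- The terms j = 0 and j = p - 1 are split off, and those for j = 1 and j = p - 2 contain the
    -- factor B₍ₚ₋₂₎ = 0.
    convolution : (rescale ½ B ⋆ B) n ≡ B n + Mid + y * B n
    convolution = begin
      (rescale ½ B ⋆ B) n
        ≡⟨ ⋆-binomial (rescale ½ B) B n ⟩
      Σ< (3 +ℕ M) T + T (3 +ℕ M) + T (4 +ℕ M)
        ≡⟨ cong (λ s → s + T (3 +ℕ M) + T (4 +ℕ M)) (trans (Σ-head (2 +ℕ M) T) (cong (T 0 +_) (Σ-head (suc M) (T ∘ suc)))) ⟩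
      T 0 + (T 1 + Mid) + T (3 +ℕ M) + T (4 +ℕ M)
        ≡⟨ cong₂ _+_ (cong₂ (λ a b → a + b + T (3 +ℕ M)) T₀ (cong (_+ Mid) T₁)) T₄ ⟩
      B n + (0ℚ + Mid) + T (3 +ℕ M) + y * B n
        ≡⟨ cong (λ z → B n + (0ℚ + Mid) + z + y * B n) T₃ ⟩
      B n + (0ℚ + Mid) + 0ℚ + y * B n
        ≡⟨ solve 3 (λ b m z → b :+ (con 0ℚ :+ m) :+ con 0ℚ :+ z := b :+ m :+ z) refl (B n) Mid (y * B n) ⟩
      B n + Mid + y * B n ∎
      where
        T : ℕ → ℚ
        T i = binomial n i * term i
        T₀ : T 0 ≡ B n
        T₀ = trans (cong (_* (1ℚ * B 0 * B n)) (binomial-zero n))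
          (solve 1 (λ b → con 1ℚ :* (con (1ℚ * B 0) :* b) := b) refl (B n))
        T₁ : T 1 ≡ 0ℚ
        T₁ = trans (cong (λ z → binomial n 1 * (rescale ½ B 1 * z)) B[p-2]≡0)
          (solve 2 (λ c g → c :* (g :* con 0ℚ) := con 0ℚ) refl (binomial n 1) (rescale ½ B 1))
        T₃ : T (3 +ℕ M) ≡ 0ℚ
        T₃ = trans (cong (λ z → binomial n (3 +ℕ M) * (exp ½ (3 +ℕ M) * z * B (n ∸ (3 +ℕ M)))) B[p-2]≡0)
          (solve 3 (λ c h b → c :* (h :* con 0ℚ :* b) := con 0ℚ) refl (binomial n (3 +ℕ M)) (exp ½ (3 +ℕ M)) (B (n ∸ (3 +ℕ M))))
        T₄ : T (4 +ℕ M) ≡ y * B n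
        T₄ = trans (cong₂ (λ c k → c * (y * B n * B k)) (binomial-self n) (ℕ.n∸n≡0 n))
          (solve 2 (λ y b → con 1ℚ :* (y :* b :* con (B 0)) := y :* b) refl y (B n))

    Mid-exact : Mid ≡ fromℕ p * B n * - (y * (1ℚ + ½ * R))
    Mid-exact = solve-for-m Mid (B n) x y (fromℕ n) (fromℕ p) (½ * R)
      (trans (sym convolution) (½⋆B-coefficient (3 +ℕ M) B[p-2]≡0)) x*y≡1 x-1 (fromℕ-suc n)
      where
        solve-for-m : ∀ m b x y n p h → b + m + y * b ≡ y * (b - n * b) → x * y ≡ 1ℚ → x - 1ℚ ≡ p * h → p ≡ 1ℚ + n →
                      m ≡ p * b * - (y * (1ℚ + h))
        solve-for-m m b x y n p h conv xy≡1 x-1≡ph refl = begin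
          m
            ≡⟨ solve 3 (λ m b y → m := (b :+ m :+ y :* b) :- con 1ℚ :* b :- y :* b) refl m b y ⟩
          (b + m + y * b) - 1ℚ * b - y * b
            -- Replacing the coefficient 1 of `b` by x y with x = 1 + p h makes the total
            -- coefficient of `b` a multiple of p = 1 + n.
            ≡⟨ cong₂ (λ s t → s - t * b - y * b) conv (sym xy≡1) ⟩
          y * (b - n * b) - x * y * b - y * b
            ≡⟨ cong (λ x → y * (b - n * b) - x * y * b - y * b) (trans (solve 1 (λ x → x := (x :- con 1ℚ) :+ con 1ℚ) refl x) (cong (_+ 1ℚ) x-1≡ph)) ⟩
          y * (b - n * b) - (p * h + 1ℚ) * y * b - y * b
            ≡⟨ solve 4 (λ b y n h → y :* (b :- n :* b) :- ((con 1ℚ :+ n) :* h :+ con 1ℚ) :* y :* b :- y :* b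
                 := (con 1ℚ :+ n) :* b :* :- (y :* (con 1ℚ :+ h))) refl b y n h ⟩
          p * b * - (y * (1ℚ + h)) ∎

    y~1 : y ~ 1ℚ
    y~1 = ~-sym (congruent (½ * R * y) (int-* (int-* int-½ int-R) (int-exp int-½ n)) (begin
      1ℚ - y                          ≡⟨ cong (_- y) (sym x*y≡1) ⟩
      x * y - y                       ≡⟨ solve 2 (λ x y → x :* y :- y := (x :- con 1ℚ) :* y) refl x y ⟩
      (x - 1ℚ) * y                    ≡⟨ cong (_* y) x-1 ⟩
      fromℕ p * (½ * R) * y           ≡⟨ ℚ.*-assoc (fromℕ p) (½ * R) y ⟩
      fromℕ p * (½ * R * y)           ∎))

  int-alternating : Integral (Σ< n (λ i → inv (suc i) * exp (- 1ℚ) i))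
  int-alternating = int-resp-~ (~-sym R~) int-R

  Bernoulli-sum~ : ∑[ j ∈ 2 ⋯ 2 +ℕ M ] B j /ℕ (2 ^ j) * B (n ∸ j) ~ 1ℚ + ½ * Σ< n (λ i → inv (suc i) * exp (- 1ℚ) i)
  Bernoulli-sum~ = subst₂ _~_ (sym L-∑) (solve 1 (λ r → con (- 1ℚ) :* :- (con 1ℚ :* (con 1ℚ :+ con ½ :* r)) := con 1ℚ :+ con ½ :* r) refl (Σ< n (λ i → inv (suc i) * exp (- 1ℚ) i)))
    (~-trans (~-sym middle~) (~-trans (~-reflexive Mid-exact)
      (~-* (int-resp-~ pB~-1 (int-neg int-1)) (int-neg (int-* int-1 (int-+ int-1 (int-* int-½ int-alternating)))) pB~-1
        (~-neg (~-* (int-exp int-½ n) (int-+ int-1 (int-* int-½ int-alternating)) y~1 (~-+ (~-refl {1ℚ}) (~-*ˡ int-½ R~)))))))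

-- Parity of p and comparison of the two sides

exp-±1-even : ∀ n → exp (- 1ℚ) (2 *ℕ n) ≡ 1ℚ
exp-±1-even zero    = refl
exp-±1-even (suc n) = trans (cong (exp (- 1ℚ)) (2*suc n))
  (trans (cong (λ x → - 1ℚ * (- 1ℚ * x)) (exp-±1-even n)) refl)

parity : ∀ n → (∃ λ k → n ≡ 2 *ℕ k) ⊎ (∃ λ k → n ≡ suc (2 *ℕ k))
parity zero    = inj₁ (0 , refl)
parity (suc n) with parity n
... | inj₁ (k , n≡2k)   = inj₂ (k , cong suc n≡2k)
... | inj₂ (k , n≡1+2k) = inj₁ (suc k , trans (cong suc n≡1+2k) (sym (2*suc k)))

2∤odd : ∀ n → ¬ 2 ∣ suc (2 *ℕ n)
2∤odd n 2∣1+2n = contradiction (∣1⇒≡1 (∣m+n∣m⇒∣n (subst (2 ∣_) (ℕ.+-comm 1 (2 *ℕ n)) 2∣1+2n) (m∣m*n n))) λ ()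

odd-prime : ∀ {p} → Prime p → p ≥ 5 → ∃ λ k → p ≡ suc (2 *ℕ suc (suc k))
odd-prime {p} p-prime p≥5 with parity p
... | inj₁ (k , p≡2k) with prime⇒irreducible p-prime (divides k (trans p≡2k (ℕ.*-comm 2 k)))
...   | inj₂ 2≡p = contradiction (subst (_≥ 5) (sym 2≡p) p≥5) λ { (s≤s (s≤s ())) }
odd-prime p-prime p≥5 | inj₂ (zero        , refl) = contradiction p≥5 λ { (s≤s ()) }
odd-prime p-prime p≥5 | inj₂ (suc zero    , refl) = contradiction p≥5 λ { (s≤s (s≤s (s≤s ()))) }
odd-prime p-prime p≥5 | inj₂ (suc (suc k) , p≡)   = k , p≡

-- The left-hand side was computed for p of the form 5 + M, the right-hand side for 2 N + 1; taking
-- the equation as an argument lets both speak of the same p.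
left-hand-side : ∀ p (prime : Prime p) M → p ≡ 5 +ℕ M → exp (- 1ℚ) (3 +ℕ M) ≡ - 1ℚ → let open Localisation p prime in
  ∑[ j ∈ 2 ⋯ p ∸ 3 ] B j /ℕ (2 ^ j) * B (p ∸ 1 ∸ j) ~ 1ℚ + ½ * Σ< (p ∸ 1) (λ i → inv (suc i) * exp (- 1ℚ) i)
left-hand-side p p-prime M refl odd = LeftHandSide.Bernoulli-sum~ M p-prime odd

half-double : ∀ n → (2 *ℕ n) /₀ 2 ≡ n
half-double n = trans (cong (_/₀ 2) (ℕ.*-comm 2 n)) (m*n/n≡m n 2)

-- The right-hand side without its two digits.
rhs : ℚ → ℚ → ℚ → ℚ → ℚ
rhs s a b c = - 1ℚ + fromℕ 6 * s + fromℕ 4 * a - fromℕ 4 * b - fromℕ 4 * (s * s) + fromℕ 2 * c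

module Comparison (k : ℕ) (prime : Prime (suc (2 *ℕ suc (suc k)))) where

  open RightHandSide k prime
  open OddPrime (suc (suc k)) prime (s≤s (s≤s z≤n)) hiding (p)

  private
    N = suc (suc k)
    p = suc (2 *ℕ N)

    p≡5+2k : p ≡ 5 +ℕ 2 *ℕ k
    p≡5+2k = cong suc (trans (2*suc (suc k)) (cong (suc ∘ suc) (2*suc k)))

  h≡ : (p ∸ 3) /₀ 2 ≡ suc k
  h≡ = trans (cong (λ q → (q ∸ 3) /₀ 2) p≡5+2k) (trans (cong (_/₀ 2) (sym (2*suc k))) (half-double (suc k)))

  S≡ : ∑[ m ∈ odds (1 ⋯ p ∸ 1) ] H m ≡ S
  S≡ = ∑-odds N suc H 2∤odd (λ i → divides (suc i) (trans (sym (2*suc i)) (ℕ.*-comm 2 (suc i))))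

  -- The even denominators carry the minus sign, so the alternating sum is O - E ≡ 2 O.
  alternating~O : ½ * Σ< (2 *ℕ N) (λ i → inv (suc i) * exp (- 1ℚ) i) ~ O
  alternating~O = ~-from (~-*ˡ (int-inv 2 2<p) (~-+ (~-refl {O}) (~-neg E~-O)))
    (trans (cong (λ s → ½ * s - O) alternating≡) (solve 2 (λ o e → con ½ :* (o :- e) :- o := con ½ :* (o :+ :- e) :- con ½ :* (o :+ :- :- o)) refl O E))
    where
      E~-O : E ~ - O
      E~-O = ~-from (~-neg (~-sym O~-E)) (solve 2 (λ o e → e :- :- o := :- :- e :- :- o) refl O E)
      alternating≡ : Σ< (2 *ℕ N) (λ i → inv (suc i) * exp (- 1ℚ) i) ≡ O - E
      alternating≡ = trans (Σ-pairs N _) (cong₂ _+_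
        (Σ-cong N λ i _ → trans (cong (odd-inv i *_) (exp-±1-even i)) (ℚ.*-identityʳ (odd-inv i)))
        (trans (Σ-cong N λ i _ → trans (cong (λ x → even-inv i * (- 1ℚ * x)) (exp-±1-even i)) (solve 1 (λ x → x :* con (- 1ℚ * 1ℚ) := :- x) refl (even-inv i)))
          (Σ-neg N even-inv)))

  lhs~ : ∑[ j ∈ 2 ⋯ p ∸ 3 ] B j /ℕ (2 ^ j) * B (p ∸ 1 ∸ j) ~ O + 1ℚ
  lhs~ = ~-trans (left-hand-side p prime (2 *ℕ k) p≡5+2k (cong (λ x → - 1ℚ * (- 1ℚ * (- 1ℚ * x))) (exp-±1-even k)))
    (subst (1ℚ + ½ * Σ< (2 *ℕ N) (λ i → inv (suc i) * exp (- 1ℚ) i) ~_) (ℚ.+-comm 1ℚ O) (~-+ (~-refl {1ℚ}) alternating~O))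

  rhs~ : let h = (p ∸ 3) /₀ 2 in
    rhs (∑[ m ∈ odds (1 ⋯ p ∸ 1) ] H m) (∑[ m ∈ 1 ⋯ h ] H^[ 2 ] (2 *ℕ m)) (∑[ m ∈ 1 ⋯ h ] H (2 *ℕ m) * H (2 *ℕ m +ℕ 1))
        (∑[ m ∈ 2 ⋯ h ] (∑[ i ∈ 1 ⋯ 2 *ℕ m ∸ 1 ] H i /ℕ (2 *ℕ m ∸ i))) ~ O + 1ℚ
  rhs~ = subst (_~ O + 1ℚ) (sym eq) main-terms
    where
      a b c : ℕ → ℚ
      a h = ∑[ m ∈ 1 ⋯ h ] H^[ 2 ] (2 *ℕ m)
      b h = ∑[ m ∈ 1 ⋯ h ] H (2 *ℕ m) * H (2 *ℕ m +ℕ 1)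
      c h = ∑[ m ∈ 2 ⋯ h ] (∑[ i ∈ 1 ⋯ 2 *ℕ m ∸ 1 ] H i /ℕ (2 *ℕ m ∸ i))
      s : ℚ
      s = ∑[ m ∈ odds (1 ⋯ p ∸ 1) ] H m
      eq : rhs s (a ((p ∸ 3) /₀ 2)) (b ((p ∸ 3) /₀ 2)) (c ((p ∸ 3) /₀ 2))
           ≡ rhs S (Z - O₂) (Q - W) (Q - (W + W) + O₂ - (Z - O₂) - 1ℚ)
      eq = begin
        rhs s (a ((p ∸ 3) /₀ 2)) (b ((p ∸ 3) /₀ 2)) (c ((p ∸ 3) /₀ 2))
          ≡⟨ cong (λ h → rhs s (a h) (b h) (c h)) h≡ ⟩
        rhs s (a (suc k)) (b (suc k)) (c (suc k))
          ≡⟨ cong (λ s → rhs s (a (suc k)) (b (suc k)) (c (suc k))) S≡ ⟩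
        rhs S (a (suc k)) (b (suc k)) (c (suc k))
          ≡⟨ cong (λ z → rhs S z (b (suc k)) (c (suc k))) Σ-H²-even ⟩
        rhs S (Z - O₂) (b (suc k)) (c (suc k))
          ≡⟨ cong₂ (rhs S (Z - O₂)) Σ-H-H Σ-conv-even ⟩
        rhs S (Z - O₂) (Q - W) (Q - (W + W) + O₂ - (Z - O₂) - 1ℚ) ∎

comparison : ∀ p (p-prime : Prime p) k → p ≡ suc (2 *ℕ suc (suc k)) →
  let open Localisation p p-prime
      S = ∑[ m ∈ odds (1 ⋯ p ∸ 1) ] H m
      h = (p ∸ 3) /₀ 2
  in Integral S × ∃ λ o → Integral o ×
     (∑[ j ∈ 2 ⋯ p ∸ 3 ] B j /ℕ (2 ^ j) * B (p ∸ 1 ∸ j)) ~ o ×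
     rhs S (∑[ m ∈ 1 ⋯ h ] H^[ 2 ] (2 *ℕ m)) (∑[ m ∈ 1 ⋯ h ] H (2 *ℕ m) * H (2 *ℕ m +ℕ 1))
         (∑[ m ∈ 2 ⋯ h ] (∑[ i ∈ 1 ⋯ 2 *ℕ m ∸ 1 ] H i /ℕ (2 *ℕ m ∸ i))) ~ o
comparison _ p-prime k refl = subst Integral (sym S≡) int-S , O + 1ℚ , int-+ int-O int-1 , lhs~ , rhs~
  where
    open OddPrime (suc (suc k)) p-prime (s≤s (s≤s z≤n)) using (Integral; O; int-S; int-O; int-+; int-1)
    open Comparison k p-prime

module Conclusion (p : ℕ) (prime : Prime p) where

  open Localisation p prime

  -- The digit terms add up to 0 modulo p, so both sides are congruent to the p-integral `o`, which
  -- also makes the full right-hand side p-integral.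
  conclude : ∀ s l d₁ d₂ a b c → d₁ + d₂ ~ 0ℚ → (∃ λ o → Integral o × l ~ o × rhs s a b c ~ o) →
    l ≡ - 1ℚ + d₁ + d₂ + fromℕ 6 * s + fromℕ 4 * a - fromℕ 4 * b - fromℕ 4 * (s * s) + fromℕ 2 * c [mod p ]
  conclude s l d₁ d₂ a b c digits (o , int-o , l~o , r~o) = ~⇒≡mod (int-resp-~ right int-o) (~-trans l~o (~-sym right))
    where
      right : - 1ℚ + d₁ + d₂ + fromℕ 6 * s + fromℕ 4 * a - fromℕ 4 * b - fromℕ 4 * (s * s) + fromℕ 2 * c ~ o
      right = subst₂ _~_
        (solve 6 (λ s d e a b c →
           (d :+ e) :+ (con (- 1ℚ) :+ con (fromℕ 6) :* s :+ con (fromℕ 4) :* a :- con (fromℕ 4) :* b :- con (fromℕ 4) :* (s :* s) :+ con (fromℕ 2) :* c)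
           := con (- 1ℚ) :+ d :+ e :+ con (fromℕ 6) :* s :+ con (fromℕ 4) :* a :- con (fromℕ 4) :* b :- con (fromℕ 4) :* (s :* s) :+ con (fromℕ 2) :* c)
           refl s d₁ d₂ a b c)
        (ℚ.+-identityˡ o) (~-+ digits r~o)

theorem1 : (p : ℕ) → Prime p → p ≥ 5 →
    let S = ∑[ m ∈ odds (1 ⋯ p ∸ 1) ] H m
        h = (p ∸ 3) /₀ 2
    in
    (∑[ j ∈ 2 ⋯ p ∸ 3 ] B j /ℕ (2 ^ j) * B (p ∸ 1 ∸ j))
      ≡ - 1ℚ
        + fromℕ 2 * fromℕ (digit p 1 (fromℕ (digit p 0 (fromℕ 2 * S)) /ℕ 2))
        + fromℕ (digit p 1 (fromℕ 2 * fromℕ (digit p 0 S)))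
        + fromℕ 6 * S
        + fromℕ 4 * (∑[ m ∈ 1 ⋯ h ] H^[ 2 ] (2 *ℕ m))
        - fromℕ 4 * (∑[ m ∈ 1 ⋯ h ] H (2 *ℕ m) * H (2 *ℕ m +ℕ 1))
        - fromℕ 4 * (S * S)
        + fromℕ 2 * (∑[ m ∈ 2 ⋯ h ] (∑[ i ∈ 1 ⋯ 2 *ℕ m ∸ 1 ] H i /ℕ (2 *ℕ m ∸ i)))
      [mod p ]
theorem1 p p-prime p≥5 =
  -- S is η-contracted as in the elaborated goal; otherwise the conversion check unfolds digit and diverges.
  let S = ∑ (odds (1 ⋯ p ∸ 1)) H
      h = (p ∸ 3) /₀ 2
      k , p≡ = odd-prime p-prime p≥5
      int-S , both-sides = comparison p p-prime k p≡
      digits = Digits.digits-cancel p p-prime (suc (suc k)) p≡ (ℕ.≤-trans (s≤s (s≤s (s≤s z≤n))) p≥5) S int-S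
      congruence = Conclusion.conclude p p-prime S (∑[ j ∈ 2 ⋯ p ∸ 3 ] B j /ℕ (2 ^ j) * B (p ∸ 1 ∸ j))
        (fromℕ 2 * fromℕ (digit p 1 (fromℕ (digit p 0 (fromℕ 2 * S)) /ℕ 2))) (fromℕ (digit p 1 (fromℕ 2 * fromℕ (digit p 0 S))))
        (∑[ m ∈ 1 ⋯ h ] H^[ 2 ] (2 *ℕ m)) (∑[ m ∈ 1 ⋯ h ] H (2 *ℕ m) * H (2 *ℕ m +ℕ 1))
        (∑[ m ∈ 2 ⋯ h ] (∑[ i ∈ 1 ⋯ 2 *ℕ m ∸ 1 ] H i /ℕ (2 *ℕ m ∸ i)))
        digits both-sides
  in congruence
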